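{- Let $G$ be a bipartite graph of type $(2,n)$, i.e. a (not necessarily complete) bipartite graph whose two parts have $2$ and $n$ vertices. Then all complex roots of the Ehrhart polynomial $H_G$ of the symmetric edge polytope $P_G$ lie on the line $R=\{z\in\mathbb{C}:\operatorname{Re}(z)=-\tfrac12\}$.
   Context: For a finite simple undirected graph $G=(V,E)$, let $\mathbb{Z}^{|V|}$ be the lattice with basis $(e_v)_{v\in V}$. The symmetric edge polytope $P_G\subset\mathbb{R}^{|V|}$ is the convex hull of all vectors $e_{v_1}-e_{v_2}$ with $\{v_1,v_2\}\in E$ (both orders, so each edge contributes $\pm(e_{v_1}-e_{v_2})$). If $G$ has no edges, $P_G$ is taken to be $\{0\}$. The Ehrhart polynomial $H_G$ is the polynomial with $H_G(s)=|sP_G\cap\mathbb{Z}^{|V|}|$ for all integers $s\ge 0$. -}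

module Defs where

open import Data.Bool.Base using (if_then_else_)
open import Data.Fin.Base using (Fin)
import Data.Fin.Properties as Fin
open import Data.Fin.Subset using (Subset; ∁) renaming (_∈_ to _∈ˢ_; ∣_∣ to ∣_∣ˢ)
open import Data.Integer.Base using (ℤ; +_)
open import Data.List.Base using (List; length; foldr)
open import Data.List.Membership.Propositional using (_∈_)
open import Data.List.Relation.Unary.Unique.Propositional using (Unique)
open import Data.Nat.Base as ℕ using (ℕ)
import Data.Nat.Properties as ℕ
open import Data.Product.Base using (_×_; _,_; ∃; ∃-syntax; ∃₂)
open import Data.Rational.Base
open import Data.Rational.Properties
open import Data.Rational.Solver using (module +-*-Solver)
open import Data.Sum.Base using (_⊎_)
open import Data.Vec.Base using (Vec; lookup)
import Data.Vec.Functional as Vector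
open import Function.Bundles using (_⇔_)
open import Level using (0ℓ)
open import Relation.Binary.Core using (Rel)
open import Relation.Binary.Definitions using (Decidable; Symmetric; Irreflexive)
open import Relation.Binary.PropositionalEquality
  using (_≡_; refl; sym; trans; cong; cong₂; subst)
open import Relation.Nullary using (¬_; does)
open import Relation.Unary using (Pred)

-- Real numbers are Cauchy sequences of rationals under the setoid equality
-- _≈_ (the difference tends to 0), with pointwise operations.

CauchySequence : (ℕ → ℚ) → Set
CauchySequence x = ∀ ε → 0ℚ < ε →
  ∃[ N ] (∀ m n → N ℕ.≤ m → N ℕ.≤ n → ∣ x m - x n ∣ < ε)

record ℝ : Set where
  constructor mkℝ
  field
    seq    : ℕ → ℚ
    cauchy : CauchySequence seq

open ℝ public

infix  4 _≈_ _≤ᴿ_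
infixl 6 _+ᴿ_ _-ᴿ_
infixl 7 _*ᴿ_
infix  8 -ᴿ_

-- Records rather than functions, so that x and y can be inferred.
record _≈_ (x y : ℝ) : Set where
  constructor mk≈
  field
    converges : ∀ ε → 0ℚ < ε →
      ∃[ N ] (∀ n → N ℕ.≤ n → ∣ seq x n - seq y n ∣ < ε)

record _≤ᴿ_ (x y : ℝ) : Set where
  constructor mk≤ᴿ
  field
    eventually : ∀ ε → 0ℚ < ε →
      ∃[ N ] (∀ n → N ℕ.≤ n → seq x n < seq y n + ε)

open _≈_ public
open _≤ᴿ_ public

private
  open +-*-Solver using (solve; _:=_; _:+_; _:*_; _:-_)

  ½ε+½ε≡ε : ∀ ε → ½ * ε + ½ * ε ≡ ε
  ½ε+½ε≡ε ε = trans (sym (*-distribʳ-+ ε ½ ½)) (*-identityˡ ε)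

  0<½ε : ∀ {ε} → 0ℚ < ε → 0ℚ < ½ * ε
  0<½ε {ε} 0<ε = positive⁻¹ (½ * ε) {{pos*pos⇒pos ½ ε {{positive 0<ε}}}}

  const-cauchy : ∀ q → CauchySequence (λ _ → q)
  const-cauchy q ε 0<ε = 0 , λ _ _ _ _ →
    subst (_< ε) (sym (cong ∣_∣ (+-inverseʳ q))) 0<ε

  +-cauchy : ∀ {x y} → CauchySequence x → CauchySequence y →
             CauchySequence (λ n → x n + y n)
  +-cauchy {x} {y} cx cy ε 0<ε with cx (½ * ε) (0<½ε 0<ε) | cy (½ * ε) (0<½ε 0<ε)
  ... | M , hx | N , hy = M ℕ.⊔ N , λ m n m≥ n≥ → begin-strict
    ∣ (x m + y m) - (x n + y n) ∣     ≡⟨ cong ∣_∣ (regroup (x m) (y m) (x n) (y n)) ⟩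
    ∣ (x m - x n) + (y m - y n) ∣     ≤⟨ ∣p+q∣≤∣p∣+∣q∣ (x m - x n) (y m - y n) ⟩
    ∣ x m - x n ∣ + ∣ y m - y n ∣     <⟨ +-mono-< (hx m n (ℕ.m⊔n≤o⇒m≤o M N m≥) (ℕ.m⊔n≤o⇒m≤o M N n≥))
                                                  (hy m n (ℕ.m⊔n≤o⇒n≤o M N m≥) (ℕ.m⊔n≤o⇒n≤o M N n≥)) ⟩
    ½ * ε + ½ * ε                     ≡⟨ ½ε+½ε≡ε ε ⟩
    ε                                 ∎
    where
    open ≤-Reasoning
    regroup : ∀ a b c d → (a + b) - (c + d) ≡ (a - c) + (b - d)
    regroup = solve 4 (λ a b c d → (a :+ b) :- (c :+ d) := (a :- c) :+ (b :- d)) refl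

  neg-cauchy : ∀ {x} → CauchySequence x → CauchySequence (λ n → - x n)
  neg-cauchy {x} cx ε 0<ε with cx ε 0<ε
  ... | N , h = N , λ m n m≥ n≥ →
    subst (_< ε) (trans (sym (∣-p∣≡∣p∣ (x m - x n))) (cong ∣_∣ (neg-distrib-+ (x m) (- x n))))
      (h m n m≥ n≥)

  eventually-bounded : ∀ {x} → CauchySequence x →
    ∃₂ λ N K → 0ℚ < K × (∀ n → N ℕ.≤ n → ∣ x n ∣ < K)
  eventually-bounded {x} cx with cx 1ℚ (positive⁻¹ 1ℚ)
  ... | N , h = N , 1ℚ + ∣ x N ∣
              , +-mono-<-≤ (positive⁻¹ 1ℚ) (0≤∣p∣ (x N))
              , λ n n≥ → begin-strict
      ∣ x n ∣                    ≡⟨ cong ∣_∣ (split (x n) (x N)) ⟩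
      ∣ (x n - x N) + x N ∣      ≤⟨ ∣p+q∣≤∣p∣+∣q∣ (x n - x N) (x N) ⟩
      ∣ x n - x N ∣ + ∣ x N ∣    <⟨ +-monoˡ-< ∣ x N ∣ (h n N n≥ ℕ.≤-refl) ⟩
      1ℚ + ∣ x N ∣               ∎
    where
    open ≤-Reasoning
    split : ∀ a b → a ≡ (a - b) + b
    split = solve 2 (λ a b → a := (a :- b) :+ b) refl

  divide : ∀ {K ε} → 0ℚ < K → 0ℚ < ε → ∃[ δ ] 0ℚ < δ × K * δ ≡ ε
  divide {K} {ε} 0<K 0<ε = 1/K * ε , positive⁻¹ (1/K * ε) {{1/K*ε-pos}} , K*[1/K*ε]≡ε
    where
    K-pos : Positive K
    K-pos = positive 0<K
    1/K : ℚ
    1/K = (1/ K) {{pos⇒nonZero K {{K-pos}}}}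
    1/K*ε-pos : Positive (1/K * ε)
    1/K*ε-pos = pos*pos⇒pos 1/K {{1/pos⇒pos K {{K-pos}}}} ε {{positive 0<ε}}
    K*[1/K*ε]≡ε : K * (1/K * ε) ≡ ε
    K*[1/K*ε]≡ε = trans (sym (*-assoc K 1/K ε))
      (trans (cong (_* ε) (*-inverseʳ K {{pos⇒nonZero K {{K-pos}}}})) (*-identityˡ ε))

  ∣*∣-mono-< : ∀ a b {C D} → 0ℚ < C → ∣ a ∣ < C → ∣ b ∣ < D → ∣ a * b ∣ < C * D
  ∣*∣-mono-< a b {C} {D} 0<C a<C b<D = begin-strict
    ∣ a * b ∣       ≡⟨ ∣p*q∣≡∣p∣*∣q∣ a b ⟩
    ∣ a ∣ * ∣ b ∣   ≤⟨ *-monoʳ-≤-nonNeg ∣ b ∣ {{nonNegative (0≤∣p∣ b)}} (<⇒≤ a<C) ⟩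
    C * ∣ b ∣       <⟨ *-monoʳ-<-pos C {{positive 0<C}} b<D ⟩
    C * D           ∎
    where open ≤-Reasoning

  *-close : ∀ a b a′ b′ {K L δ} → 0ℚ < K → 0ℚ < L → ∣ a ∣ < K → ∣ b′ ∣ < L →
            ∣ a - a′ ∣ < δ → ∣ b - b′ ∣ < δ → ∣ a * b - a′ * b′ ∣ < (K + L) * δ
  *-close a b a′ b′ {K} {L} {δ} 0<K 0<L a<K b′<L Δa<δ Δb<δ = begin-strict
    ∣ a * b - a′ * b′ ∣                     ≡⟨ cong ∣_∣ (regroup a b a′ b′) ⟩
    ∣ a * (b - b′) + b′ * (a - a′) ∣        ≤⟨ ∣p+q∣≤∣p∣+∣q∣ (a * (b - b′)) (b′ * (a - a′)) ⟩
    ∣ a * (b - b′) ∣ + ∣ b′ * (a - a′) ∣    <⟨ +-mono-< (∣*∣-mono-< a (b - b′) 0<K a<K Δb<δ)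
                                                        (∣*∣-mono-< b′ (a - a′) 0<L b′<L Δa<δ) ⟩
    K * δ + L * δ                           ≡⟨ sym (*-distribʳ-+ δ K L) ⟩
    (K + L) * δ                             ∎
    where
    open ≤-Reasoning
    regroup : ∀ a b c d → a * b - c * d ≡ a * (b - d) + d * (a - c)
    regroup = solve 4 (λ a b c d → a :* b :- c :* d := a :* (b :- d) :+ d :* (a :- c)) refl

  *-cauchy : ∀ {x y} → CauchySequence x → CauchySequence y →
             CauchySequence (λ n → x n * y n)
  *-cauchy {x} {y} cx cy ε 0<ε =
    let M₁ , K , 0<K , x<K = eventually-bounded {x} cx
        N₁ , L , 0<L , y<L = eventually-bounded {y} cy
        δ , 0<δ , [K+L]δ≡ε = divide {K + L} {ε} (+-mono-< 0<K 0<L) 0<ε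
        M₂ , Δx<δ = cx δ 0<δ
        N₂ , Δy<δ = cy δ 0<δ
        M = M₁ ℕ.⊔ M₂
        N = N₁ ℕ.⊔ N₂
    in M ℕ.⊔ N , λ m n m≥ n≥ →
    let m≥M = ℕ.m⊔n≤o⇒m≤o M N m≥
        m≥N = ℕ.m⊔n≤o⇒n≤o M N m≥
        n≥M = ℕ.m⊔n≤o⇒m≤o M N n≥
        n≥N = ℕ.m⊔n≤o⇒n≤o M N n≥
    in subst (∣ x m * y m - x n * y n ∣ <_) [K+L]δ≡ε
         (*-close (x m) (y m) (x n) (y n) 0<K 0<L
           (x<K m (ℕ.m⊔n≤o⇒m≤o M₁ M₂ m≥M))
           (y<L n (ℕ.m⊔n≤o⇒m≤o N₁ N₂ n≥N))
           (Δx<δ m n (ℕ.m⊔n≤o⇒n≤o M₁ M₂ m≥M) (ℕ.m⊔n≤o⇒n≤o M₁ M₂ n≥M))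
           (Δy<δ m n (ℕ.m⊔n≤o⇒n≤o N₁ N₂ m≥N) (ℕ.m⊔n≤o⇒n≤o N₁ N₂ n≥N)))

ℚ→ℝ : ℚ → ℝ
ℚ→ℝ q = mkℝ (λ _ → q) (const-cauchy q)

ℤ→ℝ : ℤ → ℝ
ℤ→ℝ z = ℚ→ℝ (z / 1)

0ᴿ 1ᴿ : ℝ
0ᴿ = ℚ→ℝ 0ℚ
1ᴿ = ℚ→ℝ 1ℚ

_+ᴿ_ _*ᴿ_ : ℝ → ℝ → ℝ
x +ᴿ y = mkℝ (λ n → seq x n + seq y n) (+-cauchy {seq x} {seq y} (cauchy x) (cauchy y))
x *ᴿ y = mkℝ (λ n → seq x n * seq y n) (*-cauchy {seq x} {seq y} (cauchy x) (cauchy y))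

-ᴿ_ : ℝ → ℝ
-ᴿ x = mkℝ (λ n → - seq x n) (neg-cauchy {seq x} (cauchy x))

_-ᴿ_ : ℝ → ℝ → ℝ
x -ᴿ y = x +ᴿ (-ᴿ y)

∑ : ∀ {k} → (Fin k → ℝ) → ℝ
∑ = Vector.foldr _+ᴿ_ 0ᴿ

record ℂ : Set where
  constructor _+i_
  field
    Re Im : ℝ

open ℂ public

infix  4 _≈ᶜ_
infixl 6 _+ᶜ_
infixl 7 _*ᶜ_

_≈ᶜ_ : Rel ℂ 0ℓ
z ≈ᶜ w = Re z ≈ Re w × Im z ≈ Im w

ℚ→ℂ : ℚ → ℂ
ℚ→ℂ q = ℚ→ℝ q +i 0ᴿ

0ᶜ : ℂ
0ᶜ = ℚ→ℂ 0ℚ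

_+ᶜ_ _*ᶜ_ : ℂ → ℂ → ℂ
z +ᶜ w = (Re z +ᴿ Re w) +i (Im z +ᴿ Im w)
z *ᶜ w = (Re z *ᴿ Re w -ᴿ Im z *ᴿ Im w) +i (Re z *ᴿ Im w +ᴿ Im z *ᴿ Re w)

CriticalLine : Pred ℂ 0ℓ
CriticalLine z = Re z ≈ ℚ→ℝ -½

-- Coefficients are listed from the constant term upwards.
ℚ[X] : Set
ℚ[X] = List ℚ

evalℚ : ℚ[X] → ℚ → ℚ
evalℚ p s = foldr (λ a r → a + s * r) 0ℚ p

evalℂ : ℚ[X] → ℂ → ℂ
evalℂ p z = foldr (λ a r → ℚ→ℂ a +ᶜ z *ᶜ r) 0ᶜ p

record Graph (N : ℕ) : Set₁ where
  field
    Adj         : Rel (Fin N) 0ℓ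
    adj?        : Decidable Adj
    symmetric   : Symmetric Adj
    irreflexive : Irreflexive _≡_ Adj

open Graph public

Edgeless : ∀ {N} → Graph N → Set
Edgeless G = ∀ u v → ¬ Adj G u v

-- The two parts are A and its complement.
BipartiteOfType : ℕ → ℕ → ∀ {N} → Graph N → Set
BipartiteOfType p q {N} G = ∃[ A ]
    ∣ A ∣ˢ ≡ p × ∣ ∁ A ∣ˢ ≡ q
  × (∀ u v → Adj G u v → (u ∈ˢ A × v ∈ˢ ∁ A) ⊎ (u ∈ˢ ∁ A × v ∈ˢ A))

ℝ^ : ℕ → Set
ℝ^ N = Fin N → ℝ

infix 4 _≈ⱽ_
_≈ⱽ_ : ∀ {N} → Rel (ℝ^ N) 0ℓ
x ≈ⱽ y = ∀ i → x i ≈ y i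

0ⱽ : ∀ {N} → ℝ^ N
0ⱽ _ = 0ᴿ

_-ⱽ_ : ∀ {N} → ℝ^ N → ℝ^ N → ℝ^ N
(x -ⱽ y) i = x i -ᴿ y i

_·ⱽ_ : ∀ {N} → ℝ → ℝ^ N → ℝ^ N
(c ·ⱽ x) i = c *ᴿ x i

e : ∀ {N} → Fin N → ℝ^ N
e v w = if does (v Fin.≟ w) then 1ᴿ else 0ᴿ

ConvexHull : ∀ {N} → Pred (ℝ^ N) 0ℓ → Pred (ℝ^ N) 0ℓ
ConvexHull {N} S x =
  ∃[ k ] ∃₂ λ (c : Fin k → ℝ) (p : Fin k → ℝ^ N) →
    (∀ j → 0ᴿ ≤ᴿ c j) × ∑ c ≈ 1ᴿ × (∀ j → S (p j))
    × x ≈ⱽ (λ i → ∑ λ j → c j *ᴿ p j i)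

EdgeVector : ∀ {N} → Graph N → Pred (ℝ^ N) 0ℓ
EdgeVector G x = ∃₂ λ u v → Adj G u v × x ≈ⱽ (e u -ⱽ e v)

-- The convex hull of the empty set is empty, whence the separate case {0}.
SymmetricEdgePolytope : ∀ {N} → Graph N → Pred (ℝ^ N) 0ℓ
SymmetricEdgePolytope G x =
  ConvexHull (EdgeVector G) x ⊎ (Edgeless G × x ≈ⱽ 0ⱽ)

Dilate : ∀ {N} → ℕ → Pred (ℝ^ N) 0ℓ → Pred (ℝ^ N) 0ℓ
Dilate s P x = ∃[ y ] P y × x ≈ⱽ (ℤ→ℝ (+ s) ·ⱽ y)

LatticePoint : ∀ {N} → Pred (ℝ^ N) 0ℓ → Pred (Vec ℤ N) 0ℓ
LatticePoint P z = P (λ i → ℤ→ℝ (lookup z i))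

HasCardinality : ∀ {A : Set} → Pred A 0ℓ → ℕ → Set
HasCardinality P k = ∃[ xs ]
  Unique xs × (∀ x → x ∈ xs ⇔ P x) × length xs ≡ k

-- A polynomial is determined by its values at the natural numbers, so H is
-- unique up to trailing zero coefficients.
IsEhrhartPolynomial : ∀ {N} → Pred (ℝ^ N) 0ℓ → ℚ[X] → Set
IsEhrhartPolynomial P H = ∀ s → ∃[ k ]
  HasCardinality (LatticePoint (Dilate s P)) k × evalℚ H (+ s / 1) ≡ + k / 1

{-# OPTIONS --safe #-}

-- Let a and b be the two vertices of the first part, K the number of vertices adjacent
-- to both, and E the number of vertices adjacent to at least one of them. An integer
-- vector lies in s P_G exactly when it is the boundary of a flow of cost at most s, and
-- by linear programming duality this is a short list of inequalities. Given the
-- coordinates w at the second part, with ∣w∣ ≤ s, the remaining freedom is the amount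
-- that a sends into the common vertices, which has m + 1 + 2⌊(s − ∣w∣)/2⌋ possible
-- values, m being the mass of w on the common vertices (and a single value if K = 0).
-- Let L_d be the Ehrhart polynomial of the d-dimensional cross polytope. Summing over w
-- gives H_G = L_E if K = 0, and 2 H_G = (K + 1) L_{E+1} − (K − 1) L_{E−1} otherwise. The
-- recurrence (d + 1) L_{d+1} = W L_d + d L_{d−1} with W = 2s + 1 turns the latter into
-- α W L_E + β L_{E−1} with α, β > 0, up to a positive factor. Since
--   (d + 1) Re (L_{d+1} L̄_d) = Re W ∣L_d∣² + d Re (L_d L̄_{d−1}),
-- the real part of H_G times L̄_E (of L_E L̄_{E−1} if K = 0) is Re W times a factor bounded
-- away from 0, so that Re W = 0 at a root.
module Submission where

open import Data.Nat.Base using (ℕ)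
open import Defs

open import Data.Bool.Base using (Bool; true; false; if_then_else_)
open import Data.Fin.Base using (Fin; zero; suc)
import Data.Fin.Properties as Fin
open import Data.Integer.Base as ℤ using (ℤ)
import Data.Integer.Properties as ℤ
open import Data.Nat.Base as ℕ using (ℕ; zero; suc)
import Data.Nat.Properties as ℕ
import Data.Nat.Tactic.RingSolver as ℕSolver
open import Data.Product.Base using (_×_; _,_; proj₁; proj₂; ∃; ∃₂; ∃-syntax)
open import Data.Sum.Base as Sum using (_⊎_; inj₁; inj₂; [_,_]′)
open import Function.Base using (_∘_)
open import Relation.Binary.PropositionalEquality
open import Relation.Nullary using (¬_; does; yes; no; contradiction)

-- Real numbers are Cauchy sequences, so the cofactor of Re W cannot simply be divided out. The
-- final argument runs on the rational terms of the sequences, where `z` is only approximately a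
-- root; the conclusion survives the limit because the cofactor is at least 1 at every Gaussian
-- rational. The interval behind m + 1 + 2⌊(s - ∣w∣)/2⌋: let X⁺ and X⁻ be the masses of the positive
-- and of the negative common coordinates, so that m = X⁺ + X⁻. A common vertex settles its
-- coordinate with either hub at the same cost, so `a` can send in any amount from -X⁺ to X⁻ without
-- extra cost. Each unit beyond that travels from hub to hub through a common vertex, at cost 2,
-- which is impossible when K = 0. All common vertices are made to share in one fixed proportion
-- between the hubs. This avoids choosing a flow vertex by vertex, at the price of fractional arcs;
-- hence flows are built for a multiple of the point, and the denominator is absorbed in the convex
-- weights.

-- Counting sequences of cross polytopes and their recurrences.

module Sequences where

  open import Data.Nat.Base
  open import Data.Nat.Properties
  open import Data.Nat.Tactic.RingSolver using (solve-∀)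

  -- T g s = ∑ g (s − ∣x∣) and T′ g s = ∑ ∣x∣ g (s − ∣x∣), both over the integers x
  -- with ∣x∣ ≤ s; as power series, multiplication by (1+t)/(1−t) and 2t/(1−t)².
  T T′ : (ℕ → ℕ) → ℕ → ℕ
  T g zero    = g 0
  T g (suc s) = 2 * g 0 + T (g ∘ suc) s
  T′ g zero    = 0
  T′ g (suc s) = 2 * suc s * g 0 + T′ (g ∘ suc) s

  -- Multiplication by (1+t)/(1-t), cleared of its denominator: (1-t) T g = (1+t) g.
  T-suc : ∀ g s → T g (suc s) ≡ T g s + (g s + g (suc s))
  T-suc g zero    = lemma (g 0) (g 1)
    where
    lemma : ∀ a b → 2 * a + b ≡ a + (a + b)
    lemma = solve-∀
  T-suc g (suc s) = trans (cong (2 * g 0 +_) (T-suc (g ∘ suc) s))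
    (sym (+-assoc (2 * g 0) _ _))

  -- As 1 + (1+t)/(1-t) = 2/(1-t), the factor 2t/(1-t)² gives (1-t) T′ g = t (T g + g).
  T′-suc : ∀ g s → T′ g (suc s) ≡ T′ g s + (T g s + g s)
  T′-suc g zero    = lemma (g 0)
    where
    lemma : ∀ a → 2 * 1 * a + 0 ≡ 0 + (a + a)
    lemma = solve-∀
  T′-suc g (suc s) = trans (cong (2 * suc (suc s) * g 0 +_) (T′-suc (g ∘ suc) s))
    (lemma s (g 0) _ _ _)
    where
    lemma : ∀ s a b c d → 2 * (2 + s) * a + (b + (c + d))
                        ≡ 2 * (1 + s) * a + b + (2 * a + c + d)
    lemma = solve-∀

  T-cong : ∀ {f g} → f ≗ g → T f ≗ T g
  T-cong f≗g zero    = f≗g 0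
  T-cong f≗g (suc s) = cong₂ _+_ (cong (2 *_) (f≗g 0)) (T-cong (f≗g ∘ suc) s)

  T-+ : ∀ f g s → T (λ i → f i + g i) s ≡ T f s + T g s
  T-+ f g zero    = refl
  T-+ f g (suc s) = trans (cong (2 * (f 0 + g 0) +_) (T-+ (f ∘ suc) (g ∘ suc) s))
    (lemma (f 0) (g 0) _ _)
    where
    lemma : ∀ a b c d → 2 * (a + b) + (c + d) ≡ 2 * a + c + (2 * b + d)
    lemma = solve-∀

  T-* : ∀ k g s → T (λ i → k * g i) s ≡ k * T g s
  T-* k g zero    = refl
  T-* k g (suc s) = trans (cong (2 * (k * g 0) +_) (T-* k (g ∘ suc) s))
    (lemma k (g 0) _)
    where
    lemma : ∀ k a b → 2 * (k * a) + k * b ≡ k * (2 * a + b)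
    lemma = solve-∀

  -- 4t/(1−t)² = ((1+t)/(1−t))² − 1
  T∘T : ∀ g s → T (T g) s ≡ g s + 2 * T′ g s
  T∘T g zero    = sym (+-identityʳ (g 0))
  T∘T g (suc s) = begin
    T (T g) (suc s) ≡⟨ T-suc (T g) s ⟩
    T (T g) s + (T g s + T g (suc s)) ≡⟨ cong₂ (λ a b → a + (T g s + b)) (T∘T g s) (T-suc g s) ⟩
    g s + 2 * T′ g s + (T g s + (T g s + (g s + g (suc s))))
                                                      ≡⟨ lemma (g s) (T′ g s) (T g s) (g (suc s)) ⟩
    g (suc s) + 2 * (T′ g s + (T g s + g s)) ≡⟨ cong (λ a → g (suc s) + 2 * a) (sym (T′-suc g s)) ⟩
    g (suc s) + 2 * T′ g (suc s) ∎
    where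
    open ≡-Reasoning
    lemma : ∀ a b c d → a + 2 * b + (c + (c + (a + d))) ≡ d + 2 * (b + (c + a))
    lemma = solve-∀

  T^ : ℕ → (ℕ → ℕ) → ℕ → ℕ
  T^ zero    g = g
  T^ (suc d) g = T (T^ d g)

  -- The Ehrhart polynomial of the d-dimensional cross polytope.
  L : ℕ → ℕ → ℕ
  L d = T^ d (λ _ → 1)

  L-zero : ∀ d → L d 0 ≡ 1
  L-zero zero    = refl
  L-zero (suc d) = L-zero d

  L₁ : ∀ s → L 1 s ≡ 2 * s + 1
  L₁ zero    = refl
  L₁ (suc s) = trans (T-suc _ s) (trans (cong (_+ 2) (L₁ s)) (lemma s))
    where
    lemma : ∀ s → 2 * s + 1 + 2 ≡ 2 * (1 + s) + 1
    lemma = solve-∀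

  L₂ : ∀ s → L 2 s ≡ 2 * (s * s) + 2 * s + 1
  L₂ zero    = refl
  L₂ (suc s) = trans (T-suc (L 1) s)
    (trans (cong₂ _+_ (L₂ s) (cong₂ _+_ (L₁ s) (L₁ (suc s)))) (lemma s))
    where
    lemma : ∀ s → 2 * (s * s) + 2 * s + 1 + (2 * s + 1 + (2 * (1 + s) + 1))
                ≡ 2 * ((1 + s) * (1 + s)) + 2 * (1 + s) + 1
    lemma = solve-∀

  -- The `L d s` are the Delannoy numbers, with `T-suc` as their defining rule. The recurrences at
  -- the three neighbouring cells (d+1, s), (d, s) and (d, s+1) add up to the one at (d+1, s+1), so
  -- a double induction works.
  L-recurrence : ∀ d s → (2 + d) * L (2 + d) s ≡ (2 * s + 1) * L (1 + d) s + (1 + d) * L d s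
  L-recurrence zero s =
    trans (cong (2 *_) (L₂ s)) (trans (lemma s) (cong (λ a → (2 * s + 1) * a + 1) (sym (L₁ s))))
    where
    lemma : ∀ s → 2 * (2 * (s * s) + 2 * s + 1) ≡ (2 * s + 1) * (2 * s + 1) + 1
    lemma = solve-∀
  L-recurrence (suc d) zero
    rewrite L-zero d = lemma d
    where
    lemma : ∀ d → (3 + d) * 1 ≡ 1 * 1 + (2 + d) * 1
    lemma = solve-∀
  L-recurrence (suc d) (suc s) = begin
    (3 + d) * L (3 + d) (suc s)
      ≡⟨ cong ((3 + d) *_) (T-suc (L (2 + d)) s) ⟩
    (3 + d) * (L (3 + d) s + (a + a′))
      ≡⟨ *-distribˡ-+ (3 + d) (L (3 + d) s) (a + a′) ⟩
    (3 + d) * L (3 + d) s + (3 + d) * (a + a′)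
      ≡⟨ cong₂ _+_ (L-recurrence (suc d) s) (expand d a a′) ⟩
    (2 * s + 1) * a + (2 + d) * b + (a + a′ + ((2 + d) * a + (2 + d) * a′))
      ≡⟨ cong (λ x → (2 * s + 1) * a + (2 + d) * b + (a + a′ + x))
           (cong₂ _+_ (L-recurrence d s) (L-recurrence d (suc s))) ⟩
    (2 * s + 1) * a + (2 + d) * b + (a + a′ +
      (((2 * s + 1) * b + (1 + d) * c) + ((2 * suc s + 1) * b′ + (1 + d) * c′)))
      ≡⟨ collect d s a a′ b b′ c c′ ⟩
    a′ + (2 * s + 2) * (a + (b + b′)) + (b′ + (1 + d) * (b + (c + c′)))
      ≡⟨ cong₂ (λ x y → a′ + (2 * s + 2) * x + (b′ + (1 + d) * y))
           (sym (T-suc (L (1 + d)) s)) (sym (T-suc (L d) s)) ⟩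
    a′ + (2 * s + 2) * a′ + (b′ + (1 + d) * b′)
      ≡⟨ finish d s a′ b′ ⟩
    (2 * suc s + 1) * a′ + (2 + d) * b′ ∎
    where
    open ≡-Reasoning
    a = L (2 + d) s
    a′ = L (2 + d) (suc s)
    b = L (1 + d) s
    b′ = L (1 + d) (suc s)
    c = L d s
    c′ = L d (suc s)
    expand : ∀ d a a′ → (3 + d) * (a + a′) ≡ a + a′ + ((2 + d) * a + (2 + d) * a′)
    expand = solve-∀
    collect : ∀ d s a a′ b b′ c c′ →
      (2 * s + 1) * a + (2 + d) * b + (a + a′ +
        (((2 * s + 1) * b + (1 + d) * c) + ((2 * (1 + s) + 1) * b′ + (1 + d) * c′)))
      ≡ a′ + (2 * s + 2) * (a + (b + b′)) + (b′ + (1 + d) * (b + (c + c′)))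
    collect = solve-∀
    finish : ∀ d s a′ b′ → a′ + (2 * s + 2) * a′ + (b′ + (1 + d) * b′)
                         ≡ (2 * (1 + s) + 1) * a′ + (2 + d) * b′
    finish = solve-∀

  even : ℕ → ℕ
  even j = 2 * ⌊ j /2⌋

  even-pair : ∀ s → even s + even (suc s) ≡ 2 * s
  even-pair s = trans (sym (*-distribˡ-+ 2 ⌊ s /2⌋ ⌊ suc s /2⌋)) (cong (2 *_) (⌊n/2⌋+⌈n/2⌉≡n s))

  -- The generating function of `even` is 2t²/((1-t)²(1+t)). One application of `T` removes the
  -- factor 1+t from the denominator, which is why the exponent is at least 1; for `e = 0` both
  -- sides are then (2+2t²)/(1-t)³. Further applications of `T` are linear.
  T^-even : ∀ e s → 2 * T^ (suc e) even s + 2 * L (suc e) s ≡ L (2 + e) s + L e s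
  T^-even zero zero = refl
  T^-even zero (suc s) = begin
    2 * T even (suc s) + 2 * L 1 (suc s)
      ≡⟨ cong₂ (λ x y → 2 * x + 2 * y) (T-suc even s) (T-suc _ s) ⟩
    2 * (T even s + (even s + even (suc s))) + 2 * (L 1 s + 2)
      ≡⟨ cong (λ x → 2 * (T even s + x) + 2 * (L 1 s + 2)) (even-pair s) ⟩
    2 * (T even s + 2 * s) + 2 * (L 1 s + 2)
      ≡⟨ lemma₁ s (T even s) (L 1 s) ⟩
    2 * T even s + 2 * L 1 s + (2 * s + 1 + (2 * (1 + s) + 1))
      ≡⟨ cong₂ _+_ (T^-even zero s) (cong₂ _+_ (sym (L₁ s)) (sym (L₁ (suc s)))) ⟩
    L 2 s + 1 + (L 1 s + L 1 (suc s))
      ≡⟨ lemma₂ (L 2 s) _ ⟩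
    L 2 s + (L 1 s + L 1 (suc s)) + 1
      ≡⟨ cong (_+ 1) (sym (T-suc (L 1) s)) ⟩
    L 2 (suc s) + 1 ∎
    where
    open ≡-Reasoning
    lemma₁ : ∀ s a b → 2 * (a + 2 * s) + 2 * (b + 2) ≡ 2 * a + 2 * b + (2 * s + 1 + (2 * (1 + s) + 1))
    lemma₁ = solve-∀
    lemma₂ : ∀ a b → a + 1 + b ≡ a + b + 1
    lemma₂ = solve-∀
  T^-even (suc e) s = begin
    2 * T^ (2 + e) even s + 2 * L (2 + e) s
      ≡⟨ sym (cong₂ _+_ (T-* 2 (T^ (suc e) even) s) (T-* 2 (L (suc e)) s)) ⟩
    T (λ i → 2 * T^ (suc e) even i) s + T (λ i → 2 * L (suc e) i) s
      ≡⟨ sym (T-+ _ _ s) ⟩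
    T (λ i → 2 * T^ (suc e) even i + 2 * L (suc e) i) s
      ≡⟨ T-cong (T^-even e) s ⟩
    T (λ i → L (2 + e) i + L e i) s
      ≡⟨ T-+ _ _ s ⟩
    L (3 + e) s + L (suc e) s ∎
    where open ≡-Reasoning

-- The integers as an ordered subring of the rationals.

module Embedding where

  open import Data.Integer.Base as ℤ using (ℤ; +_)
  open import Data.Rational.Base
  open import Data.Rational.Properties
  open import Data.Rational.Unnormalised.Base as ℚᵘ using (ℚᵘ; mkℚᵘ; *≡*; *≤*)
  import Data.Rational.Unnormalised.Properties as ℚᵘ

  ι : ℤ → ℚ
  ι z = z / 1

  ιᵘ : ℤ → ℚᵘ
  ιᵘ z = mkℚᵘ z 0

  toℚᵘ-ι : ∀ z → toℚᵘ (ι z) ℚᵘ.≃ ιᵘ z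
  toℚᵘ-ι z = toℚᵘ-fromℚᵘ (ιᵘ z)

  ι-+ : ∀ a b → ι (a ℤ.+ b) ≡ ι a + ι b
  ι-+ a b = toℚᵘ-injective (begin
    toℚᵘ (ι (a ℤ.+ b)) ≈⟨ toℚᵘ-ι (a ℤ.+ b) ⟩
    ιᵘ (a ℤ.+ b) ≈⟨ *≡* (cong (ℤ._* + 1) (sym (cong₂ ℤ._+_ (ℤ.*-identityʳ a) (ℤ.*-identityʳ b)))) ⟩
    ιᵘ a ℚᵘ.+ ιᵘ b ≈⟨ ℚᵘ.+-cong (toℚᵘ-ι a) (toℚᵘ-ι b) ⟨
    toℚᵘ (ι a) ℚᵘ.+ toℚᵘ (ι b) ≈⟨ toℚᵘ-homo-+ (ι a) (ι b) ⟨
    toℚᵘ (ι a + ι b) ∎)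
    where open import Relation.Binary.Reasoning.Setoid ℚᵘ.≃-setoid

  ι-* : ∀ a b → ι (a ℤ.* b) ≡ ι a * ι b
  ι-* a b = toℚᵘ-injective (begin
    toℚᵘ (ι (a ℤ.* b)) ≈⟨ toℚᵘ-ι (a ℤ.* b) ⟩
    ιᵘ (a ℤ.* b) ≈⟨ *≡* refl ⟩
    ιᵘ a ℚᵘ.* ιᵘ b ≈⟨ ℚᵘ.*-cong (toℚᵘ-ι a) (toℚᵘ-ι b) ⟨
    toℚᵘ (ι a) ℚᵘ.* toℚᵘ (ι b) ≈⟨ toℚᵘ-homo-* (ι a) (ι b) ⟨
    toℚᵘ (ι a * ι b) ∎)
    where open import Relation.Binary.Reasoning.Setoid ℚᵘ.≃-setoid

  ι-neg : ∀ a → ι (ℤ.- a) ≡ - ι a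
  ι-neg a = toℚᵘ-injective (begin
    toℚᵘ (ι (ℤ.- a)) ≈⟨ toℚᵘ-ι (ℤ.- a) ⟩
    ιᵘ (ℤ.- a) ≈⟨ ℚᵘ.-‿cong (toℚᵘ-ι a) ⟨
    ℚᵘ.- toℚᵘ (ι a) ≈⟨ toℚᵘ-homo‿- (ι a) ⟨
    toℚᵘ (- ι a) ∎)
    where open import Relation.Binary.Reasoning.Setoid ℚᵘ.≃-setoid

  ι-injective : ∀ {a b} → ι a ≡ ι b → a ≡ b
  ι-injective {a} {b} eq with ℚᵘ.≃-trans (ℚᵘ.≃-sym (toℚᵘ-ι a)) (ℚᵘ.≃-trans (ℚᵘ.≃-reflexive (cong toℚᵘ eq)) (toℚᵘ-ι b))
  ... | *≡* a1≡b1 = trans (sym (ℤ.*-identityʳ a)) (trans a1≡b1 (ℤ.*-identityʳ b))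

  ι-mono-≤ : ∀ {a b} → a ℤ.≤ b → ι a ≤ ι b
  ι-mono-≤ {a} {b} a≤b = toℚᵘ-cancel-≤
    (ℚᵘ.≤-respˡ-≃ (ℚᵘ.≃-sym (toℚᵘ-ι a)) (ℚᵘ.≤-respʳ-≃ (ℚᵘ.≃-sym (toℚᵘ-ι b))
      (*≤* (ℤ.*-monoʳ-≤-nonNeg (+ 1) a≤b))))

  ι-cancel-≤ : ∀ {a b} → ι a ≤ ι b → a ℤ.≤ b
  ι-cancel-≤ {a} {b} a≤b with ℚᵘ.≤-respˡ-≃ (toℚᵘ-ι a) (ℚᵘ.≤-respʳ-≃ (toℚᵘ-ι b) (toℚᵘ-mono-≤ a≤b))
  ... | *≤* a1≤b1 = ℤ.*-cancelʳ-≤-pos a b (+ 1) a1≤b1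

-- Polynomials over ℚ, their values at Gaussian rationals, and the identity principle.

module Polynomials where

  open import Data.Integer.Base as ℤ using (ℤ; +_)
  open import Data.List.Base using ([]; _∷_; map; foldr; length)
  open import Data.List.Relation.Unary.All using (All; []; _∷_)
  open import Data.Rational.Base
  open import Data.Rational.Properties
  open import Data.Rational.Solver using (module +-*-Solver)
  open Embedding
  open +-*-Solver

  -- Gaussian rationals; they are the terms of the sequences underlying ℂ.
  𝔾 : Set
  𝔾 = ℚ × ℚ

  infixl 6 _⊕_
  infixl 7 _⊗_ _⊙_

  _⊕_ _⊗_ : 𝔾 → 𝔾 → 𝔾
  (a , b) ⊕ (c , d) = a + c , b + d
  (a , b) ⊗ (c , d) = a * c - b * d , a * d + b * c

  _⊙_ : ℚ → 𝔾 → 𝔾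
  k ⊙ (a , b) = k * a , k * b

  -- Re (w v̄)
  ⟨_∣_⟩ : 𝔾 → 𝔾 → ℚ
  ⟨ (a , b) ∣ (c , d) ⟩ = a * c + b * d

  0𝔾 : 𝔾
  0𝔾 = 0ℚ , 0ℚ

  eval𝔾 : ℚ[X] → 𝔾 → 𝔾
  eval𝔾 p w = foldr (λ a r → (a , 0ℚ) ⊕ w ⊗ r) 0𝔾 p

  -- With this the rules for `evalℚ` are read off from those for `eval𝔾` instead of being proved
  -- twice.
  eval𝔾-real : ∀ p s → eval𝔾 p (s , 0ℚ) ≡ (evalℚ p s , 0ℚ)
  eval𝔾-real []      s = refl
  eval𝔾-real (a ∷ p) s rewrite eval𝔾-real p s = cong₂ _,_
    (solve 3 (λ a s r → a :+ (s :* r :- con 0ℚ :* con 0ℚ) := a :+ s :* r) refl a s (evalℚ p s))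
    (solve 2 (λ s r → con 0ℚ :+ (s :* con 0ℚ :+ con 0ℚ :* r) := con 0ℚ) refl s (evalℚ p s))

  infixl 6 _+ₚ_
  _+ₚ_ : ℚ[X] → ℚ[X] → ℚ[X]
  []      +ₚ q       = q
  (a ∷ p) +ₚ []      = a ∷ p
  (a ∷ p) +ₚ (b ∷ q) = (a + b) ∷ (p +ₚ q)

  infixr 7 _·ₚ_
  _·ₚ_ : ℚ → ℚ[X] → ℚ[X]
  k ·ₚ p = map (k *_) p

  2ℚ : ℚ
  2ℚ = + 2 / 1

  [2X+1]·_ : ℚ[X] → ℚ[X]
  [2X+1]· p = p +ₚ (0ℚ ∷ 2ℚ ·ₚ p)

  double+1 : 𝔾 → 𝔾
  double+1 (x , y) = 2ℚ * x + 1ℚ , 2ℚ * y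

  eval𝔾-+ : ∀ p q w → eval𝔾 (p +ₚ q) w ≡ eval𝔾 p w ⊕ eval𝔾 q w
  eval𝔾-+ []      q       w = cong₂ _,_ (sym (+-identityˡ _)) (sym (+-identityˡ _))
  eval𝔾-+ (a ∷ p) []      w = cong₂ _,_ (sym (+-identityʳ _)) (sym (+-identityʳ _))
  eval𝔾-+ (a ∷ p) (b ∷ q) w@(x , y) rewrite eval𝔾-+ p q w =
    let (c , d) = eval𝔾 p w ; (e , f) = eval𝔾 q w in cong₂ _,_
    (solve 8 (λ a b x y c d e f → (a :+ b) :+ (x :* (c :+ e) :- y :* (d :+ f))
       := (a :+ (x :* c :- y :* d)) :+ (b :+ (x :* e :- y :* f))) refl a b x y c d e f)
    (solve 6 (λ x y c d e f → con 0ℚ :+ (x :* (d :+ f) :+ y :* (c :+ e))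
       := (con 0ℚ :+ (x :* d :+ y :* c)) :+ (con 0ℚ :+ (x :* f :+ y :* e))) refl x y c d e f)

  eval𝔾-· : ∀ k p w → eval𝔾 (k ·ₚ p) w ≡ k ⊙ eval𝔾 p w
  eval𝔾-· k []      w = cong₂ _,_ (sym (*-zeroʳ k)) (sym (*-zeroʳ k))
  eval𝔾-· k (a ∷ p) w@(x , y) rewrite eval𝔾-· k p w =
    let (c , d) = eval𝔾 p w in cong₂ _,_
    (solve 6 (λ k a x y c d → k :* a :+ (x :* (k :* c) :- y :* (k :* d))
       := k :* (a :+ (x :* c :- y :* d))) refl k a x y c d)
    (solve 5 (λ k x y c d → con 0ℚ :+ (x :* (k :* d) :+ y :* (k :* c))
       := k :* (con 0ℚ :+ (x :* d :+ y :* c))) refl k x y c d)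

  eval𝔾-[2X+1] : ∀ p w → eval𝔾 ([2X+1]· p) w ≡ double+1 w ⊗ eval𝔾 p w
  eval𝔾-[2X+1] p w@(x , y) rewrite eval𝔾-+ p (0ℚ ∷ 2ℚ ·ₚ p) w | eval𝔾-· 2ℚ p w =
    let (c , d) = eval𝔾 p w in cong₂ _,_
    (solve 5 (λ t x y c d → c :+ (con 0ℚ :+ (x :* (t :* c) :- y :* (t :* d)))
       := (t :* x :+ con 1ℚ) :* c :- (t :* y) :* d) refl 2ℚ x y c d)
    (solve 5 (λ t x y c d → d :+ (con 0ℚ :+ (x :* (t :* d) :+ y :* (t :* c)))
       := (t :* x :+ con 1ℚ) :* d :+ (t :* y) :* c) refl 2ℚ x y c d)

  evalℚ-via-𝔾 : ∀ p s → evalℚ p s ≡ proj₁ (eval𝔾 p (s , 0ℚ))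
  evalℚ-via-𝔾 p s = cong proj₁ (sym (eval𝔾-real p s))

  evalℚ-+ : ∀ p q s → evalℚ (p +ₚ q) s ≡ evalℚ p s + evalℚ q s
  evalℚ-+ p q s = trans (evalℚ-via-𝔾 (p +ₚ q) s) (trans (cong proj₁ (eval𝔾-+ p q (s , 0ℚ)))
    (cong₂ _+_ (sym (evalℚ-via-𝔾 p s)) (sym (evalℚ-via-𝔾 q s))))

  evalℚ-· : ∀ k p s → evalℚ (k ·ₚ p) s ≡ k * evalℚ p s
  evalℚ-· k p s = trans (evalℚ-via-𝔾 (k ·ₚ p) s) (trans (cong proj₁ (eval𝔾-· k p (s , 0ℚ)))
    (cong (k *_) (sym (evalℚ-via-𝔾 p s))))

  evalℚ-[2X+1] : ∀ p s → evalℚ ([2X+1]· p) s ≡ (2ℚ * s + 1ℚ) * evalℚ p s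
  evalℚ-[2X+1] p s = trans (evalℚ-via-𝔾 ([2X+1]· p) s)
    (trans (cong proj₁ (trans (eval𝔾-[2X+1] p (s , 0ℚ)) (cong (double+1 (s , 0ℚ) ⊗_) (eval𝔾-real p s))))
      (solve 3 (λ t s r → (t :* s :+ con 1ℚ) :* r :- (t :* con 0ℚ) :* con 0ℚ
         := (t :* s :+ con 1ℚ) :* r) refl 2ℚ s (evalℚ p s)))

  -- Vanishing at all large naturals passes to the quotient by X − r.

  quotient : ℚ → ℚ[X] → ℚ[X]
  quotient r []          = []
  quotient r (a ∷ [])    = []
  quotient r (a ∷ b ∷ p) = evalℚ (b ∷ p) r ∷ quotient r (b ∷ p)

  quotient-spec : ∀ r p s → evalℚ p s ≡ evalℚ p r + (s - r) * evalℚ (quotient r p) s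
  quotient-spec r [] s = solve 2 (λ s r → con 0ℚ := con 0ℚ :+ (s :- r) :* con 0ℚ) refl s r
  quotient-spec r (a ∷ []) s = solve 3 (λ a s r → a :+ s :* con 0ℚ
    := (a :+ r :* con 0ℚ) :+ (s :- r) :* con 0ℚ) refl a s r
  quotient-spec r (a ∷ p@(_ ∷ _)) s = trans
    (cong (λ x → a + s * x) (quotient-spec r p s))
    (solve 5 (λ a s r v q → a :+ s :* (v :+ (s :- r) :* q)
      := (a :+ r :* v) :+ (s :- r) :* (v :+ s :* q)) refl a s r (evalℚ p r) (evalℚ (quotient r p) s))

  quotient-length : ∀ r a p → length (quotient r (a ∷ p)) ≡ length p
  quotient-length r a []      = refl
  quotient-length r a (b ∷ p) = cong suc (quotient-length r b p)

  quotient-zero : ∀ r p → evalℚ p r ≡ 0ℚ → All (_≡ 0ℚ) (quotient r p) → All (_≡ 0ℚ) p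
  quotient-zero r []       _   _ = []
  quotient-zero r (a ∷ []) p≡0 _ =
    trans (solve 2 (λ a r → a := a :+ r :* con 0ℚ) refl a r) p≡0 ∷ []
  quotient-zero r (a ∷ p@(_ ∷ _)) a+rv≡0 (v≡0 ∷ q≡0) =
    trans (solve 2 (λ a r → a := a :+ r :* con 0ℚ) refl a r)
      (trans (cong (λ v → a + r * v) (sym v≡0)) a+rv≡0)
    ∷ quotient-zero r p v≡0 q≡0

  product-zero : ∀ {a b} → a ≢ 0ℚ → a * b ≡ 0ℚ → b ≡ 0ℚ
  product-zero {a} {b} a≢0 ab≡0 = *-cancelˡ-≡
    where
    instance _ = ≢-nonZero a≢0
    *-cancelˡ-≡ : b ≡ 0ℚ
    *-cancelˡ-≡ = trans (sym (*-identityˡ b)) (trans (cong (_* b) (sym (*-inverseˡ a)))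
      (trans (*-assoc (1/ a) a b) (trans (cong (1/ a *_) ab≡0) (*-zeroʳ (1/ a)))))

  -- Split off X - r at the first root; the quotient still vanishes beyond `r`, because s - r ≠ 0
  -- there, so the threshold moves up by one. The bound `n` carries the recursion, as the quotient
  -- is not a sublist of `p`.
  vanishing : ∀ n p r → length p ℕ.≤ n →
              (∀ s → r ℕ.≤ s → evalℚ p (ι (+ s)) ≡ 0ℚ) → All (_≡ 0ℚ) p
  vanishing n       []      r _           _     = []
  vanishing (suc n) (a ∷ p) r (ℕ.s≤s len) zeros =
    quotient-zero (ι (+ r)) (a ∷ p) (zeros r ℕ.≤-refl)
      (vanishing n (quotient (ι (+ r)) (a ∷ p)) (suc r)
        (subst (ℕ._≤ n) (sym (quotient-length (ι (+ r)) a p)) len) quotient-zeros)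
    where
    quotient-zeros : ∀ s → r ℕ.< s → evalℚ (quotient (ι (+ r)) (a ∷ p)) (ι (+ s)) ≡ 0ℚ
    quotient-zeros s r<s = product-zero s-r≢0 (begin
      (ι (+ s) - ι (+ r)) * q ≡⟨ sym (+-identityˡ _) ⟩
      0ℚ + (ι (+ s) - ι (+ r)) * q ≡⟨ cong (_+ (ι (+ s) - ι (+ r)) * q) (sym (zeros r ℕ.≤-refl)) ⟩
      evalℚ (a ∷ p) (ι (+ r)) + (ι (+ s) - ι (+ r)) * q ≡⟨ sym (quotient-spec (ι (+ r)) (a ∷ p) (ι (+ s))) ⟩
      evalℚ (a ∷ p) (ι (+ s)) ≡⟨ zeros s (ℕ.<⇒≤ r<s) ⟩
      0ℚ ∎)
      where
      open ≡-Reasoning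
      q = evalℚ (quotient (ι (+ r)) (a ∷ p)) (ι (+ s))
      s-r≢0 : ι (+ s) - ι (+ r) ≢ 0ℚ
      s-r≢0 s-r≡0 = ℕ.<⇒≢ r<s (ℤ.+-injective (ι-injective (begin
        ι (+ r) ≡⟨ sym (+-identityˡ _) ⟩
        0ℚ + ι (+ r) ≡⟨ cong (_+ ι (+ r)) (sym s-r≡0) ⟩
        ι (+ s) - ι (+ r) + ι (+ r) ≡⟨ solve 2 (λ s r → s :- r :+ r := s) refl (ι (+ s)) (ι (+ r)) ⟩
        ι (+ s) ∎)))

  eval𝔾-zero : ∀ {p} → All (_≡ 0ℚ) p → ∀ w → eval𝔾 p w ≡ 0𝔾
  eval𝔾-zero []           w = refl
  eval𝔾-zero (refl ∷ p≡0) w@(x , y) rewrite eval𝔾-zero p≡0 w = cong₂ _,_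
    (solve 2 (λ x y → con 0ℚ :+ (x :* con 0ℚ :- y :* con 0ℚ) := con 0ℚ) refl x y)
    (solve 2 (λ x y → con 0ℚ :+ (x :* con 0ℚ :+ y :* con 0ℚ) := con 0ℚ) refl x y)

  -- All coefficients of p - q vanish. The lists themselves may differ by trailing zeros, so the
  -- conclusion is about values. It carries counting formulas, known at natural numbers, over to
  -- complex arguments.
  identity-principle : ∀ p q → (∀ s → evalℚ p (ι (+ s)) ≡ evalℚ q (ι (+ s))) →
                       ∀ w → eval𝔾 p w ≡ eval𝔾 q w
  identity-principle p q p≡q w = begin
    eval𝔾 p w ≡⟨ cong₂ _,_ (cancel _ _) (cancel _ _) ⟩
    (eval𝔾 p w ⊕ (- 1ℚ) ⊙ eval𝔾 q w) ⊕ eval𝔾 q w ≡⟨ cong (_⊕ eval𝔾 q w) (sym difference) ⟩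
    eval𝔾 (p +ₚ (- 1ℚ) ·ₚ q) w ⊕ eval𝔾 q w ≡⟨ cong (_⊕ eval𝔾 q w)
                                                           (eval𝔾-zero (vanishing _ (p +ₚ (- 1ℚ) ·ₚ q) 0 ℕ.≤-refl (λ s _ → vanishes s)) w) ⟩
    0𝔾 ⊕ eval𝔾 q w ≡⟨ cong₂ _,_ (+-identityˡ _) (+-identityˡ _) ⟩
    eval𝔾 q w ∎
    where
    open ≡-Reasoning
    cancel : ∀ a b → a ≡ a + - 1ℚ * b + b
    cancel = solve 2 (λ a b → a := a :+ (:- con 1ℚ) :* b :+ b) refl
    difference : eval𝔾 (p +ₚ (- 1ℚ) ·ₚ q) w ≡ eval𝔾 p w ⊕ (- 1ℚ) ⊙ eval𝔾 q w
    difference = trans (eval𝔾-+ p ((- 1ℚ) ·ₚ q) w) (cong (eval𝔾 p w ⊕_) (eval𝔾-· (- 1ℚ) q w))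
    vanishes : ∀ s → evalℚ (p +ₚ (- 1ℚ) ·ₚ q) (ι (+ s)) ≡ 0ℚ
    vanishes s = begin
      evalℚ (p +ₚ (- 1ℚ) ·ₚ q) (ι (+ s)) ≡⟨ evalℚ-+ p ((- 1ℚ) ·ₚ q) (ι (+ s)) ⟩
      evalℚ p (ι (+ s)) + evalℚ ((- 1ℚ) ·ₚ q) (ι (+ s)) ≡⟨ cong₂ _+_ (p≡q s) (evalℚ-· (- 1ℚ) q (ι (+ s))) ⟩
      evalℚ q (ι (+ s)) + - 1ℚ * evalℚ q (ι (+ s)) ≡⟨ solve 1 (λ a → a :+ (:- con 1ℚ) :* a := con 0ℚ) refl (evalℚ q (ι (+ s))) ⟩
      0ℚ ∎

-- Ehrhart polynomials of cross polytopes and the sign of Re (M_{d+1} M̄_d).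

module CrossPolytopes where

  open import Data.Integer.Base as ℤ using (ℤ; +_)
  open import Data.List.Base using ([]; _∷_)
  open import Data.Nat.Base as ℕ using (ℕ; zero; suc; _!)
  open import Data.Rational.Base
  open import Data.Rational.Properties
  open import Data.Rational.Solver using (module +-*-Solver)
  open Embedding
  open Polynomials
  open Sequences using (L; L₁; L-recurrence)
  open +-*-Solver

  ιⁿ : ℕ → ℚ
  ιⁿ n = ι (+ n)

  ιⁿ-* : ∀ m n → ιⁿ (m ℕ.* n) ≡ ιⁿ m * ιⁿ n
  ιⁿ-* m n = trans (cong ι (ℤ.pos-* m n)) (ι-* (+ m) (+ n))

  ιⁿ-+ : ∀ m n → ιⁿ (m ℕ.+ n) ≡ ιⁿ m + ιⁿ n
  ιⁿ-+ m n = ι-+ (+ m) (+ n)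

  ιⁿ-≥1 : ∀ n → 1ℚ ≤ ιⁿ (suc n)
  ιⁿ-≥1 n = ι-mono-≤ {+ 1} {+ suc n} (ℤ.+≤+ (ℕ.s≤s ℕ.z≤n))

  ιⁿ-≥0 : ∀ n → 0ℚ ≤ ιⁿ n
  ιⁿ-≥0 n = ι-mono-≤ {+ 0} {+ n} (ℤ.+≤+ ℕ.z≤n)

  -- d ! times the Ehrhart polynomial of the d-dimensional cross polytope, which has
  -- integer coefficients and satisfies a division-free recurrence.
  M : ℕ → ℚ[X]
  M 0             = 1ℚ ∷ []
  M 1             = [2X+1]· M 0
  M (suc (suc d)) = [2X+1]· M (suc d) +ₚ ιⁿ (suc d ℕ.* suc d) ·ₚ M d

  evalℚ-M₀ : ∀ s → evalℚ (M 0) s ≡ 1ℚ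
  evalℚ-M₀ = solve 1 (λ s → con 1ℚ :+ s :* con 0ℚ := con 1ℚ) refl

  2s+1 : ∀ s → 2ℚ * ιⁿ s + 1ℚ ≡ ιⁿ (2 ℕ.* s ℕ.+ 1)
  2s+1 s = trans (cong (_+ 1ℚ) (sym (ιⁿ-* 2 s))) (sym (ιⁿ-+ (2 ℕ.* s) 1))

  -- Multiplied by (d+1)!, the term (d+1) L_d of `L-recurrence` becomes (d+1)² times d! L_d, whence
  -- the square in `M`.
  evalℚ-M : ∀ d s → evalℚ (M d) (ιⁿ s) ≡ ιⁿ (d ! ℕ.* L d s)
  evalℚ-M 0 s = evalℚ-M₀ (ιⁿ s)
  evalℚ-M 1 s = begin
    evalℚ ([2X+1]· M 0) (ιⁿ s) ≡⟨ evalℚ-[2X+1] (M 0) (ιⁿ s) ⟩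
    (2ℚ * ιⁿ s + 1ℚ) * evalℚ (M 0) (ιⁿ s) ≡⟨ cong₂ _*_ (2s+1 s) (evalℚ-M₀ (ιⁿ s)) ⟩
    ιⁿ (2 ℕ.* s ℕ.+ 1) * 1ℚ ≡⟨ *-identityʳ _ ⟩
    ιⁿ (2 ℕ.* s ℕ.+ 1) ≡⟨ cong ιⁿ (sym (trans (ℕ.+-identityʳ _) (L₁ s))) ⟩
    ιⁿ (1 ℕ.* L 1 s) ∎
    where open ≡-Reasoning
  evalℚ-M (suc (suc d)) s = begin
    evalℚ (M (2 ℕ.+ d)) (ιⁿ s)
      ≡⟨ trans (evalℚ-+ ([2X+1]· M (suc d)) (ιⁿ (suc d ℕ.* suc d) ·ₚ M d) (ιⁿ s))
           (cong₂ _+_ (evalℚ-[2X+1] (M (suc d)) (ιⁿ s)) (evalℚ-· (ιⁿ (suc d ℕ.* suc d)) (M d) (ιⁿ s))) ⟩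
    (2ℚ * ιⁿ s + 1ℚ) * evalℚ (M (suc d)) (ιⁿ s) + ιⁿ (suc d ℕ.* suc d) * evalℚ (M d) (ιⁿ s)
      ≡⟨ cong₂ _+_ (cong₂ _*_ (2s+1 s) (evalℚ-M (suc d) s)) (cong (ιⁿ (suc d ℕ.* suc d) *_) (evalℚ-M d s)) ⟩
    ιⁿ (2 ℕ.* s ℕ.+ 1) * ιⁿ (suc d ! ℕ.* L (suc d) s) + ιⁿ (suc d ℕ.* suc d) * ιⁿ (d ! ℕ.* L d s)
      ≡⟨ sym (cong₂ _+_ (ιⁿ-* (2 ℕ.* s ℕ.+ 1) (suc d ! ℕ.* L (suc d) s)) (ιⁿ-* (suc d ℕ.* suc d) (d ! ℕ.* L d s))) ⟩
    ιⁿ ((2 ℕ.* s ℕ.+ 1) ℕ.* (suc d ! ℕ.* L (suc d) s)) + ιⁿ (suc d ℕ.* suc d ℕ.* (d ! ℕ.* L d s))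
      ≡⟨ sym (ιⁿ-+ ((2 ℕ.* s ℕ.+ 1) ℕ.* (suc d ! ℕ.* L (suc d) s)) (suc d ℕ.* suc d ℕ.* (d ! ℕ.* L d s))) ⟩
    ιⁿ ((2 ℕ.* s ℕ.+ 1) ℕ.* (suc d ! ℕ.* L (suc d) s) ℕ.+ suc d ℕ.* suc d ℕ.* (d ! ℕ.* L d s))
      ≡⟨ cong ιⁿ (factor d s (d !) (L (suc d) s) (L d s)) ⟩
    ιⁿ (suc d ! ℕ.* ((2 ℕ.* s ℕ.+ 1) ℕ.* L (suc d) s ℕ.+ suc d ℕ.* L d s))
      ≡⟨ cong (λ x → ιⁿ (suc d ! ℕ.* x)) (sym (L-recurrence d s)) ⟩
    ιⁿ (suc d ! ℕ.* ((2 ℕ.+ d) ℕ.* L (2 ℕ.+ d) s))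
      ≡⟨ cong ιⁿ (reassociate (suc d !) (2 ℕ.+ d) (L (2 ℕ.+ d) s)) ⟩
    ιⁿ ((2 ℕ.+ d) ! ℕ.* L (2 ℕ.+ d) s) ∎
    where
    open ≡-Reasoning
    factor : ∀ d s f a b →
      (2 ℕ.* s ℕ.+ 1) ℕ.* ((1 ℕ.+ d) ℕ.* f ℕ.* a) ℕ.+ (1 ℕ.+ d) ℕ.* (1 ℕ.+ d) ℕ.* (f ℕ.* b)
      ≡ (1 ℕ.+ d) ℕ.* f ℕ.* ((2 ℕ.* s ℕ.+ 1) ℕ.* a ℕ.+ (1 ℕ.+ d) ℕ.* b)
    factor = ℕSolver.solve-∀
    reassociate : ∀ a b c → a ℕ.* (b ℕ.* c) ≡ b ℕ.* a ℕ.* c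
    reassociate = ℕSolver.solve-∀

  norm² : 𝔾 → ℚ
  norm² w = ⟨ w ∣ w ⟩

  square-≥0 : ∀ a → 0ℚ ≤ a * a
  square-≥0 a with ∣p∣≡p∨∣p∣≡-p a
  ... | inj₁ ∣a∣≡a  = subst (0ℚ ≤_) (cong₂ _*_ ∣a∣≡a ∣a∣≡a) ∣a∣²≥0
    where
    ∣a∣²≥0 : 0ℚ ≤ ∣ a ∣ * ∣ a ∣
    ∣a∣²≥0 = subst (0ℚ ≤_) (∣p*q∣≡∣p∣*∣q∣ a a) (0≤∣p∣ (a * a))
  ... | inj₂ ∣a∣≡-a = subst (0ℚ ≤_)
    (trans (∣p*q∣≡∣p∣*∣q∣ a a) (trans (cong₂ _*_ ∣a∣≡-a ∣a∣≡-a)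
      (solve 1 (λ a → (:- a) :* (:- a) := a :* a) refl a)))
    (0≤∣p∣ (a * a))

  norm²-≥0 : ∀ w → 0ℚ ≤ norm² w
  norm²-≥0 (a , b) = +-mono-≤ (square-≥0 a) (square-≥0 b)

  *-≥0 : ∀ {a b} → 0ℚ ≤ a → 0ℚ ≤ b → 0ℚ ≤ a * b
  *-≥0 {a} {b} 0≤a 0≤b = subst (_≤ a * b) (*-zeroʳ a)
    (*-monoˡ-≤-nonNeg a {{nonNegative 0≤a}} 0≤b)

  *-≥1 : ∀ {a b} → 1ℚ ≤ a → 1ℚ ≤ b → 1ℚ ≤ a * b
  *-≥1 {a} {b} 1≤a 1≤b = ≤-trans 1≤a (subst (_≤ a * b) (*-identityʳ a)
    (*-monoˡ-≤-nonNeg a {{nonNegative (≤-trans (ιⁿ-≥0 1) 1≤a)}} 1≤b))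

  +-≥1 : ∀ {a b} → 0ℚ ≤ a → 1ℚ ≤ b → 1ℚ ≤ a + b
  +-≥1 {a} {b} 0≤a 1≤b = subst (_≤ a + b) (+-identityˡ 1ℚ) (+-mono-≤ 0≤a 1≤b)

  -- W μ μ̄ = W ∣μ∣² has real part Re W ∣μ∣².
  ⟨∣⟩-step : ∀ W μ κ ν → ⟨ W ⊗ μ ⊕ κ ⊙ ν ∣ μ ⟩ ≡ proj₁ W * norm² μ + κ * ⟨ μ ∣ ν ⟩
  ⟨∣⟩-step (x , y) (a , b) κ (c , d) = solve 7 (λ x y a b k c d →
    ((x :* a :- y :* b) :+ k :* c) :* a :+ ((x :* b :+ y :* a) :+ k :* d) :* b
    := x :* (a :* a :+ b :* b) :+ k :* (a :* c :+ b :* d)) refl x y a b κ c d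

  -- The cofactor of Re W in Re (M_{d+1} M̄_d). Unrolled, it is the sum of (d!/j!)² ∣M_j∣² over 1 ≤
  -- j ≤ d, plus (d!)²; the last term keeps it away from 0.
  S : ℕ → 𝔾 → ℚ
  S zero    w = 1ℚ
  S (suc d) w = norm² (eval𝔾 (M (suc d)) w) + ιⁿ (suc d ℕ.* suc d) * S d w

  S-≥1 : ∀ d w → 1ℚ ≤ S d w
  S-≥1 zero    w = ≤-refl
  -- The product `suc d ℕ.* suc d` reduces to `suc (d ℕ.+ d ℕ.* suc d)`.
  S-≥1 (suc d) w = +-≥1 (norm²-≥0 (eval𝔾 (M (suc d)) w)) (*-≥1 (ιⁿ-≥1 (d ℕ.+ d ℕ.* suc d)) (S-≥1 d w))

  eval𝔾-M₀ : ∀ w → eval𝔾 (M 0) w ≡ (1ℚ , 0ℚ)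
  eval𝔾-M₀ (x , y) = cong₂ _,_
    (solve 2 (λ x y → con 1ℚ :+ (x :* con 0ℚ :- y :* con 0ℚ) := con 1ℚ) refl x y)
    (solve 2 (λ x y → con 0ℚ :+ (x :* con 0ℚ :+ y :* con 0ℚ) := con 0ℚ) refl x y)

  ⟨M∣M⟩ : ∀ d w → ⟨ eval𝔾 (M (suc d)) w ∣ eval𝔾 (M d) w ⟩ ≡ proj₁ (double+1 w) * S d w
  ⟨M∣M⟩ zero w = trans
    (cong₂ ⟨_∣_⟩ (trans (eval𝔾-[2X+1] (M 0) w) (cong (double+1 w ⊗_) (eval𝔾-M₀ w))) (eval𝔾-M₀ w))
    (⟨W∣1⟩ (double+1 w))
    where
    ⟨W∣1⟩ : ∀ W → ⟨ W ⊗ (1ℚ , 0ℚ) ∣ (1ℚ , 0ℚ) ⟩ ≡ proj₁ W * 1ℚ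
    ⟨W∣1⟩ (x , y) = solve 2 (λ x y → (x :* con 1ℚ :- y :* con 0ℚ) :* con 1ℚ
      :+ (x :* con 0ℚ :+ y :* con 1ℚ) :* con 0ℚ := x :* con 1ℚ) refl x y
  ⟨M∣M⟩ (suc d) w = begin
    ⟨ eval𝔾 (M (2 ℕ.+ d)) w ∣ μ ⟩
      ≡⟨ cong (⟨_∣ μ ⟩) (trans (eval𝔾-+ ([2X+1]· M (suc d)) (κ ·ₚ M d) w)
           (cong₂ _⊕_ (eval𝔾-[2X+1] (M (suc d)) w) (eval𝔾-· κ (M d) w))) ⟩
    ⟨ W ⊗ μ ⊕ κ ⊙ ν ∣ μ ⟩ ≡⟨ ⟨∣⟩-step W μ κ ν ⟩
    proj₁ W * norm² μ + κ * ⟨ μ ∣ ν ⟩ ≡⟨ cong (λ x → proj₁ W * norm² μ + κ * x) (⟨M∣M⟩ d w) ⟩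
    proj₁ W * norm² μ + κ * (proj₁ W * S d w) ≡⟨ solve 4 (λ x n k s → x :* n :+ k :* (x :* s) := x :* (n :+ k :* s))
                                                     refl (proj₁ W) (norm² μ) κ (S d w) ⟩
    proj₁ W * S (suc d) w ∎
    where
    open ≡-Reasoning
    W = double+1 w
    μ = eval𝔾 (M (suc d)) w
    ν = eval𝔾 (M d) w
    κ = ιⁿ (suc d ℕ.* suc d)

-- Null and asymptotically nonnegative rational sequences.

module Asymptotics where

  open import Data.Integer.Base as ℤ using (ℤ; +_)
  open import Data.Rational.Base
  open import Data.Rational.Properties
  open import Data.Rational.Solver using (module +-*-Solver)
  open import Algebra.Bundles using (module Ring)
  open import Algebra.Properties.Semiring.Sum (Ring.semiring +-*-ring) using (sum)
  open Embedding
  open +-*-Solver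

  -- Limits are taken along the underlying rational sequences, on which the identities
  -- of a commutative ring hold pointwise.

  Null AsymptoticallyNonneg : (ℕ → ℚ) → Set
  Null f = ∀ ε → 0ℚ < ε → ∃[ N ] (∀ n → N ℕ.≤ n → ∣ f n ∣ < ε)
  AsymptoticallyNonneg f = ∀ ε → 0ℚ < ε → ∃[ N ] (∀ n → N ℕ.≤ n → 0ℚ < f n + ε)

  half : ∀ {ε} → 0ℚ < ε → 0ℚ < ½ * ε
  half {ε} 0<ε = subst (_< ½ * ε) (*-zeroʳ ½) (*-monoʳ-<-pos ½ 0<ε)

  half+half : ∀ ε → ½ * ε + ½ * ε ≡ ε
  half+half ε = trans (sym (*-distribʳ-+ ε ½ ½)) (*-identityˡ ε)

  -∣p∣≤p : ∀ p → - ∣ p ∣ ≤ p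
  -∣p∣≤p p = subst₂ _≤_ (+-identityˡ (- ∣ p ∣))
    (solve 2 (λ p a → p :+ a :+ (:- a) := p) refl p ∣ p ∣)
    (+-monoˡ-≤ (- ∣ p ∣) 0≤p+∣p∣)
    where
    0≤p+∣p∣ : 0ℚ ≤ p + ∣ p ∣
    0≤p+∣p∣ = subst₂ _≤_ (+-inverseʳ p) (cong (_+_ p) (∣-p∣≡∣p∣ p)) (+-monoʳ-≤ p (q≤∣q∣ (- p)))
      where
      q≤∣q∣ : ∀ q → q ≤ ∣ q ∣
      q≤∣q∣ (mkℚ (ℤ.+ _) _ _)        = ≤-refl
      q≤∣q∣ q@(mkℚ (ℤ.-[1+ _ ]) _ _) = ≤-trans (<⇒≤ (negative⁻¹ q)) (0≤∣p∣ q)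

  null-dominated : ∀ {f g} → (∀ n → ∣ g n ∣ ≤ ∣ f n ∣) → Null f → Null g
  null-dominated g≤f nf ε 0<ε = let N , h = nf ε 0<ε in
    N , λ n n≥N → ≤-<-trans (g≤f n) (h n n≥N)

  null-cong : ∀ {f g} → f ≗ g → Null f → Null g
  null-cong f≗g = null-dominated (λ n → ≤-reflexive (cong ∣_∣ (sym (f≗g n))))

  null-0 : Null (λ _ → 0ℚ)
  null-0 ε 0<ε = 0 , λ _ _ → 0<ε

  null-+ : ∀ {f g} → Null f → Null g → Null (λ n → f n + g n)
  null-+ {f} {g} nf ng ε 0<ε =
    let M , hf = nf (½ * ε) (half 0<ε)
        N , hg = ng (½ * ε) (half 0<ε)
    in M ℕ.⊔ N , λ n n≥ → subst (∣ f n + g n ∣ <_) (half+half ε)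
      (≤-<-trans (∣p+q∣≤∣p∣+∣q∣ (f n) (g n))
        (+-mono-< (hf n (ℕ.m⊔n≤o⇒m≤o M N n≥)) (hg n (ℕ.m⊔n≤o⇒n≤o M N n≥))))

  null-sum : ∀ k (f : Fin k → ℕ → ℚ) → (∀ j → Null (f j)) → Null (λ n → sum (λ j → f j n))
  null-sum zero    f nf = null-0
  null-sum (suc k) f nf = null-+ (nf zero) (null-sum k (f ∘ suc) (nf ∘ suc))

  bounded : ∀ x → ∃[ N ] ∃[ K ] 0ℚ < K × (∀ n → N ℕ.≤ n → ∣ seq x n ∣ ≤ K)
  bounded x with cauchy x 1ℚ (positive⁻¹ 1ℚ)
  ... | N , h = N , 1ℚ + ∣ seq x N ∣ , +-mono-<-≤ (positive⁻¹ 1ℚ) (0≤∣p∣ (seq x N)) , λ n n≥N →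
    ≤-trans (subst (λ d → ∣ d ∣ ≤ ∣ seq x n - seq x N ∣ + ∣ seq x N ∣)
      (solve 2 (λ a b → a :- b :+ b := a) refl (seq x n) (seq x N))
      (∣p+q∣≤∣p∣+∣q∣ (seq x n - seq x N) (seq x N)))
      (<⇒≤ (+-monoˡ-< ∣ seq x N ∣ (h n N n≥N ℕ.≤-refl)))

  scaled : ∀ {K ε} → 0ℚ < K → 0ℚ < ε → ∃[ δ ] 0ℚ < δ × K * δ ≡ ε
  scaled {K} {ε} 0<K 0<ε = K⁻¹ * ε
    , positive⁻¹ (K⁻¹ * ε) {{pos*pos⇒pos K⁻¹ {{1/pos⇒pos K {{K-pos}}}} ε {{positive 0<ε}}}}
    , trans (sym (*-assoc K K⁻¹ ε)) (trans (cong (_* ε) (*-inverseʳ K {{pos⇒nonZero K {{K-pos}}}})) (*-identityˡ ε))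
    where
    K-pos : Positive K
    K-pos = positive 0<K
    K⁻¹ : ℚ
    K⁻¹ = (1/ K) {{pos⇒nonZero K {{K-pos}}}}

  null-* : ∀ x {f} → Null f → Null (λ n → seq x n * f n)
  null-* x {f} nf ε 0<ε =
    let N , K , 0<K , x≤K = bounded x
        δ , 0<δ , Kδ≡ε = scaled {K} {ε} 0<K 0<ε
        M , h = nf δ 0<δ
    in M ℕ.⊔ N , λ n n≥ → subst (∣ seq x n * f n ∣ <_) Kδ≡ε
      (product (seq x n) (f n) 0<K (x≤K n (ℕ.m⊔n≤o⇒n≤o M N n≥)) (h n (ℕ.m⊔n≤o⇒m≤o M N n≥)))
    where
    product : ∀ a b {K δ} → 0ℚ < K → ∣ a ∣ ≤ K → ∣ b ∣ < δ → ∣ a * b ∣ < K * δ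
    product a b {K} {δ} 0<K a≤K b<δ = begin-strict
      ∣ a * b ∣ ≡⟨ ∣p*q∣≡∣p∣*∣q∣ a b ⟩
      ∣ a ∣ * ∣ b ∣ ≤⟨ *-monoʳ-≤-nonNeg ∣ b ∣ {{nonNegative (0≤∣p∣ b)}} a≤K ⟩
      K * ∣ b ∣ <⟨ *-monoʳ-<-pos K {{positive 0<K}} b<δ ⟩
      K * δ ∎
      where open ≤-Reasoning

  null-*ℚ : ∀ q {f} → Null f → Null (λ n → q * f n)
  null-*ℚ q = null-* (ℚ→ℝ q)

  nonneg-cong : ∀ {f g} → f ≗ g → AsymptoticallyNonneg f → AsymptoticallyNonneg g
  nonneg-cong f≗g pf ε 0<ε = let N , h = pf ε 0<ε in
    N , λ n n≥N → subst (λ a → 0ℚ < a + ε) (f≗g n) (h n n≥N)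

  nonneg-+ : ∀ {f g} → AsymptoticallyNonneg f → AsymptoticallyNonneg g →
             AsymptoticallyNonneg (λ n → f n + g n)
  nonneg-+ {f} {g} pf pg ε 0<ε =
    let M , hf = pf (½ * ε) (half 0<ε)
        N , hg = pg (½ * ε) (half 0<ε)
    in M ℕ.⊔ N , λ n n≥ → subst (0ℚ <_)
      (trans (solve 3 (λ a b e → a :+ e :+ (b :+ e) := a :+ b :+ (e :+ e)) refl (f n) (g n) (½ * ε))
        (cong (_+_ (f n + g n)) (half+half ε)))
      (+-mono-< (hf n (ℕ.m⊔n≤o⇒m≤o M N n≥)) (hg n (ℕ.m⊔n≤o⇒n≤o M N n≥)))

  null⇒nonneg : ∀ {f} → Null f → AsymptoticallyNonneg f
  null⇒nonneg {f} nf ε 0<ε = let N , h = nf ε 0<ε in N , λ n n≥N →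
    subst (_< f n + ε) (+-inverseˡ ∣ f n ∣) (+-mono-≤-< (-∣p∣≤p (f n)) (h n n≥N))

  nonneg-sum : ∀ k (f : Fin k → ℕ → ℚ) → (∀ j → AsymptoticallyNonneg (f j)) →
               AsymptoticallyNonneg (λ n → sum (λ j → f j n))
  nonneg-sum zero    f pf = null⇒nonneg null-0
  nonneg-sum (suc k) f pf = nonneg-+ {f zero} {λ n → sum (λ j → f (suc j) n)} (pf zero) (nonneg-sum k (f ∘ suc) (pf ∘ suc))

  nonneg-* : ∀ {f q} → 0ℚ ≤ q → AsymptoticallyNonneg f → AsymptoticallyNonneg (λ n → f n * q)
  nonneg-* {f} {q} 0≤q pf ε 0<ε =
    -- Dividing by q + 1 instead of q keeps the divisor positive when q = 0.
    let δ , 0<δ , Kδ≡ε = scaled {q + 1ℚ} {ε} (+-mono-≤-< 0≤q (positive⁻¹ 1ℚ)) 0<ε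
        N , h = pf δ 0<δ
    in N , λ n n≥N → subst (λ e → 0ℚ < f n * q + e) Kδ≡ε (bound (f n) δ 0<δ (h n n≥N))
    where
    bound : ∀ x δ → 0ℚ < δ → 0ℚ < x + δ → 0ℚ < x * q + (q + 1ℚ) * δ
    bound x δ 0<δ 0<x+δ = subst (0ℚ <_)
      (solve 3 (λ x d q → (x :+ d) :* q :+ d := x :* q :+ (q :+ con 1ℚ) :* d) refl x δ q)
      (+-mono-≤-< (subst (_≤ (x + δ) * q) (*-zeroʳ (x + δ))
        (*-monoˡ-≤-nonNeg (x + δ) {{nonNegative (<⇒≤ 0<x+δ)}} 0≤q)) 0<δ)

  -- For negative `q` the choice ε = -q would give 0 < 0. This is the way back from limits to exact
  -- inequalities.
  nonneg-const : ∀ {q} → AsymptoticallyNonneg (λ _ → q) → 0ℚ ≤ q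
  nonneg-const {q} pq with 0ℚ ≤? q
  ... | yes 0≤q = 0≤q
  ... | no 0≰q with pq (- q) (neg-antimono-< (≰⇒> 0≰q))
  ... | N , h = contradiction (sym (+-inverseʳ q)) (<⇒≢ (h N ℕ.≤-refl))

-- A criterion for roots to lie on the critical line.

module Roots where

  open import Data.Integer.Base using (+_)
  open import Data.List.Base using ([]; _∷_)
  open import Data.Rational.Base
  open import Data.Rational.Properties
  open import Data.Rational.Solver using (module +-*-Solver)
  open Polynomials
  open CrossPolytopes
  open Asymptotics
  open +-*-Solver

  term : ℂ → ℕ → 𝔾
  term z n = seq (Re z) n , seq (Im z) n

  term-evalℂ : ∀ p z n → term (evalℂ p z) n ≡ eval𝔾 p (term z n)
  term-evalℂ []      z n = refl
  term-evalℂ (a ∷ p) z n = cong (λ r → (a , 0ℚ) ⊕ term z n ⊗ r) (term-evalℂ p z n)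

  null-≈0 : ∀ {x} → x ≈ 0ᴿ → Null (seq x)
  null-≈0 {x} x≈0 = null-cong {λ n → seq x n - 0ℚ} (λ n → +-identityʳ (seq x n)) (converges x≈0)

  null-⟨∣⟩ : ∀ z w → z ≈ᶜ 0ᶜ → Null (λ n → ⟨ term z n ∣ term w n ⟩)
  null-⟨∣⟩ z w (Re≈0 , Im≈0) = null-+ (component (Re z) (Re w) (null-≈0 Re≈0)) (component (Im z) (Im w) (null-≈0 Im≈0))
    where
    component : ∀ x y → Null (seq x) → Null (λ n → seq x n * seq y n)
    component x y nx = null-cong (λ n → *-comm (seq y n) (seq x n)) (null-* y nx)

  -- If c H = F and Re (F Ū) = (2 Re z + 1) T with T ≥ 1, then ∣2 Re z + 1∣ ≤ ∣c Re (H Ū)∣,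
  -- which vanishes at a root of H.
  roots-on-line : ∀ (H F U : ℚ[X]) (c : ℚ) (T : 𝔾 → ℚ) →
    (∀ s → c * evalℚ H (ιⁿ s) ≡ evalℚ F (ιⁿ s)) →
    (∀ w → ⟨ eval𝔾 F w ∣ eval𝔾 U w ⟩ ≡ proj₁ (double+1 w) * T w) →
    (∀ w → 1ℚ ≤ T w) →
    ∀ z → evalℂ H z ≈ᶜ 0ᶜ → CriticalLine z
  roots-on-line H F U c T cH≡F Re[FŪ] 1≤T z Hz≈0 =
    mk≈ (null-dominated bound (null-*ℚ (½ * c) (null-⟨∣⟩ (evalℂ H z) (evalℂ U z) Hz≈0)))
    where
    -- The factor ½ turns 2 Re z + 1 into Re z - (-½), the difference that has to tend to 0.
    u : ℕ → ℚ
    u n = ½ * c * ⟨ term (evalℂ H z) n ∣ term (evalℂ U z) n ⟩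

    eval𝔾-F : ∀ w → eval𝔾 F w ≡ c ⊙ eval𝔾 H w
    eval𝔾-F w = trans (identity-principle F (c ·ₚ H) (λ s → sym (trans (evalℚ-· c H (ιⁿ s)) (cH≡F s))) w)
      (eval𝔾-· c H w)

    expand : ∀ h u → ½ * c * ⟨ h ∣ u ⟩ ≡ ½ * ⟨ c ⊙ h ∣ u ⟩
    expand (a , b) (d , e) = solve 6 (λ k c a b d e → k :* c :* (a :* d :+ b :* e)
      := k :* (c :* a :* d :+ c :* b :* e)) refl ½ c a b d e

    u≡ : ∀ n → let w = term z n in u n ≡ (seq (Re z) n - -½) * T w
    u≡ n = begin
      ½ * c * ⟨ term (evalℂ H z) n ∣ term (evalℂ U z) n ⟩
        ≡⟨ cong₂ (λ h v → ½ * c * ⟨ h ∣ v ⟩) (term-evalℂ H z n) (term-evalℂ U z n) ⟩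
      ½ * c * ⟨ eval𝔾 H w ∣ eval𝔾 U w ⟩ ≡⟨ expand (eval𝔾 H w) (eval𝔾 U w) ⟩
      ½ * ⟨ c ⊙ eval𝔾 H w ∣ eval𝔾 U w ⟩ ≡⟨ cong (λ f → ½ * ⟨ f ∣ eval𝔾 U w ⟩) (sym (eval𝔾-F w)) ⟩
      ½ * ⟨ eval𝔾 F w ∣ eval𝔾 U w ⟩ ≡⟨ cong (½ *_) (Re[FŪ] w) ⟩
      ½ * ((2ℚ * x + 1ℚ) * T w) ≡⟨ sym (*-assoc ½ (2ℚ * x + 1ℚ) (T w)) ⟩
      ½ * (2ℚ * x + 1ℚ) * T w ≡⟨ cong (_* T w) (halve x) ⟩
      (x - -½) * T w ∎
      where
      open ≡-Reasoning
      w = term z n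
      x = seq (Re z) n
      halve : ∀ x → ½ * (2ℚ * x + 1ℚ) ≡ x - -½
      halve = solve 1 (λ x → con ½ :* (con 2ℚ :* x :+ con 1ℚ) := x :- con -½) refl

    bound : ∀ n → ∣ seq (Re z) n - -½ ∣ ≤ ∣ u n ∣
    bound n = begin
      ∣ x - -½ ∣ ≡⟨ sym (*-identityʳ ∣ x - -½ ∣) ⟩
      ∣ x - -½ ∣ * 1ℚ ≤⟨ *-monoˡ-≤-nonNeg ∣ x - -½ ∣ {{nonNegative (0≤∣p∣ (x - -½))}} (1≤T w) ⟩
      ∣ x - -½ ∣ * T w ≡⟨ cong (∣ x - -½ ∣ *_) (sym (0≤p⇒∣p∣≡p (≤-trans (ιⁿ-≥0 1) (1≤T w)))) ⟩
      ∣ x - -½ ∣ * ∣ T w ∣ ≡⟨ sym (∣p*q∣≡∣p∣*∣q∣ (x - -½) (T w)) ⟩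
      ∣ (x - -½) * T w ∣ ≡⟨ cong ∣_∣ (sym (u≡ n)) ⟩
      ∣ u n ∣ ∎
      where
      open ≤-Reasoning
      w = term z n
      x = seq (Re z) n

  -- Both summands of the combination pair with `M (suc e)` to multiples of Re W. The cofactor
  -- `norm²` of the first can vanish, so the lower bound 1 comes from the second, and its
  -- coefficient is a successor.
  combination-on-line : ∀ (H : ℚ[X]) (c : ℚ) e α β →
    (∀ s → c * evalℚ H (ιⁿ s) ≡ evalℚ (ιⁿ α ·ₚ [2X+1]· M (ℕ.suc e) +ₚ ιⁿ (ℕ.suc β) ·ₚ M e) (ιⁿ s)) →
    ∀ z → evalℂ H z ≈ᶜ 0ᶜ → CriticalLine z
  combination-on-line H c e α β cH≡F = roots-on-line H F (M (ℕ.suc e)) c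
    (λ w → ιⁿ α * norm² (eval𝔾 (M (ℕ.suc e)) w) + ιⁿ (ℕ.suc β) * S e w) cH≡F pairing
    (λ w → +-≥1 (*-≥0 (ιⁿ-≥0 α) (norm²-≥0 (eval𝔾 (M (ℕ.suc e)) w))) (*-≥1 (ιⁿ-≥1 β) (S-≥1 e w)))
    where
    F = ιⁿ α ·ₚ [2X+1]· M (ℕ.suc e) +ₚ ιⁿ (ℕ.suc β) ·ₚ M e
    regroup : ∀ a b W μ ν → ⟨ a ⊙ (W ⊗ μ) ⊕ b ⊙ ν ∣ μ ⟩ ≡ a * (proj₁ W * norm² μ) + b * ⟨ μ ∣ ν ⟩
    regroup k l (x , y) (a , b) (c , d) = solve 8 (λ k l x y a b c d →
      (k :* (x :* a :- y :* b) :+ l :* c) :* a :+ (k :* (x :* b :+ y :* a) :+ l :* d) :* b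
      := k :* (x :* (a :* a :+ b :* b)) :+ l :* (a :* c :+ b :* d)) refl k l x y a b c d
    pairing : ∀ w → ⟨ eval𝔾 F w ∣ eval𝔾 (M (ℕ.suc e)) w ⟩
      ≡ proj₁ (double+1 w) * (ιⁿ α * norm² (eval𝔾 (M (ℕ.suc e)) w) + ιⁿ (ℕ.suc β) * S e w)
    pairing w = begin
      ⟨ eval𝔾 F w ∣ μ ⟩
        ≡⟨ cong (⟨_∣ μ ⟩) (trans (eval𝔾-+ (ιⁿ α ·ₚ [2X+1]· M (ℕ.suc e)) (ιⁿ (ℕ.suc β) ·ₚ M e) w)
             (cong₂ _⊕_ (trans (eval𝔾-· (ιⁿ α) ([2X+1]· M (ℕ.suc e)) w) (cong (ιⁿ α ⊙_) (eval𝔾-[2X+1] (M (ℕ.suc e)) w)))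
               (eval𝔾-· (ιⁿ (ℕ.suc β)) (M e) w))) ⟩
      ⟨ ιⁿ α ⊙ (W ⊗ μ) ⊕ ιⁿ (ℕ.suc β) ⊙ ν ∣ μ ⟩
        ≡⟨ regroup (ιⁿ α) (ιⁿ (ℕ.suc β)) W μ ν ⟩
      ιⁿ α * (proj₁ W * norm² μ) + ιⁿ (ℕ.suc β) * ⟨ μ ∣ ν ⟩
        ≡⟨ cong (λ q → ιⁿ α * (proj₁ W * norm² μ) + ιⁿ (ℕ.suc β) * q) (⟨M∣M⟩ e w) ⟩
      ιⁿ α * (proj₁ W * norm² μ) + ιⁿ (ℕ.suc β) * (proj₁ W * S e w)
        ≡⟨ solve 5 (λ a b x n s → a :* (x :* n) :+ b :* (x :* s) := x :* (a :* n :+ b :* s)) refl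
             (ιⁿ α) (ιⁿ (ℕ.suc β)) (proj₁ W) (norm² μ) (S e w) ⟩
      proj₁ W * (ιⁿ α * norm² μ + ιⁿ (ℕ.suc β) * S e w) ∎
      where
      open ≡-Reasoning
      W = double+1 w
      μ = eval𝔾 (M (ℕ.suc e)) w
      ν = eval𝔾 (M e) w

  M-on-line : ∀ H c d → (∀ s → c * evalℚ H (ιⁿ s) ≡ evalℚ (M d) (ιⁿ s)) →
              ∀ z → evalℂ H z ≈ᶜ 0ᶜ → CriticalLine z
  -- There is no polynomial below `M 0`, so it is paired with `M 1`; the cofactor is `S 0`, the
  -- constant 1.
  M-on-line H c ℕ.zero cH≡M = roots-on-line H (M 0) (M 1) c (S 0) cH≡M
    (λ w → trans (symmetric-pairing (eval𝔾 (M 0) w) (eval𝔾 (M 1) w)) (⟨M∣M⟩ 0 w)) (S-≥1 0)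
    where
    symmetric-pairing : ∀ v w → ⟨ v ∣ w ⟩ ≡ ⟨ w ∣ v ⟩
    symmetric-pairing (a , b) (c , d) = cong₂ _+_ (*-comm a c) (*-comm b d)
  M-on-line H c (ℕ.suc d) cH≡M = roots-on-line H (M (ℕ.suc d)) (M d) c (S d) cH≡M (⟨M∣M⟩ d) (S-≥1 d)

-- Kinds of vertices, and sums of coordinates by kind and sign.

module Kinds where

  open import Data.Integer.Base as ℤ using (ℤ; _+_; _-_; _*_; -_; +_; -[1+_])
  open import Data.Integer.Tactic.RingSolver using (solve-∀)
  open import Data.Vec.Base using (Vec; []; _∷_; lookup)
  open import Algebra.Properties.Semiring.Sum ℤ.+-*-semiring using (sum)

  -- The kinds of vertices of a bipartite graph with parts {hub₁, hub₂} and the rest: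
  -- leaves are adjacent to both hubs, to one of them, or to none.
  data Kind : Set where
    hub₁ hub₂ common pendant₁ pendant₂ isolated : Kind

  same : Kind → Kind → Bool
  same hub₁     hub₁     = true
  same hub₂     hub₂     = true
  same common   common   = true
  same pendant₁ pendant₁ = true
  same pendant₂ pendant₂ = true
  same isolated isolated = true
  same _        _        = false

  same⇒≡ : ∀ l k → same l k ≡ true → l ≡ k
  same⇒≡ hub₁ hub₁ _ = refl
  same⇒≡ hub₂ hub₂ _ = refl
  same⇒≡ common common _ = refl
  same⇒≡ pendant₁ pendant₁ _ = refl
  same⇒≡ pendant₂ pendant₂ _ = refl
  same⇒≡ isolated isolated _ = refl

  same-refl : ∀ k → same k k ≡ true
  same-refl hub₁ = refl
  same-refl hub₂ = refl
  same-refl common = refl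
  same-refl pendant₁ = refl
  same-refl pendant₂ = refl
  same-refl isolated = refl

  pos neg : ℤ → ℕ
  pos (+ n)    = n
  pos -[1+ n ] = 0
  neg (+ n)    = 0
  neg -[1+ n ] = suc n

  pos-neg : ∀ x → + pos x - + neg x ≡ x
  pos-neg (+ n)    = ℤ.+-identityʳ (+ n)
  pos-neg -[1+ n ] = refl

  pos+neg : ∀ x → pos x ℕ.+ neg x ≡ ℤ.∣ x ∣
  pos+neg (+ n)    = ℕ.+-identityʳ n
  pos+neg -[1+ n ] = refl

  private variable
    N : ℕ

  ⟦_⟧ : Bool → ℕ → ℕ
  ⟦ b ⟧ n = if b then n else 0

  kindSum : (ℤ → ℕ) → Vec Kind N → Kind → Vec ℤ N → ℕ
  kindSum f []      k []      = 0
  kindSum f (l ∷ κ) k (x ∷ z) = ⟦ same k l ⟧ (f x) ℕ.+ kindSum f κ k z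

  posSum negSum : Vec Kind N → Kind → Vec ℤ N → ℕ
  posSum = kindSum pos
  negSum = kindSum neg

  -- Six explicit summands, so that identities between such sums are ring identities.
  Σₖ : (Kind → ℤ) → ℤ
  Σₖ f = f hub₁ + f hub₂ + f common + f pendant₁ + f pendant₂ + f isolated

  Σₖ-+ : ∀ f g → Σₖ f + Σₖ g ≡ Σₖ (λ k → f k + g k)
  Σₖ-+ f g = lemma (f hub₁) (f hub₂) (f common) (f pendant₁) (f pendant₂) (f isolated) _ _ _ _ _ _
    where
    lemma : ∀ a b c d e f a′ b′ c′ d′ e′ f′ →
      a + b + c + d + e + f + (a′ + b′ + c′ + d′ + e′ + f′)
      ≡ (a + a′) + (b + b′) + (c + c′) + (d + d′) + (e + e′) + (f + f′)
    lemma = solve-∀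

  Σₖ-cong : ∀ {f g} → (∀ k → f k ≡ g k) → Σₖ f ≡ Σₖ g
  Σₖ-cong f≡g rewrite f≡g hub₁ | f≡g hub₂ | f≡g common | f≡g pendant₁ | f≡g pendant₂ | f≡g isolated = refl

  Σₖ-single : ∀ k a → Σₖ (λ l → if same l k then a else + 0) ≡ a
  Σₖ-single hub₁ = at₀
    where
    at₀ : ∀ a → a + + 0 + + 0 + + 0 + + 0 + + 0 ≡ a
    at₀ = solve-∀
  Σₖ-single hub₂ = at₁
    where
    at₁ : ∀ a → + 0 + a + + 0 + + 0 + + 0 + + 0 ≡ a
    at₁ = solve-∀
  Σₖ-single common = at₂
    where
    at₂ : ∀ a → + 0 + + 0 + a + + 0 + + 0 + + 0 ≡ a
    at₂ = solve-∀
  Σₖ-single pendant₁ = at₃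
    where
    at₃ : ∀ a → + 0 + + 0 + + 0 + a + + 0 + + 0 ≡ a
    at₃ = solve-∀
  Σₖ-single pendant₂ = at₄
    where
    at₄ : ∀ a → + 0 + + 0 + + 0 + + 0 + a + + 0 ≡ a
    at₄ = solve-∀
  Σₖ-single isolated = at₅
    where
    at₅ : ∀ a → + 0 + + 0 + + 0 + + 0 + + 0 + a ≡ a
    at₅ = solve-∀

  -- The piecewise linear function equal to c x for x ≥ 0 and to -d x for x < 0: linear when d = -c,
  -- the absolute value when c = d = 1.
  hinge : (c d x : ℤ) → ℤ
  hinge c d x = c * + pos x + d * + neg x

  hinge-at : ∀ (c d : Kind → ℤ) k x → Σₖ (λ l → c l * + ⟦ same l k ⟧ (pos x) + d l * + ⟦ same l k ⟧ (neg x)) ≡ hinge (c k) (d k) x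
  hinge-at c d k x = trans (Σₖ-cong select) (Σₖ-single k (hinge (c k) (d k) x))
    where
    select : ∀ l → c l * + ⟦ same l k ⟧ (pos x) + d l * + ⟦ same l k ⟧ (neg x)
                 ≡ (if same l k then hinge (c k) (d k) x else + 0)
    select l with same l k in eq
    ... | true  rewrite same⇒≡ l k eq = refl
    ... | false = cong₂ ℤ._+_ (ℤ.*-zeroʳ (c l)) (ℤ.*-zeroʳ (d l))

  -- Every vertex sum that occurs later has this form, so the geometry becomes linear arithmetic in
  -- the twelve numbers `posSum κ k z` and `negSum κ k z`.
  sum-hinge : ∀ (κ : Vec Kind N) (c d : Kind → ℤ) z →
    sum (λ v → hinge (c (lookup κ v)) (d (lookup κ v)) (lookup z v))
    ≡ Σₖ (λ k → c k * + posSum κ k z + d k * + negSum κ k z)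
  sum-hinge []       c d []      = sym (trans (Σₖ-cong (λ k → cong₂ ℤ._+_ (ℤ.*-zeroʳ (c k)) (ℤ.*-zeroʳ (d k)))) refl)
  sum-hinge (k₀ ∷ κ) c d (x ∷ z) = begin
    hinge (c k₀) (d k₀) x + sum (λ v → hinge (c (lookup κ v)) (d (lookup κ v)) (lookup z v))
      ≡⟨ cong₂ ℤ._+_ (sym (hinge-at c d k₀ x)) (sum-hinge κ c d z) ⟩
    Σₖ (λ k → c k * + p k + d k * + q k) + Σₖ (λ k → c k * + p′ k + d k * + q′ k)
      ≡⟨ Σₖ-+ (λ k → c k * + p k + d k * + q k) (λ k → c k * + p′ k + d k * + q′ k) ⟩
    Σₖ (λ k → (c k * + p k + d k * + q k) + (c k * + p′ k + d k * + q′ k))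
      ≡⟨ Σₖ-cong (λ k → regroup (c k) (d k) (+ p k) (+ q k) (+ p′ k) (+ q′ k)) ⟩
    Σₖ (λ k → c k * + (p k ℕ.+ p′ k) + d k * + (q k ℕ.+ q′ k)) ∎
    where
    open ≡-Reasoning
    p q p′ q′ : Kind → ℕ
    p k = ⟦ same k k₀ ⟧ (pos x)
    q k = ⟦ same k k₀ ⟧ (neg x)
    p′ k = posSum κ k z
    q′ k = negSum κ k z
    regroup : ∀ c d p q p′ q′ → (c * p + d * q) + (c * p′ + d * q′)
                              ≡ c * (p + p′) + d * (q + q′)
    regroup = solve-∀

-- Enumeration of the leaf coordinates and the number of lattice points.

module LeafVectors where

  open import Data.Integer.Base as ℤ using (ℤ; +_; -[1+_]; ∣_∣)
  open import Data.List.Base using (List; []; _∷_; map; concatMap; _++_)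
  open import Data.List.Membership.Propositional using (_∈_; lose)
  open import Data.List.Membership.Propositional.Properties using (∈-map⁺; ∈-map⁻; ∈-concatMap⁺)
  open import Data.List.Properties using (map-∘; map-cong; map-cong-local)
  open import Data.List.Relation.Unary.All as All using (All; []; _∷_)
  import Data.List.Relation.Unary.All.Properties as All
  open import Data.List.Relation.Unary.AllPairs as AllPairs using (AllPairs; []; _∷_)
  import Data.List.Relation.Unary.AllPairs.Properties as AllPairs
  open import Data.List.Relation.Unary.Any using (here; there)
  open import Data.List.Relation.Unary.Unique.Propositional using (Unique)
  import Data.List.Relation.Unary.Unique.Propositional.Properties as Unique
  open import Data.Nat.Base
  open import Data.Nat.ListAction using (sum)
  open import Data.Nat.Properties
  open import Data.Nat.Tactic.RingSolver using (solve-∀)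
  open import Data.Vec.Base using (Vec; []; _∷_; lookup)
  open import Data.Vec.Properties using (∷-injectiveˡ; ∷-injectiveʳ)
  open Kinds
  open Sequences

  private variable
    A B : Set
    N : ℕ

  sum-map-concatMap : ∀ (f : B → ℕ) (g : A → List B) xs →
    sum (map f (concatMap g xs)) ≡ sum (map (λ x → sum (map f (g x))) xs)
  sum-map-concatMap f g []       = refl
  sum-map-concatMap f g (x ∷ xs) = trans (sum-map-++ (g x) (concatMap g xs))
    (cong (_+_ (sum (map f (g x)))) (sum-map-concatMap f g xs))
    where
    sum-map-++ : ∀ ys zs → sum (map f (ys ++ zs)) ≡ sum (map f ys) + sum (map f zs)
    sum-map-++ []       zs = refl
    sum-map-++ (y ∷ ys) zs = trans (cong (_+_ (f y)) (sum-map-++ ys zs)) (sym (+-assoc (f y) _ _))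

  sum-map-+ : ∀ (f g : A → ℕ) xs → sum (map (λ x → f x + g x) xs) ≡ sum (map f xs) + sum (map g xs)
  sum-map-+ f g []       = refl
  sum-map-+ f g (x ∷ xs) = trans (cong (_+_ (f x + g x)) (sum-map-+ f g xs))
    (lemma (f x) (g x) _ _)
    where
    lemma : ∀ a b c d → a + b + (c + d) ≡ a + c + (b + d)
    lemma = solve-∀

  sum-map-* : ∀ k (f : A → ℕ) xs → sum (map (λ x → k * f x) xs) ≡ k * sum (map f xs)
  sum-map-* k f []       = sym (*-zeroʳ k)
  sum-map-* k f (x ∷ xs) = trans (cong (_+_ (k * f x)) (sum-map-* k f xs)) (sym (*-distribˡ-+ k (f x) _))

  -- `P` records what is known about the entries of `xs`; two entries have to be told apart by their
  -- lists only under that knowledge.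
  unique-concatMap : ∀ {P : A → Set} (f : A → List B) {xs} → All P xs → Unique xs →
    (∀ {x} → P x → Unique (f x)) →
    (∀ {x y v} → P x → P y → v ∈ f x → v ∈ f y → x ≡ y) →
    Unique (concatMap f xs)
  unique-concatMap {P = P} f all-P unique unique-f separated =
    Unique.concat⁺ (All.map⁺ (All.map unique-f all-P)) (AllPairs.map⁺ (disjoint all-P unique))
    where
    disjoint : ∀ {xs} → All P xs → Unique xs → AllPairs _ xs
    disjoint []         []              = []
    disjoint (px ∷ pxs) (x≢xs ∷ unique) =
      All.zipWith (λ { (x≢y , py) (v∈fx , v∈fy) → x≢y (separated px py v∈fx v∈fy) }) (x≢xs , pxs)
      ∷ disjoint pxs unique

  ball : ℕ → List ℤ
  ball zero    = + 0 ∷ []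
  ball (suc s) = + suc s ∷ -[1+ s ] ∷ ball s

  ball-bounded : ∀ s → All (λ x → ∣ x ∣ ≤ s) (ball s)
  ball-bounded zero    = z≤n ∷ []
  ball-bounded (suc s) = ≤-refl ∷ ≤-refl ∷ All.map m≤n⇒m≤1+n (ball-bounded s)

  ball-complete : ∀ s x → ∣ x ∣ ≤ s → x ∈ ball s
  ball-complete zero    (+ zero)  _ = here refl
  ball-complete (suc s) x ∣x∣≤1+s with m≤n⇒m<n∨m≡n ∣x∣≤1+s
  ... | inj₁ ∣x∣<1+s = there (there (ball-complete s x (s≤s⁻¹ ∣x∣<1+s)))
  ... | inj₂ ∣x∣≡1+s with x
  ...   | + _      = here (cong +_ ∣x∣≡1+s)
  ...   | -[1+ _ ] = there (here (cong -[1+_] (suc-injective ∣x∣≡1+s)))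

  ball-unique : ∀ s → Unique (ball s)
  ball-unique zero    = [] ∷ []
  ball-unique (suc s) =
    ((λ ()) ∷ All.map (λ { ∣x∣≤s refl → <-irrefl refl ∣x∣≤s }) (ball-bounded s))
    ∷ All.map (λ { ∣x∣≤s refl → <-irrefl refl ∣x∣≤s }) (ball-bounded s)
    ∷ ball-unique s

  suc-∸-ball : ∀ s → All (λ x → suc s ∸ ∣ x ∣ ≡ suc (s ∸ ∣ x ∣)) (ball s)
  suc-∸-ball s = All.map (+-∸-assoc 1) (ball-bounded s)

  sum-ball : ∀ g s → sum (map (λ x → g (s ∸ ∣ x ∣)) (ball s)) ≡ T g s
  sum-ball g zero    = +-identityʳ (g 0)
  sum-ball g (suc s) = begin
    g (s ∸ s) + (g (s ∸ s) + sum (map (λ x → g (suc s ∸ ∣ x ∣)) (ball s)))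
      ≡⟨ cong₂ (λ i t → g i + (g i + t)) (n∸n≡0 s)
           (cong sum (map-cong-local (All.map (cong g) (suc-∸-ball s)))) ⟩
    g 0 + (g 0 + sum (map (λ x → g (suc (s ∸ ∣ x ∣))) (ball s)))
      ≡⟨ cong (λ t → g 0 + (g 0 + t)) (sum-ball (g ∘ suc) s) ⟩
    g 0 + (g 0 + T (g ∘ suc) s)
      ≡⟨ lemma (g 0) _ ⟩
    2 * g 0 + T (g ∘ suc) s ∎
    where
    open ≡-Reasoning
    lemma : ∀ a b → a + (a + b) ≡ 2 * a + b
    lemma = solve-∀

  sum-ball-weighted : ∀ g s → sum (map (λ x → ∣ x ∣ * g (s ∸ ∣ x ∣)) (ball s)) ≡ T′ g s
  sum-ball-weighted g zero    = refl
  sum-ball-weighted g (suc s) = begin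
    suc s * g (s ∸ s) + (suc s * g (s ∸ s) + sum (map (λ x → ∣ x ∣ * g (suc s ∸ ∣ x ∣)) (ball s)))
      ≡⟨ cong₂ (λ i t → suc s * g i + (suc s * g i + t)) (n∸n≡0 s)
           (cong sum (map-cong-local (All.map (λ {x} eq → cong (λ i → ∣ x ∣ * g i) eq) (suc-∸-ball s)))) ⟩
    suc s * g 0 + (suc s * g 0 + sum (map (λ x → ∣ x ∣ * g (suc (s ∸ ∣ x ∣))) (ball s)))
      ≡⟨ cong (λ t → suc s * g 0 + (suc s * g 0 + t)) (sum-ball-weighted (g ∘ suc) s) ⟩
    suc s * g 0 + (suc s * g 0 + T′ (g ∘ suc) s)
      ≡⟨ lemma s (g 0) _ ⟩
    2 * suc s * g 0 + T′ (g ∘ suc) s ∎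
    where
    open ≡-Reasoning
    lemma : ∀ s a b → (1 + s) * a + ((1 + s) * a + b) ≡ 2 * (1 + s) * a + b
    lemma = solve-∀

  leaf? : Kind → Bool
  leaf? common    = true
  leaf? pendant₁  = true
  leaf? pendant₂  = true
  leaf? _         = false

  ∥_∥ : Vec ℤ N → ℕ
  ∥ [] ∥    = 0
  ∥ x ∷ z ∥ = ∣ x ∣ + ∥ z ∥

  ∷-ball : (ℕ → List (Vec ℤ N)) → ℕ → List (Vec ℤ (suc N))
  ∷-ball f s = concatMap (λ x → map (x ∷_) (f (s ∸ ∣ x ∣))) (ball s)

  -- The other coordinates are set to 0 for now: those of the hubs are filled in by `place`, and
  -- those of isolated vertices vanish at every lattice point.
  leafVectors : Vec Kind N → ℕ → List (Vec ℤ N)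
  leafVectors []      s = [] ∷ []
  leafVectors (k ∷ κ) s = if leaf? k then ∷-ball (leafVectors κ) s else map (+ 0 ∷_) (leafVectors κ s)

  Supported : Vec Kind N → Vec ℤ N → Set
  Supported κ w = ∀ v → leaf? (lookup κ v) ≡ false → lookup w v ≡ + 0

  leafVectors-sound : ∀ (κ : Vec Kind N) s → All (λ w → Supported κ w × ∥ w ∥ ≤ s) (leafVectors κ s)
  leafVectors-sound []      s = ((λ ()) , z≤n) ∷ []
  leafVectors-sound (k ∷ κ) s with leaf? k in eq
  ... | true  = All.concat⁺ (All.map⁺ (All.map extend (ball-bounded s)))
    where
    extend : ∀ {x} → ∣ x ∣ ≤ s → All (λ w → Supported (k ∷ κ) w × ∥ w ∥ ≤ s) (map (x ∷_) (leafVectors κ (s ∸ ∣ x ∣)))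
    extend {x} ∣x∣≤s = All.map⁺ (All.map
      (λ { (supp , ∥w∥≤) → (λ { zero leaf → contradiction (trans (sym eq) leaf) λ () ; (suc v) → supp v })
         , subst (∣ x ∣ + _ ≤_) (m+[n∸m]≡n ∣x∣≤s) (+-monoʳ-≤ ∣ x ∣ ∥w∥≤) })
      (leafVectors-sound κ (s ∸ ∣ x ∣)))
  ... | false = All.map⁺ (All.map (λ { (supp , ∥w∥≤s) → (λ { zero _ → refl ; (suc v) → supp v }) , ∥w∥≤s })
                  (leafVectors-sound κ s))

  leafVectors-complete : ∀ (κ : Vec Kind N) s w → Supported κ w → ∥ w ∥ ≤ s → w ∈ leafVectors κ s
  leafVectors-complete []      s []      _    _    = here refl
  leafVectors-complete (k ∷ κ) s (x ∷ w) supp ∥≤s with leaf? k in eq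
  ... | true  = ∈-concatMap⁺ (λ x → map (x ∷_) (leafVectors κ (s ∸ ∣ x ∣)))
    (lose (ball-complete s x (m+n≤o⇒m≤o ∣ x ∣ ∥≤s))
      (∈-map⁺ (x ∷_) (leafVectors-complete κ (s ∸ ∣ x ∣) w (supp ∘ suc) (m+n≤o⇒m≤o∸n ∥ w ∥ (subst (_≤ s) (+-comm ∣ x ∣ ∥ w ∥) ∥≤s)))))
  ... | false with supp zero eq
  ...   | refl = ∈-map⁺ (+ 0 ∷_) (leafVectors-complete κ s w (supp ∘ suc) ∥≤s)

  leafVectors-unique : ∀ (κ : Vec Kind N) s → Unique (leafVectors κ s)
  leafVectors-unique []      s = [] ∷ []
  leafVectors-unique (k ∷ κ) s with leaf? k
  ... | true  = unique-concatMap (λ x → map (x ∷_) (leafVectors κ (s ∸ ∣ x ∣))) (ball-bounded s) (ball-unique s)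
    (λ _ → Unique.map⁺ ∷-injectiveʳ (leafVectors-unique κ _))
    (λ {x} {y} _ _ v∈x v∈y → let _ , _ , v≡x∷ = ∈-map⁻ (x ∷_) v∈x ; _ , _ , v≡y∷ = ∈-map⁻ (y ∷_) v∈y
                             in ∷-injectiveˡ (trans (sym v≡x∷) v≡y∷))
  ... | false = Unique.map⁺ ∷-injectiveʳ (leafVectors-unique κ s)

  commonMass : Vec Kind N → Vec ℤ N → ℕ
  commonMass κ w = posSum κ common w + negSum κ common w

  commonCount pendantCount leafCount : Vec Kind N → ℕ
  commonCount []             = 0
  commonCount (common ∷ κ)   = suc (commonCount κ)
  commonCount (_ ∷ κ)        = commonCount κ
  pendantCount []              = 0
  pendantCount (pendant₁ ∷ κ)  = suc (pendantCount κ)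
  pendantCount (pendant₂ ∷ κ)  = suc (pendantCount κ)
  pendantCount (_ ∷ κ)         = pendantCount κ
  leafCount κ = commonCount κ + pendantCount κ

  sum-∷-ball : ∀ (f : Vec ℤ (suc N) → ℕ) (ws : ℕ → List (Vec ℤ N)) s →
    sum (map f (∷-ball ws s)) ≡ sum (map (λ x → sum (map (λ w → f (x ∷ w)) (ws (s ∸ ∣ x ∣)))) (ball s))
  sum-∷-ball f ws s = trans (sum-map-concatMap f (λ x → map (x ∷_) (ws (s ∸ ∣ x ∣))) (ball s))
    (cong sum (map-cong (λ x → cong sum (sym (map-∘ (ws (s ∸ ∣ x ∣))))) (ball s)))

  slackSum : (ℕ → ℕ) → Vec Kind N → ℕ → ℕ
  slackSum g κ s = sum (map (λ w → g (s ∸ ∥ w ∥)) (leafVectors κ s))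

  slackSum-leaf : ∀ g (κ : Vec Kind N) d → (∀ s → slackSum g κ s ≡ T^ d g s) → ∀ s →
    sum (map (λ w → g (s ∸ ∥ w ∥)) (∷-ball (leafVectors κ) s)) ≡ T^ (suc d) g s
  slackSum-leaf g κ d ih s = begin
    sum (map (λ w → g (s ∸ ∥ w ∥)) (∷-ball (leafVectors κ) s))
      ≡⟨ sum-∷-ball (λ w → g (s ∸ ∥ w ∥)) (leafVectors κ) s ⟩
    sum (map (λ x → sum (map (λ w → g (s ∸ (∣ x ∣ + ∥ w ∥))) (leafVectors κ (s ∸ ∣ x ∣)))) (ball s))
      ≡⟨ cong sum (map-cong (λ x → trans
           (cong sum (map-cong (λ w → cong g (sym (∸-+-assoc s ∣ x ∣ ∥ w ∥))) (leafVectors κ (s ∸ ∣ x ∣))))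
           (ih (s ∸ ∣ x ∣))) (ball s)) ⟩
    sum (map (λ x → T^ d g (s ∸ ∣ x ∣)) (ball s))
      ≡⟨ sum-ball (T^ d g) s ⟩
    T^ (suc d) g s ∎
    where open ≡-Reasoning

  -- A leaf coordinate x leaves the slack s - ∣x∣ to the remaining ones, so each leaf contributes
  -- one application of `T`, and every other vertex contributes nothing.
  slackSum-T^ : ∀ g (κ : Vec Kind N) s → slackSum g κ s ≡ T^ (leafCount κ) g s
  slackSum-T^ g []             s = +-identityʳ (g s)
  slackSum-T^ g (common ∷ κ)   s = slackSum-leaf g κ (leafCount κ) (slackSum-T^ g κ) s
  slackSum-T^ g (pendant₁ ∷ κ) s = trans (slackSum-leaf g κ (leafCount κ) (slackSum-T^ g κ) s)
    (cong (λ d → T^ d g s) (sym (+-suc (commonCount κ) (pendantCount κ))))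
  slackSum-T^ g (pendant₂ ∷ κ) s = trans (slackSum-leaf g κ (leafCount κ) (slackSum-T^ g κ) s)
    (cong (λ d → T^ d g s) (sym (+-suc (commonCount κ) (pendantCount κ))))
  slackSum-T^ g (hub₁ ∷ κ)     s = trans (cong sum (sym (map-∘ (leafVectors κ s)))) (slackSum-T^ g κ s)
  slackSum-T^ g (hub₂ ∷ κ)     s = trans (cong sum (sym (map-∘ (leafVectors κ s)))) (slackSum-T^ g κ s)
  slackSum-T^ g (isolated ∷ κ) s = trans (cong sum (sym (map-∘ (leafVectors κ s)))) (slackSum-T^ g κ s)

  massSum : Vec Kind N → ℕ → ℕ
  massSum κ s = sum (map (commonMass κ) (leafVectors κ s))

  -- By symmetry each of the K common coordinates contributes T′ L_{E−1} to massSum, and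
  -- 2 T′ L_{E−1} = L_{E+1} − L_{E−1}.
  MassFormula : Vec Kind N → Set
  MassFormula κ = ∀ s → 2 * massSum κ s + commonCount κ * L (pred (leafCount κ)) s
                      ≡ commonCount κ * L (suc (leafCount κ)) s

  -- The new coordinate contributes ∣x∣ once for each of the `L (leafCount κ) (s ∸ ∣ x ∣)`
  -- completions; the completions contribute their own mass.
  massSum-common : ∀ (κ : Vec Kind N) s →
    massSum (common ∷ κ) s ≡ T′ (L (leafCount κ)) s + T (massSum κ) s
  massSum-common κ s = begin
    massSum (common ∷ κ) s
      ≡⟨ sum-∷-ball (commonMass (common ∷ κ)) (leafVectors κ) s ⟩
    sum (map (λ x → sum (map (λ w → commonMass (common ∷ κ) (x ∷ w)) (leafVectors κ (s ∸ ∣ x ∣)))) (ball s))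
      ≡⟨ cong sum (map-cong split (ball s)) ⟩
    sum (map (λ x → ∣ x ∣ * L (leafCount κ) (s ∸ ∣ x ∣) + massSum κ (s ∸ ∣ x ∣)) (ball s))
      ≡⟨ sum-map-+ (λ x → ∣ x ∣ * L (leafCount κ) (s ∸ ∣ x ∣)) (λ x → massSum κ (s ∸ ∣ x ∣)) (ball s) ⟩
    sum (map (λ x → ∣ x ∣ * L (leafCount κ) (s ∸ ∣ x ∣)) (ball s)) + sum (map (λ x → massSum κ (s ∸ ∣ x ∣)) (ball s))
      ≡⟨ cong₂ _+_ (sum-ball-weighted (L (leafCount κ)) s) (sum-ball (massSum κ) s) ⟩
    T′ (L (leafCount κ)) s + T (massSum κ) s ∎
    where
    open ≡-Reasoning
    -- The factor 1 lets the sum of the constant ∣x∣ become ∣x∣ times a `slackSum` of the constant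
    -- 1, which is a value of `L`.
    regroup : ∀ a b c d → a + b + (c + d) ≡ (a + c) * 1 + (b + d)
    regroup = solve-∀
    split : ∀ x → sum (map (λ w → commonMass (common ∷ κ) (x ∷ w)) (leafVectors κ (s ∸ ∣ x ∣)))
                ≡ ∣ x ∣ * L (leafCount κ) (s ∸ ∣ x ∣) + massSum κ (s ∸ ∣ x ∣)
    split x = begin
      sum (map (λ w → commonMass (common ∷ κ) (x ∷ w)) ws)
        ≡⟨ cong sum (map-cong (λ w → trans (regroup (pos x) (posSum κ common w) (neg x) (negSum κ common w))
             (cong (λ a → a * 1 + commonMass κ w) (pos+neg x))) ws) ⟩
      sum (map (λ w → ∣ x ∣ * 1 + commonMass κ w) ws)
        ≡⟨ sum-map-+ (λ _ → ∣ x ∣ * 1) (commonMass κ) ws ⟩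
      sum (map (λ _ → ∣ x ∣ * 1) ws) + massSum κ (s ∸ ∣ x ∣)
        ≡⟨ cong (_+ massSum κ (s ∸ ∣ x ∣)) (sum-map-* ∣ x ∣ (λ _ → 1) ws) ⟩
      ∣ x ∣ * sum (map (λ _ → 1) ws) + massSum κ (s ∸ ∣ x ∣)
        ≡⟨ cong (λ t → ∣ x ∣ * t + massSum κ (s ∸ ∣ x ∣)) (slackSum-T^ (λ _ → 1) κ (s ∸ ∣ x ∣)) ⟩
      ∣ x ∣ * L (leafCount κ) (s ∸ ∣ x ∣) + massSum κ (s ∸ ∣ x ∣) ∎
      where ws = leafVectors κ (s ∸ ∣ x ∣)

  -- T (L (pred E)) = L E needs E ≠ 0, hence the case split on K.
  T-massFormula : ∀ (κ : Vec Kind N) → MassFormula κ → ∀ s →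
    2 * T (massSum κ) s + commonCount κ * L (leafCount κ) s ≡ commonCount κ * L (2 + leafCount κ) s
  T-massFormula κ formula s with commonCount κ
  ... | zero  = trans (cong (_+ 0) (sym (T-* 2 (massSum κ) s)))
    (trans (cong (_+ 0) (T-cong (λ i → trans (sym (+-identityʳ _)) (formula i)) s)) (trans (+-identityʳ _) (T-0 s)))
    where
    T-0 : ∀ s → T (λ _ → 0) s ≡ 0
    T-0 s = T-* 0 (λ _ → 0) s
  ... | suc k = begin
    2 * T (massSum κ) s + suc k * T (L (k + pendantCount κ)) s
      ≡⟨ sym (cong₂ _+_ (T-* 2 (massSum κ) s) (T-* (suc k) (L (k + pendantCount κ)) s)) ⟩
    T (λ i → 2 * massSum κ i) s + T (λ i → suc k * L (k + pendantCount κ) i) s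
      ≡⟨ sym (T-+ _ _ s) ⟩
    T (λ i → 2 * massSum κ i + suc k * L (k + pendantCount κ) i) s
      ≡⟨ T-cong formula s ⟩
    T (λ i → suc k * L (2 + (k + pendantCount κ)) i) s
      ≡⟨ T-* (suc k) (L (2 + (k + pendantCount κ))) s ⟩
    suc k * L (3 + (k + pendantCount κ)) s ∎
    where open ≡-Reasoning

  massSum-pendant : ∀ k (κ : Vec Kind N) →
    (∀ x w → commonMass (k ∷ κ) (x ∷ w) ≡ commonMass κ w) → ∀ s →
    sum (map (commonMass (k ∷ κ)) (∷-ball (leafVectors κ) s)) ≡ T (massSum κ) s
  massSum-pendant k κ ignores s = trans (sum-∷-ball (commonMass (k ∷ κ)) (leafVectors κ) s)
    (trans (cong sum (map-cong (λ x → cong sum (map-cong (ignores x) (leafVectors κ (s ∸ ∣ x ∣)))) (ball s)))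
      (sum-ball (massSum κ) s))

  massFormula-zero : ∀ (κ : Vec Kind N) (mass : Vec ℤ (suc N) → ℕ) s → (∀ w → mass (+ 0 ∷ w) ≡ commonMass κ w) → MassFormula κ →
    2 * sum (map mass (map (+ 0 ∷_) (leafVectors κ s))) + commonCount κ * L (pred (leafCount κ)) s
      ≡ commonCount κ * L (suc (leafCount κ)) s
  massFormula-zero κ mass s mass≡ formula = trans (cong (λ a → 2 * sum a + commonCount κ * L (pred (leafCount κ)) s)
    (trans (sym (map-∘ (leafVectors κ s))) (map-cong mass≡ (leafVectors κ s)))) (formula s)

  -- Induction over the vertices. A pendant leaf applies `T` to the formula; a common leaf does so
  -- too, and in addition contributes L_E + 2 T′ L_E = L_{E+2}, which is `T∘T`.
  massFormula : ∀ (κ : Vec Kind N) → MassFormula κ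
  massFormula []           s = refl
  massFormula (common ∷ κ) s = begin
    2 * massSum (common ∷ κ) s + suc K * L E s
      ≡⟨ cong (λ a → 2 * a + suc K * L E s) (massSum-common κ s) ⟩
    2 * (T′ (L E) s + T (massSum κ) s) + suc K * L E s
      ≡⟨ regroup K (T′ (L E) s) (T (massSum κ) s) (L E s) ⟩
    L E s + 2 * T′ (L E) s + (2 * T (massSum κ) s + K * L E s)
      ≡⟨ cong₂ _+_ (sym (T∘T (L E) s)) (T-massFormula κ (massFormula κ) s) ⟩
    L (2 + E) s + K * L (2 + E) s ∎
    where
    open ≡-Reasoning
    K = commonCount κ
    E = leafCount κ
    regroup : ∀ k a b c → 2 * (a + b) + (1 + k) * c ≡ c + 2 * a + (2 * b + k * c)
    regroup = solve-∀
  massFormula (pendant₁ ∷ κ) s rewrite +-suc (commonCount κ) (pendantCount κ) =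
    trans (cong (λ a → 2 * a + commonCount κ * L (leafCount κ) s) (massSum-pendant pendant₁ κ (λ _ _ → refl) s))
      (T-massFormula κ (massFormula κ) s)
  massFormula (pendant₂ ∷ κ) s rewrite +-suc (commonCount κ) (pendantCount κ) =
    trans (cong (λ a → 2 * a + commonCount κ * L (leafCount κ) s) (massSum-pendant pendant₂ κ (λ _ _ → refl) s))
      (T-massFormula κ (massFormula κ) s)
  massFormula (hub₁ ∷ κ)     s = massFormula-zero κ (commonMass (hub₁ ∷ κ)) s (λ _ → refl) (massFormula κ)
  massFormula (hub₂ ∷ κ)     s = massFormula-zero κ (commonMass (hub₂ ∷ κ)) s (λ _ → refl) (massFormula κ)
  massFormula (isolated ∷ κ) s = massFormula-zero κ (commonMass (isolated ∷ κ)) s (λ _ → refl) (massFormula κ)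

  -- A flow from hub to hub beyond what the common vertices can absorb costs 2 per unit
  -- and has to pass through a common vertex.
  halfSlack : (commonCount slack : ℕ) → ℕ
  halfSlack zero    j = 0
  halfSlack (suc _) j = ⌊ j /2⌋

  -- The supply y of `hub₁` to the common vertices ranges over the integers from -X⁺ - h to X⁻ + h,
  -- where X⁺ and X⁻ are the positive and the negative common mass and h is the half slack.
  width : Vec Kind N → ℕ → Vec ℤ N → ℕ
  width κ s w = suc (commonMass κ w + 2 * halfSlack (commonCount κ) (s ∸ ∥ w ∥))

  pointCount : Vec Kind N → ℕ → ℕ
  pointCount κ s = sum (map (width κ s) (leafVectors κ s))

  pointCount-split : ∀ (κ : Vec Kind N) s → pointCount κ s
    ≡ L (leafCount κ) s + (massSum κ s + T^ (leafCount κ) (λ j → 2 * halfSlack (commonCount κ) j) s)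
  pointCount-split κ s = begin
    pointCount κ s
      ≡⟨ sum-map-+ (λ _ → 1) (λ w → commonMass κ w + 2 * halfSlack (commonCount κ) (s ∸ ∥ w ∥)) ws ⟩
    sum (map (λ _ → 1) ws) + sum (map (λ w → commonMass κ w + 2 * halfSlack (commonCount κ) (s ∸ ∥ w ∥)) ws)
      ≡⟨ cong (_+_ (sum (map (λ _ → 1) ws))) (sum-map-+ (commonMass κ) (λ w → 2 * halfSlack (commonCount κ) (s ∸ ∥ w ∥)) ws) ⟩
    sum (map (λ _ → 1) ws) + (massSum κ s + slackSum (λ j → 2 * halfSlack (commonCount κ) j) κ s)
      ≡⟨ cong₂ (λ a b → a + (massSum κ s + b)) (slackSum-T^ (λ _ → 1) κ s) (slackSum-T^ (λ j → 2 * halfSlack (commonCount κ) j) κ s) ⟩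
    L (leafCount κ) s + (massSum κ s + T^ (leafCount κ) (λ j → 2 * halfSlack (commonCount κ) j) s) ∎
    where
    open ≡-Reasoning
    ws = leafVectors κ s

  module _ (κ : Vec Kind N) {K} (commonCount≡K : commonCount κ ≡ K) (s : ℕ) where

    -- With `K` in place of `commonCount κ`, both `halfSlack` and `pred` reduce as soon as `K` is
    -- zero or a successor.
    pointCount-split′ : pointCount κ s
      ≡ L (K + pendantCount κ) s + (massSum κ s + T^ (K + pendantCount κ) (λ j → 2 * halfSlack K j) s)
    pointCount-split′ = subst (λ K → pointCount κ s
      ≡ L (K + pendantCount κ) s + (massSum κ s + T^ (K + pendantCount κ) (λ j → 2 * halfSlack K j) s))
      commonCount≡K (pointCount-split κ s)

    massFormula′ : 2 * massSum κ s + K * L (pred (K + pendantCount κ)) s ≡ K * L (suc (K + pendantCount κ)) s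
    massFormula′ = subst (λ K → 2 * massSum κ s + K * L (pred (K + pendantCount κ)) s
      ≡ K * L (suc (K + pendantCount κ)) s) commonCount≡K (massFormula κ s)

  pointCount-forest : ∀ (κ : Vec Kind N) → commonCount κ ≡ 0 → ∀ s → pointCount κ s ≡ L (pendantCount κ) s
  pointCount-forest κ K≡0 s = trans (pointCount-split′ κ K≡0 s)
    (trans (cong₂ (λ a b → L (pendantCount κ) s + (a + b)) mass≡0 (T^-0 (pendantCount κ) s)) (+-identityʳ _))
    where
    mass≡0 : massSum κ s ≡ 0
    mass≡0 = m+n≡0⇒m≡0 (massSum κ s) (m+n≡0⇒m≡0 (2 * massSum κ s) (massFormula′ κ K≡0 s))
    T^-0 : ∀ d s → T^ d (λ _ → 0) s ≡ 0
    T^-0 zero    s = refl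
    T^-0 (suc d) s = trans (T-cong (T^-0 d) s) (T-* 0 (λ _ → 0) s)

  -- Here K = 1 + k, E = 1 + r, and p is the number of pendants. Eliminating L_{E+1} leaves L_{E-1}
  -- with the coefficient (K + 1) E - (K - 1)(E + 1) = E + 1 + p, which is positive.
  pointCount-common : ∀ (κ : Vec Kind N) k → commonCount κ ≡ suc k → ∀ s →
    let r = k + pendantCount κ in
    2 * (2 + r) * pointCount κ s
      ≡ (2 + k) * ((2 * s + 1) * L (suc r) s) + (2 + r + pendantCount κ) * L r s
  -- The term (E + 1) K L_{E-1} is added on both sides: it completes `massFormula′`, and the
  -- computation stays within ℕ.
  pointCount-common κ k K≡1+k s = +-cancelʳ-≡ ((2 + r) * (suc k * L r s)) _ _ (begin
    2 * (2 + r) * pointCount κ s + (2 + r) * (suc k * L r s)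
      ≡⟨ cong (λ a → 2 * (2 + r) * a + (2 + r) * (suc k * L r s)) (pointCount-split′ κ K≡1+k s) ⟩
    2 * (2 + r) * (L (suc r) s + (massSum κ s + T^ (suc r) even s)) + (2 + r) * (suc k * L r s)
      ≡⟨ regroup r (L (suc r) s) (massSum κ s) (T^ (suc r) even s) (suc k * L r s) ⟩
    (2 + r) * (2 * T^ (suc r) even s + 2 * L (suc r) s + (2 * massSum κ s + suc k * L r s))
      ≡⟨ cong₂ (λ a b → (2 + r) * (a + b)) (T^-even r s) (massFormula′ κ K≡1+k s) ⟩
    (2 + r) * (L (2 + r) s + L r s + suc k * L (2 + r) s)
      ≡⟨ isolate r k (L (2 + r) s) (L r s) ⟩
    (2 + k) * ((2 + r) * L (2 + r) s) + (2 + r) * L r s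
      ≡⟨ cong (λ a → (2 + k) * a + (2 + r) * L r s) (L-recurrence r s) ⟩
    (2 + k) * ((2 * s + 1) * L (suc r) s + (1 + r) * L r s) + (2 + r) * L r s
      ≡⟨ balance k (pendantCount κ) ((2 * s + 1) * L (suc r) s) (L r s) ⟩
    (2 + k) * ((2 * s + 1) * L (suc r) s) + (2 + r + pendantCount κ) * L r s + (2 + r) * (suc k * L r s) ∎)
    where
    open ≡-Reasoning
    r = k + pendantCount κ
    regroup : ∀ r l m v c → 2 * (2 + r) * (l + (m + v)) + (2 + r) * c ≡ (2 + r) * (2 * v + 2 * l + (2 * m + c))
    regroup = solve-∀
    isolate : ∀ r k a b → (2 + r) * (a + b + (1 + k) * a) ≡ (2 + k) * ((2 + r) * a) + (2 + r) * b
    isolate = solve-∀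
    balance : ∀ k p a b → (2 + k) * (a + (1 + (k + p)) * b) + (2 + (k + p)) * b
      ≡ (2 + k) * a + (2 + (k + p) + p) * b + (2 + (k + p)) * ((1 + k) * b)
    balance = solve-∀

-- The explicit list of lattice points.

module Points where

  open import Data.Integer.Base as ℤ using (ℤ; +_; ∣_∣)
  open import Data.Integer.Tactic.RingSolver using (solve-∀)
  open import Data.List.Base using (List; []; _∷_; map; concatMap; length; upTo)
  open import Data.List.Membership.Propositional using (_∈_; find; lose)
  open import Data.List.Membership.Propositional.Properties using (∈-map⁺; ∈-map⁻; ∈-concatMap⁺; ∈-concatMap⁻; ∈-upTo⁺; ∈-upTo⁻)
  open import Data.List.Properties using (map-cong; length-map; length-upTo; length-++)
  open import Data.List.Relation.Unary.All as All using (All)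
  open import Data.List.Relation.Unary.Unique.Propositional using (Unique)
  import Data.List.Relation.Unary.Unique.Propositional.Properties as Unique
  open import Data.Nat.ListAction using (sum)
  open import Data.Vec.Base using (Vec; []; _∷_; lookup; tabulate)
  open import Data.Vec.Properties using (lookup∘tabulate; tabulate∘lookup; tabulate-cong)
  open Kinds
  open LeafVectors

  private variable
    N : ℕ

  vec-ext : ∀ {x y : Vec ℤ N} → (∀ v → lookup x v ≡ lookup y v) → x ≡ y
  vec-ext {x = x} {y} x≡y = trans (sym (tabulate∘lookup x)) (trans (tabulate-cong x≡y) (tabulate∘lookup y))

  net : Vec Kind N → Kind → Vec ℤ N → ℤ
  net κ k z = + posSum κ k z ℤ.- + negSum κ k z

  mass : Vec Kind N → Kind → Vec ℤ N → ℕ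
  mass κ k z = posSum κ k z ℕ.+ negSum κ k z

  norm-supported : ∀ (κ : Vec Kind N) w → Supported κ w →
    ∥ w ∥ ≡ commonMass κ w ℕ.+ (mass κ pendant₁ w ℕ.+ mass κ pendant₂ w)
  norm-supported []      []      _    = refl
  norm-supported (k ∷ κ) (x ∷ w) supp with norm-supported κ w (supp ∘ suc) | supp zero
  norm-supported (common ∷ κ) (x ∷ w) supp | ih | _ =
    trans (cong₂ ℕ._+_ (sym (pos+neg x)) ih) (lemma (pos x) (neg x) (posSum κ common w) (negSum κ common w) _)
    where
    lemma : ∀ p n a b r → p ℕ.+ n ℕ.+ (a ℕ.+ b ℕ.+ r) ≡ (p ℕ.+ a) ℕ.+ (n ℕ.+ b) ℕ.+ r
    lemma = ℕSolver.solve-∀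
  norm-supported (pendant₁ ∷ κ) (x ∷ w) supp | ih | _ =
    trans (cong₂ ℕ._+_ (sym (pos+neg x)) ih) (lemma (pos x) (neg x) (posSum κ pendant₁ w) (negSum κ pendant₁ w) (commonMass κ w) (mass κ pendant₂ w))
    where
    lemma : ∀ p n a b c r → p ℕ.+ n ℕ.+ (c ℕ.+ (a ℕ.+ b ℕ.+ r)) ≡ c ℕ.+ ((p ℕ.+ a) ℕ.+ (n ℕ.+ b) ℕ.+ r)
    lemma = ℕSolver.solve-∀
  norm-supported (pendant₂ ∷ κ) (x ∷ w) supp | ih | _ =
    trans (cong₂ ℕ._+_ (sym (pos+neg x)) ih) (lemma (pos x) (neg x) (posSum κ pendant₂ w) (negSum κ pendant₂ w) (commonMass κ w) (mass κ pendant₁ w))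
    where
    lemma : ∀ p n a b c r → p ℕ.+ n ℕ.+ (c ℕ.+ (r ℕ.+ (a ℕ.+ b))) ≡ c ℕ.+ (r ℕ.+ ((p ℕ.+ a) ℕ.+ (n ℕ.+ b)))
    lemma = ℕSolver.solve-∀
  norm-supported (hub₁ ∷ κ)     (x ∷ w) supp | ih | x≡0 rewrite x≡0 refl = ih
  norm-supported (hub₂ ∷ κ)     (x ∷ w) supp | ih | x≡0 rewrite x≡0 refl = ih
  norm-supported (isolated ∷ κ) (x ∷ w) supp | ih | x≡0 rewrite x≡0 refl = ih

  kindSum-cong : ∀ f (κ : Vec Kind N) k x y → (∀ v → lookup κ v ≡ k → lookup x v ≡ lookup y v) →
    kindSum f κ k x ≡ kindSum f κ k y
  kindSum-cong f []      k []      []      _   = refl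
  kindSum-cong f (l ∷ κ) k (a ∷ x) (b ∷ y) x≡y with same k l in eq
  ... | true  = cong₂ ℕ._+_ (cong f (x≡y zero (sym (same⇒≡ k l eq)))) (kindSum-cong f κ k x y (x≡y ∘ suc))
  ... | false = kindSum-cong f κ k x y (x≡y ∘ suc)

  mass-bound : ∀ (κ : Vec Kind N) k z v → lookup κ v ≡ k → ∣ lookup z v ∣ ℕ.≤ mass κ k z
  mass-bound (l ∷ κ) .l (x ∷ z) zero refl rewrite same-refl l = subst₂ ℕ._≤_ (pos+neg x)
    (lemma (pos x) (neg x) (posSum κ l z) (negSum κ l z)) (ℕ.m≤m+n (pos x ℕ.+ neg x) (mass κ l z))
    where
    lemma : ∀ p n a b → p ℕ.+ n ℕ.+ (a ℕ.+ b) ≡ (p ℕ.+ a) ℕ.+ (n ℕ.+ b)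
    lemma = ℕSolver.solve-∀
  mass-bound (l ∷ κ) k (x ∷ z) (suc v) eq = ℕ.≤-trans (mass-bound κ k z v eq)
    (ℕ.+-mono-≤ (ℕ.m≤n+m (posSum κ k z) (⟦ same k l ⟧ (pos x))) (ℕ.m≤n+m (negSum κ k z) (⟦ same k l ⟧ (neg x))))

  leaf-or-none : ∀ (κ : Vec Kind N) → (∃ λ v → leaf? (lookup κ v) ≡ true) ⊎ (∀ v → leaf? (lookup κ v) ≡ false)
  leaf-or-none []      = inj₂ λ ()
  leaf-or-none (k ∷ κ) with leaf? k in eq | leaf-or-none κ
  ... | true  | _              = inj₁ (zero , eq)
  ... | false | inj₁ (v , lf)  = inj₁ (suc v , lf)
  ... | false | inj₂ none      = inj₂ λ { zero → eq ; (suc v) → none v }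

  common-exists : ∀ (κ : Vec Kind N) {k} → commonCount κ ≡ suc k → ∃ λ v → lookup κ v ≡ common
  common-exists (common ∷ κ)   _  = zero , refl
  common-exists (hub₁ ∷ κ)     eq = let v , κv = common-exists κ eq in suc v , κv
  common-exists (hub₂ ∷ κ)     eq = let v , κv = common-exists κ eq in suc v , κv
  common-exists (pendant₁ ∷ κ) eq = let v , κv = common-exists κ eq in suc v , κv
  common-exists (pendant₂ ∷ κ) eq = let v , κv = common-exists κ eq in suc v , κv
  common-exists (isolated ∷ κ) eq = let v , κv = common-exists κ eq in suc v , κv

  no-common : ∀ (κ : Vec Kind N) → commonCount κ ≡ 0 → ∀ v → lookup κ v ≢ common
  no-common (hub₁ ∷ κ)     eq (suc v) = no-common κ eq v
  no-common (hub₂ ∷ κ)     eq (suc v) = no-common κ eq v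
  no-common (pendant₁ ∷ κ) eq (suc v) = no-common κ eq v
  no-common (pendant₂ ∷ κ) eq (suc v) = no-common κ eq v
  no-common (isolated ∷ κ) eq (suc v) = no-common κ eq v

  absent-mass : ∀ (κ : Vec Kind N) k → (∀ v → lookup κ v ≢ k) → ∀ z → mass κ k z ≡ 0
  absent-mass []      k _      []      = refl
  absent-mass (l ∷ κ) k absent (x ∷ z) with same k l in eq
  ... | true  = contradiction (sym (same⇒≡ k l eq)) (absent zero)
  ... | false = absent-mass κ k (absent ∘ suc) z

  -‿cancel : ∀ c {a b} → a ℤ.- c ≡ b ℤ.- c → a ≡ b
  -‿cancel c {a} {b} eq = trans (add-back a c) (trans (cong (ℤ._+ c) eq) (sym (add-back b c)))
    where
    add-back : ∀ a c → a ≡ a ℤ.- c ℤ.+ c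
    add-back = solve-∀

  module _ (κ : Vec Kind N) where

    -- The lattice point with leaf coordinates w for which hub₁ supplies y units in
    -- total to the common vertices.
    placeAt : ℤ → Vec ℤ N → Kind → ℤ → ℤ
    placeAt y w hub₁ _ = y ℤ.- net κ pendant₁ w
    placeAt y w hub₂ _ = ℤ.- (y ℤ.+ net κ common w ℤ.+ net κ pendant₂ w)
    placeAt y w _    x = x

    place : Vec ℤ N → ℤ → Vec ℤ N
    place w y = tabulate λ v → placeAt y w (lookup κ v) (lookup w v)

    lookup-place : ∀ w y v → lookup (place w y) v ≡ placeAt y w (lookup κ v) (lookup w v)
    lookup-place w y = lookup∘tabulate λ v → placeAt y w (lookup κ v) (lookup w v)

    module _ (s : ℕ) where

      excess : Vec ℤ N → ℕ
      excess w = halfSlack (commonCount κ) (s ℕ.∸ ∥ w ∥)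

      -- The shift puts i = 0 at the lower end of the interval of possible supplies.
      demand : Vec ℤ N → ℕ → ℤ
      demand w i = + i ℤ.- + (posSum κ common w ℕ.+ excess w)

      pointsOver : Vec ℤ N → List (Vec ℤ N)
      pointsOver w = map (λ i → place w (demand w i)) (upTo (width κ s w))

      points : List (Vec ℤ N)
      points = concatMap pointsOver (leafVectors κ s)

      points-length : length points ≡ pointCount κ s
      points-length = trans (length-concatMap (leafVectors κ s))
        (cong sum (map-cong (λ w → trans (length-map _ (upTo (width κ s w))) (length-upTo (width κ s w))) (leafVectors κ s)))
        where
        length-concatMap : ∀ ws → length (concatMap pointsOver ws) ≡ sum (map (length ∘ pointsOver) ws)
        length-concatMap []       = refl
        length-concatMap (w ∷ ws) = trans (length-++ (pointsOver w)) (cong (ℕ._+_ (length (pointsOver w))) (length-concatMap ws))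

      ∈-points⁺ : ∀ w i → Supported κ w → ∥ w ∥ ℕ.≤ s → i ℕ.< width κ s w → place w (demand w i) ∈ points
      ∈-points⁺ w i supp ∥w∥≤s i< = ∈-concatMap⁺ pointsOver
        (lose (leafVectors-complete κ s w supp ∥w∥≤s) (∈-map⁺ (λ i → place w (demand w i)) (∈-upTo⁺ i<)))

      ∈-points⁻ : ∀ {z} → z ∈ points → ∃ λ w → ∃ λ i →
        Supported κ w × ∥ w ∥ ℕ.≤ s × i ℕ.< width κ s w × z ≡ place w (demand w i)
      ∈-points⁻ z∈ =
        let w , w∈ , z∈w = find (∈-concatMap⁻ pointsOver z∈)
            supp , ∥w∥≤s = All.lookup (leafVectors-sound κ s) w∈
            i , i∈ , z≡  = ∈-map⁻ (λ i → place w (demand w i)) z∈w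
        in w , i , supp , ∥w∥≤s , ∈-upTo⁻ i∈ , z≡

      -- The leaf coordinates of a listed point determine `w`; given `w`, the coordinate at the hub
      -- `a` determines the index.
      points-unique : ∀ a → lookup κ a ≡ hub₁ → Unique points
      points-unique a κa = unique-concatMap pointsOver (leafVectors-sound κ s) (leafVectors-unique κ s)
        (λ {w} _ → Unique.map⁺ (injective w) (Unique.upTo⁺ (width κ s w)))
        (λ {w} {w′} (supp , _) (supp′ , _) z∈w z∈w′ →
          let i , _ , z≡  = ∈-map⁻ (λ i → place w (demand w i)) z∈w
              j , _ , z≡′ = ∈-map⁻ (λ i → place w′ (demand w′ i)) z∈w′
          in vec-ext (separate w w′ (demand w i) (demand w′ j) supp supp′ (trans (sym z≡) z≡′)))
        where
        at-hub : ∀ w y → lookup (place w y) a ≡ y ℤ.- net κ pendant₁ w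
        at-hub w y = trans (lookup-place w y a) (cong (λ k → placeAt y w k (lookup w a)) κa)
        injective : ∀ w {i j} → place w (demand w i) ≡ place w (demand w j) → i ≡ j
        injective w {i} {j} eq = ℤ.+-injective (-‿cancel (+ (posSum κ common w ℕ.+ excess w)) {+ i} {+ j} (-‿cancel (net κ pendant₁ w) {demand w i} {demand w j}
          (trans (sym (at-hub w (demand w i))) (trans (cong (λ z → lookup z a) eq) (at-hub w (demand w j))))))
        separate : ∀ w w′ y y′ → Supported κ w → Supported κ w′ → place w y ≡ place w′ y′ → ∀ v → lookup w v ≡ lookup w′ v
        separate w w′ y y′ supp supp′ eq v
          with lookup κ v | supp v | supp′ v | trans (sym (lookup-place w y v)) (trans (cong (λ z → lookup z v) eq) (lookup-place w′ y′ v))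
        ... | hub₁     | w≡0 | w′≡0 | _  = trans (w≡0 refl) (sym (w′≡0 refl))
        ... | hub₂     | w≡0 | w′≡0 | _  = trans (w≡0 refl) (sym (w′≡0 refl))
        ... | isolated | w≡0 | w′≡0 | _  = trans (w≡0 refl) (sym (w′≡0 refl))
        ... | common    | _ | _ | same-value = same-value
        ... | pendant₁  | _ | _ | same-value = same-value
        ... | pendant₂  | _ | _ | same-value = same-value

-- From bipartiteness to the two hubs and the kinds of the other vertices.

module Hubs where

  open import Data.Fin.Subset using (Subset; inside; outside; ∁) renaming (_∈_ to _∈ˢ_; _∉_ to _∉ˢ_; ∣_∣ to ∣_∣ˢ)
  open import Data.Fin.Subset.Properties using (x∈∁p⇒x∉p)
  open import Data.List.Base using (List; []; _∷_)
  open import Data.List.Membership.Propositional using (_∈_)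
  open import Data.List.Relation.Unary.Any using (here; there)
  open import Data.Nat.Properties using (suc-injective)
  open import Data.Vec.Base using (Vec; []; _∷_; lookup; tabulate; here; there)
  open import Data.Vec.Properties using (lookup∘tabulate)
  open Kinds

  card-0 : ∀ {N} (A : Subset N) → ∣ A ∣ˢ ≡ 0 → ∀ v → v ∉ˢ A
  card-0 (outside ∷ A) eq (suc v) (there v∈A) = card-0 A eq v v∈A

  card-1 : ∀ {N} (A : Subset N) → ∣ A ∣ˢ ≡ 1 → ∃ λ a → a ∈ˢ A × (∀ v → v ∈ˢ A → v ≡ a)
  card-1 (inside ∷ A)  eq = zero , here , λ where
    zero    _           → refl
    (suc v) (there v∈A) → contradiction v∈A (card-0 A (suc-injective eq) v)
  card-1 (outside ∷ A) eq = let a , a∈A , only = card-1 A eq in suc a , there a∈A , λ where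
    (suc v) (there v∈A) → cong suc (only v v∈A)

  card-2 : ∀ {N} (A : Subset N) → ∣ A ∣ˢ ≡ 2 →
    ∃₂ λ a b → a ≢ b × a ∈ˢ A × b ∈ˢ A × (∀ v → v ∈ˢ A → v ≡ a ⊎ v ≡ b)
  card-2 (inside ∷ A)  eq = let b , b∈A , only = card-1 A (suc-injective eq) in
    zero , suc b , (λ ()) , here , there b∈A , λ where
      zero    _           → inj₁ refl
      (suc v) (there v∈A) → inj₂ (cong suc (only v v∈A))
  card-2 (outside ∷ A) eq = let a , b , a≢b , a∈A , b∈A , only = card-2 A eq in
    suc a , suc b , a≢b ∘ Fin.suc-injective , there a∈A , there b∈A , λ where
      (suc v) (there v∈A) → Sum.map (cong suc) (cong suc) (only v v∈A)

  -- The kinds that an edge may join. Both orientations are listed, so that a check over this list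
  -- covers every ordered pair of adjacent vertices.
  incidentPairs : List (Kind × Kind)
  incidentPairs = (hub₁ , common) ∷ (hub₁ , pendant₁) ∷ (hub₂ , common) ∷ (hub₂ , pendant₂)
                ∷ (common , hub₁) ∷ (pendant₁ , hub₁) ∷ (common , hub₂) ∷ (pendant₂ , hub₂) ∷ []

  -- The fields that produce edges serve the construction of flows; `incident`, which limits the
  -- edges, serves the potentials of the dual side.
  record HubStructure {N} (G : Graph N) : Set where
    field
      a b    : Fin N
      κ      : Vec Kind N
      κa     : lookup κ a ≡ hub₁
      κb     : lookup κ b ≡ hub₂
      only-a : ∀ v → lookup κ v ≡ hub₁ → v ≡ a
      only-b : ∀ v → lookup κ v ≡ hub₂ → v ≡ b
      common→a   : ∀ v → lookup κ v ≡ common   → Adj G v a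
      common→b   : ∀ v → lookup κ v ≡ common   → Adj G v b
      pendant₁→a : ∀ v → lookup κ v ≡ pendant₁ → Adj G v a
      pendant₂→b : ∀ v → lookup κ v ≡ pendant₂ → Adj G v b
      incident   : ∀ u v → Adj G u v → (lookup κ u , lookup κ v) ∈ incidentPairs

  module _ {N} (G : Graph N) (a b : Fin N) where

    -- The inequalities with `a` and `b` make the kinds exclusive, so that the kinds of the hubs
    -- themselves follow by case analysis.
    data KindSpec (v : Fin N) : Kind → Set where
      is-hub₁     : v ≡ a → KindSpec v hub₁
      is-hub₂     : v ≢ a → v ≡ b → KindSpec v hub₂
      is-common   : v ≢ a → v ≢ b → Adj G v a → Adj G v b → KindSpec v common
      is-pendant₁ : v ≢ a → v ≢ b → Adj G v a → ¬ Adj G v b → KindSpec v pendant₁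
      is-pendant₂ : v ≢ a → v ≢ b → ¬ Adj G v a → Adj G v b → KindSpec v pendant₂
      is-isolated : v ≢ a → v ≢ b → ¬ Adj G v a → ¬ Adj G v b → KindSpec v isolated

    classify : ∀ v → ∃ (KindSpec v)
    classify v with v Fin.≟ a | v Fin.≟ b | adj? G v a | adj? G v b
    ... | yes v≡a | _       | _      | _      = _ , is-hub₁ v≡a
    ... | no v≢a  | yes v≡b | _      | _      = _ , is-hub₂ v≢a v≡b
    ... | no v≢a  | no v≢b  | yes va | yes vb = _ , is-common v≢a v≢b va vb
    ... | no v≢a  | no v≢b  | yes va | no ¬vb = _ , is-pendant₁ v≢a v≢b va ¬vb
    ... | no v≢a  | no v≢b  | no ¬va | yes vb = _ , is-pendant₂ v≢a v≢b ¬va vb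
    ... | no v≢a  | no v≢b  | no ¬va | no ¬vb = _ , is-isolated v≢a v≢b ¬va ¬vb

  hubs : ∀ {N n} (G : Graph N) → BipartiteOfType 2 n G → HubStructure G
  hubs {N} G (A , ∣A∣≡2 , _ , bipartite) with card-2 A ∣A∣≡2
  ... | a , b , a≢b , a∈A , b∈A , only = record
    { a = a ; b = b ; κ = κ
    ; κa = kind-a (spec a) ; κb = kind-b (spec b)
    ; only-a = λ v κv → extract-a (spec′ κv)
    ; only-b = λ v κv → extract-b (spec′ κv)
    ; common→a = λ v κv → extract-ca (spec′ κv)
    ; common→b = λ v κv → extract-cb (spec′ κv)
    ; pendant₁→a = λ v κv → extract-pa (spec′ κv)
    ; pendant₂→b = λ v κv → extract-pb (spec′ κv)
    ; incident = λ u v uv → oriented u v uv (bipartite u v uv)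
    }
    where
    κ : Vec Kind N
    κ = tabulate (proj₁ ∘ classify G a b)

    spec : ∀ v → KindSpec G a b v (lookup κ v)
    spec v = subst (KindSpec G a b v) (sym (lookup∘tabulate (proj₁ ∘ classify G a b) v)) (proj₂ (classify G a b v))

    spec′ : ∀ {v k} → lookup κ v ≡ k → KindSpec G a b v k
    spec′ {v} κv = subst (KindSpec G a b v) κv (spec v)

    kind-a : ∀ {k} → KindSpec G a b a k → k ≡ hub₁
    kind-a (is-hub₁ _)             = refl
    kind-a (is-hub₂ a≢a _)         = contradiction refl a≢a
    kind-a (is-common a≢a _ _ _)   = contradiction refl a≢a
    kind-a (is-pendant₁ a≢a _ _ _) = contradiction refl a≢a
    kind-a (is-pendant₂ a≢a _ _ _) = contradiction refl a≢a
    kind-a (is-isolated a≢a _ _ _) = contradiction refl a≢a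

    kind-b : ∀ {k} → KindSpec G a b b k → k ≡ hub₂
    kind-b (is-hub₁ b≡a)           = contradiction (sym b≡a) a≢b
    kind-b (is-hub₂ _ _)           = refl
    kind-b (is-common _ b≢b _ _)   = contradiction refl b≢b
    kind-b (is-pendant₁ _ b≢b _ _) = contradiction refl b≢b
    kind-b (is-pendant₂ _ b≢b _ _) = contradiction refl b≢b
    kind-b (is-isolated _ b≢b _ _) = contradiction refl b≢b

    extract-a : ∀ {v} → KindSpec G a b v hub₁ → v ≡ a
    extract-a (is-hub₁ v≡a) = v≡a
    extract-b : ∀ {v} → KindSpec G a b v hub₂ → v ≡ b
    extract-b (is-hub₂ _ v≡b) = v≡b
    extract-ca : ∀ {v} → KindSpec G a b v common → Adj G v a
    extract-ca (is-common _ _ va _) = va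
    extract-cb : ∀ {v} → KindSpec G a b v common → Adj G v b
    extract-cb (is-common _ _ _ vb) = vb
    extract-pa : ∀ {v} → KindSpec G a b v pendant₁ → Adj G v a
    extract-pa (is-pendant₁ _ _ va _) = va
    extract-pb : ∀ {v} → KindSpec G a b v pendant₂ → Adj G v b
    extract-pb (is-pendant₂ _ _ _ vb) = vb

    at-hub : ∀ {v k} → v ∉ˢ A → KindSpec G a b v k →
      (Adj G v a → k ≡ common ⊎ k ≡ pendant₁) × (Adj G v b → k ≡ common ⊎ k ≡ pendant₂)
    at-hub v∉A (is-hub₁ refl)           = contradiction a∈A v∉A
    at-hub v∉A (is-hub₂ _ refl)         = contradiction b∈A v∉A
    at-hub v∉A (is-common _ _ _ _)      = (λ _ → inj₁ refl) , λ _ → inj₁ refl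
    at-hub v∉A (is-pendant₁ _ _ _ ¬vb)  = (λ _ → inj₂ refl) , λ vb → contradiction vb ¬vb
    at-hub v∉A (is-pendant₂ _ _ ¬va _)  = (λ va → contradiction va ¬va) , λ _ → inj₂ refl
    at-hub v∉A (is-isolated _ _ ¬va ¬vb) = (λ va → contradiction va ¬va) , λ vb → contradiction vb ¬vb

    hub-kind : ∀ u → u ∈ˢ A → ∀ v → v ∉ˢ A → Adj G v u →
      (lookup κ u , lookup κ v) ∈ incidentPairs × (lookup κ v , lookup κ u) ∈ incidentPairs
    hub-kind u u∈A v v∉A vu with only u u∈A
    ... | inj₁ refl rewrite kind-a (spec a) with proj₁ (at-hub v∉A (spec v)) vu
    ...   | inj₁ κv rewrite κv = here refl , there (there (there (there (here refl))))
    ...   | inj₂ κv rewrite κv = there (here refl) , there (there (there (there (there (here refl)))))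
    hub-kind u u∈A v v∉A vu | inj₂ refl rewrite kind-b (spec b) with proj₂ (at-hub v∉A (spec v)) vu
    ...   | inj₁ κv rewrite κv = there (there (here refl)) , there (there (there (there (there (there (here refl))))))
    ...   | inj₂ κv rewrite κv = there (there (there (here refl))) , there (there (there (there (there (there (there (here refl)))))))

    oriented : ∀ u v → Adj G u v → (u ∈ˢ A × v ∈ˢ ∁ A) ⊎ (u ∈ˢ ∁ A × v ∈ˢ A) →
      (lookup κ u , lookup κ v) ∈ incidentPairs
    oriented u v uv (inj₁ (u∈A , v∈∁A)) = proj₁ (hub-kind u u∈A v (x∈∁p⇒x∉p v∈∁A) (symmetric G uv))
    oriented u v uv (inj₂ (u∈∁A , v∈A)) = proj₂ (hub-kind v v∈A u (x∈∁p⇒x∉p u∈∁A) uv)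

-- Weak duality: potentials bound the points of the polytope.

module Duality where

  open import Algebra.Bundles using (module Ring; module Semiring; Semiring)
  import Algebra.Properties.Semiring.Sum as Summation
  open import Data.Integer.Base as ℤ using (ℤ; +_)
  open import Data.Rational.Base
  open import Data.Rational.Properties
  open import Data.Rational.Solver using (module +-*-Solver)
  open import Data.Vec.Base using (lookup)
  open Embedding
  open Asymptotics
  open +-*-Solver

  module Kronecker {c ℓ} (R : Semiring c ℓ) where
    private module R = Semiring R
    open Summation R using (sum; sum-replicate-zero)

    sum-δ : ∀ {n} (f : Fin n → R.Carrier) u → sum (λ v → if does (u Fin.≟ v) then f v else R.0#) R.≈ f u
    sum-δ {suc n} f zero    = R.trans (R.+-cong R.refl (sum-replicate-zero n)) (R.+-identityʳ (f zero))
    sum-δ {suc n} f (suc u) = R.trans (R.+-identityˡ _) (sum-δ (f ∘ suc) u)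

  open Summation (Ring.semiring +-*-ring) using (sum; sum-cong-≗; ∑-comm; ∑-distrib-+; *-distribˡ-sum)
  open Summation ℤ.+-*-semiring using () renaming (sum to sumℤ)

  δ : ∀ {N} → Fin N → Fin N → ℚ
  δ u v = if does (u Fin.≟ v) then 1ℚ else 0ℚ

  sum-*δ : ∀ {N} (f : Fin N → ℚ) u → sum (λ v → f v * δ u v) ≡ f u
  sum-*δ f u = trans (sum-cong-≗ λ v → select (does (u Fin.≟ v)) (f v)) (Kronecker.sum-δ (Ring.semiring +-*-ring) f u)
    where
    select : ∀ b a → a * (if b then 1ℚ else 0ℚ) ≡ (if b then a else 0ℚ)
    select true  a = *-identityʳ a
    select false a = *-zeroʳ a

  seq-e : ∀ {N} (u v : Fin N) n → seq (e u v) n ≡ δ u v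
  seq-e u v n with does (u Fin.≟ v)
  ... | true  = refl
  ... | false = refl

  seq-∑ : ∀ {k} (F : Fin k → ℝ) n → seq (∑ F) n ≡ sum (λ j → seq (F j) n)
  seq-∑ {zero}  F n = refl
  seq-∑ {suc k} F n = cong (_+_ (seq (F zero) n)) (seq-∑ (F ∘ suc) n)

  sum-ι : ∀ {k} (f : Fin k → ℤ) → sum (ι ∘ f) ≡ ι (sumℤ f)
  sum-ι {zero}  f = refl
  sum-ι {suc k} f = trans (cong (_+_ (ι (f zero))) (sum-ι (f ∘ suc))) (sym (ι-+ (f zero) (sumℤ (f ∘ suc))))

  nonneg-close : ∀ {f g} → Null (λ n → f n - g n) → AsymptoticallyNonneg g → AsymptoticallyNonneg f
  nonneg-close {f} {g} f~g pg = nonneg-cong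
    {λ n → (f n - g n) + g n} (λ n → solve 2 (λ a b → a :- b :+ b := a) refl (f n) (g n))
    (nonneg-+ {λ n → f n - g n} {g} (null⇒nonneg f~g) pg)

  null-swap : ∀ (f g : ℕ → ℚ) → Null (λ n → f n - g n) → Null (λ n → g n - f n)
  null-swap f g f~g = null-cong {λ n → - 1ℚ * (f n - g n)}
    (λ n → solve 2 (λ a b → con (- 1ℚ) :* (a :- b) := b :- a) refl (f n) (g n)) (null-*ℚ (- 1ℚ) f~g)

  module _ {N} (φ : Fin N → ℚ) where

    ⟪_⟫ : (Fin N → ℕ → ℚ) → ℕ → ℚ
    ⟪ x ⟫ n = sum (λ v → φ v * x v n)

    sum-*-distribˡ-- : ∀ (x y : Fin N → ℚ) → sum (λ v → φ v * (x v - y v)) ≡ sum (λ v → φ v * x v) - sum (λ v → φ v * y v)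
    sum-*-distribˡ-- x y = begin
      sum (λ v → φ v * (x v - y v))
        ≡⟨ cancel _ _ ⟩
      sum (λ v → φ v * (x v - y v)) + sum (λ v → φ v * y v) - sum (λ v → φ v * y v)
        ≡⟨ cong (_- sum (λ v → φ v * y v)) (sym (∑-distrib-+ (λ v → φ v * (x v - y v)) (λ v → φ v * y v))) ⟩
      sum (λ v → φ v * (x v - y v) + φ v * y v) - sum (λ v → φ v * y v)
        ≡⟨ cong (_- sum (λ v → φ v * y v)) (sum-cong-≗ λ v →
             solve 3 (λ f x y → f :* (x :- y) :+ f :* y := f :* x) refl (φ v) (x v) (y v)) ⟩
      sum (λ v → φ v * x v) - sum (λ v → φ v * y v) ∎
      where
      open ≡-Reasoning
      cancel : ∀ a b → a ≡ a + b - b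
      cancel = solve 2 (λ a b → a := a :+ b :- b) refl

    ⟪⟫-close : ∀ x y → (∀ v → Null (λ n → x v n - y v n)) → Null (λ n → ⟪ x ⟫ n - ⟪ y ⟫ n)
    ⟪⟫-close x y x~y = null-cong (λ n → sum-*-distribˡ-- (λ v → x v n) (λ v → y v n))
      (null-sum N (λ v n → φ v * (x v n - y v n)) (λ v → null-*ℚ (φ v) (x~y v)))

    module _ (G : Graph N) (γ : ℚ) (0≤γ : 0ℚ ≤ γ) (slope : ∀ u v → Adj G u v → φ u - φ v ≤ γ) where

      -- The functional φ takes the value φ u - φ v ≤ γ at the edge vector e_u - e_v, hence a value
      -- at most γ at convex combinations; 0 ≤ γ covers the polytope {0}. Weights and points are
      -- real, so the inequality is asymptotic.
      polytope-bound : ∀ y → SymmetricEdgePolytope G y → AsymptoticallyNonneg (λ n → γ - ⟪ seq ∘ y ⟫ n)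
      polytope-bound y (inj₂ (_ , y≈0)) = nonneg-close
        {λ n → γ - ⟪ seq ∘ y ⟫ n} {λ _ → γ}
        (null-cong (λ n → rearrange γ (⟪ seq ∘ y ⟫ n) (⟪ (λ _ _ → 0ℚ) ⟫ n) zero-functional)
          (null-swap ⟪ seq ∘ y ⟫ ⟪ (λ _ _ → 0ℚ) ⟫
            (⟪⟫-close (seq ∘ y) (λ _ _ → 0ℚ) (λ v → converges (y≈0 v)))))
        (λ ε 0<ε → 0 , λ _ _ → +-mono-≤-< 0≤γ 0<ε)
        where
        zero-functional : sum (λ v → φ v * 0ℚ) ≡ 0ℚ
        zero-functional = trans (sum-cong-≗ (λ v → trans (*-zeroʳ (φ v)) (sym (*-zeroˡ 0ℚ))))
          (trans (sym (*-distribˡ-sum 0ℚ (λ (v : Fin N) → 0ℚ))) (*-zeroˡ (sum (λ (v : Fin N) → 0ℚ))))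
        rearrange : ∀ c a b → b ≡ 0ℚ → b - a ≡ (c - a) - c
        rearrange c a .0ℚ refl = solve 2 (λ c a → con 0ℚ :- a := c :- a :- c) refl c a
      polytope-bound y (inj₁ (k , c , p , 0≤c , ∑c≈1 , edge , y≈)) = nonneg-close
        {λ n → γ - ⟪ seq ∘ y ⟫ n} {λ n → γ - ⟪ Y ⟫ n}
        (null-cong (λ n → solve 3 (λ c a b → b :- a := (c :- a) :- (c :- b)) refl γ (⟪ seq ∘ y ⟫ n) (⟪ Y ⟫ n))
          (null-swap ⟪ seq ∘ y ⟫ ⟪ Y ⟫ (⟪⟫-close (seq ∘ y) Y y~Y)))
        -- With C the sum of the weights, γ - ⟨φ, Y⟩ = γ (1 - C) + ∑ c_j (γ - g_j): a null sequence
        -- plus asymptotically nonnegative ones.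
        (nonneg-cong {λ n → γ * (1ℚ - C n) + sum (λ j → seq (c j) n * (γ - g j))} evaluate
          (nonneg-+ {λ n → γ * (1ℚ - C n)} {λ n → sum (λ j → seq (c j) n * (γ - g j))}
            (null⇒nonneg (null-*ℚ γ 1~C))
            (nonneg-sum k (λ j n → seq (c j) n * (γ - g j)) (λ j → nonneg-*
              {seq (c j)} (0≤γ-g j) (c-nonneg j)))))
        where
        tail head : Fin k → Fin N
        tail j = proj₁ (edge j)
        head j = proj₁ (proj₂ (edge j))
        g : Fin k → ℚ
        g j = φ (tail j) - φ (head j)
        d : Fin k → Fin N → ℚ
        d j v = δ (tail j) v - δ (head j) v
        C : ℕ → ℚ
        C n = sum (λ j → seq (c j) n)
        -- The same combination with the points `p j` replaced by exact rational edge vectors; the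
        -- error is null.
        Y : Fin N → ℕ → ℚ
        Y v n = sum (λ j → seq (c j) n * d j v)

        0≤γ-g : ∀ j → 0ℚ ≤ γ - g j
        0≤γ-g j = subst (_≤ γ - g j) (+-inverseʳ (g j))
          (+-monoˡ-≤ (- g j) (slope (tail j) (head j) (proj₁ (proj₂ (proj₂ (edge j))))))

        c-nonneg : ∀ j → AsymptoticallyNonneg (seq (c j))
        c-nonneg j = eventually (0≤c j)

        1~C : Null (λ n → 1ℚ - C n)
        1~C = null-swap C (λ _ → 1ℚ)
          (null-cong {λ n → seq (∑ c) n - 1ℚ} (λ n → cong (_- 1ℚ) (seq-∑ c n)) (converges ∑c≈1))

        p~d : ∀ j v → Null (λ n → seq (p j v) n - d j v)
        p~d j v = null-cong {λ n → seq (p j v) n - (seq (e (tail j) v) n - seq (e (head j) v) n)}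
          (λ n → cong (λ a → seq (p j v) n - a) (cong₂ _-_ (seq-e (tail j) v n) (seq-e (head j) v n)))
          (converges (proj₂ (proj₂ (proj₂ (edge j))) v))

        y~Y : ∀ v → Null (λ n → seq (y v) n - Y v n)
        y~Y v = null-cong
          {λ n → sum (λ j → seq (c j) n * (seq (p j v) n - d j v)) + (seq (y v) n - seq (∑ (λ j → c j *ᴿ p j v)) n)}
          (λ n → combine n (λ j → seq (c j) n) (λ j → seq (p j v) n))
          (null-+ (null-sum k (λ j n → seq (c j) n * (seq (p j v) n - d j v)) (λ j → null-* (c j) (p~d j v)))
            (converges (y≈ v)))
          where
          combine : ∀ n (c′ p′ : Fin k → ℚ) → sum (λ j → seq (c j) n * (seq (p j v) n - d j v))
                      + (seq (y v) n - seq (∑ (λ j → c j *ᴿ p j v)) n)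
                    ≡ seq (y v) n - Y v n
          combine n c′ p′ = begin
            A + (seq (y v) n - seq (∑ (λ j → c j *ᴿ p j v)) n)
              ≡⟨ cong (λ b → A + (seq (y v) n - b)) (seq-∑ (λ j → c j *ᴿ p j v) n) ⟩
            A + (seq (y v) n - sum (λ j → seq (c j) n * seq (p j v) n))
              ≡⟨ cong (λ b → A + (seq (y v) n - b)) (sum-cong-≗ λ j →
                   solve 3 (λ c p d → c :* p := c :* (p :- d) :+ c :* d) refl (seq (c j) n) (seq (p j v) n) (d j v)) ⟩
            A + (seq (y v) n - sum (λ j → seq (c j) n * (seq (p j v) n - d j v) + seq (c j) n * d j v))
              ≡⟨ cong (λ b → A + (seq (y v) n - b)) (∑-distrib-+ (λ j → seq (c j) n * (seq (p j v) n - d j v)) (λ j → seq (c j) n * d j v)) ⟩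
            A + (seq (y v) n - (A + Y v n))
              ≡⟨ solve 3 (λ a y b → a :+ (y :- (a :+ b)) := y :- b) refl A (seq (y v) n) (Y v n) ⟩
            seq (y v) n - Y v n ∎
            where
            open ≡-Reasoning
            A = sum (λ j → seq (c j) n * (seq (p j v) n - d j v))

        functional-of-edge : ∀ j → sum (λ v → φ v * d j v) ≡ g j
        functional-of-edge j = trans (sum-*-distribˡ-- (δ (tail j)) (δ (head j)))
          (cong₂ _-_ (sum-*δ φ (tail j)) (sum-*δ φ (head j)))

        ⟪Y⟫ : ∀ n → ⟪ Y ⟫ n ≡ sum (λ j → seq (c j) n * g j)
        ⟪Y⟫ n = begin
          sum (λ v → φ v * sum (λ j → seq (c j) n * d j v))
            ≡⟨ sum-cong-≗ (λ v → *-distribˡ-sum (φ v) (λ j → seq (c j) n * d j v)) ⟩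
          sum (λ v → sum (λ j → φ v * (seq (c j) n * d j v)))
            ≡⟨ ∑-comm (λ v j → φ v * (seq (c j) n * d j v)) ⟩
          sum (λ j → sum (λ v → φ v * (seq (c j) n * d j v)))
            ≡⟨ sum-cong-≗ (λ j → sum-cong-≗ λ v →
                 solve 3 (λ f c d → f :* (c :* d) := c :* (f :* d)) refl (φ v) (seq (c j) n) (d j v)) ⟩
          sum (λ j → sum (λ v → seq (c j) n * (φ v * d j v)))
            ≡⟨ sum-cong-≗ (λ j → trans (sym (*-distribˡ-sum (seq (c j) n) (λ v → φ v * d j v)))
                 (cong (seq (c j) n *_) (functional-of-edge j))) ⟩
          sum (λ j → seq (c j) n * g j) ∎
          where open ≡-Reasoning

        evaluate : ∀ n → γ * (1ℚ - C n) + sum (λ j → seq (c j) n * (γ - g j)) ≡ γ - ⟪ Y ⟫ n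
        evaluate n = begin
          γ * (1ℚ - C n) + B ≡⟨ solve 4 (λ γ c b a → γ :* (con 1ℚ :- c) :+ b := γ :- a :+ ((b :+ a) :- γ :* c)) refl γ (C n) B A ⟩
          γ - A + ((B + A) - γ * C n) ≡⟨ cong (λ t → γ - A + (t - γ * C n)) B+A ⟩
          γ - A + (γ * C n - γ * C n) ≡⟨ solve 2 (λ x y → x :+ (y :- y) := x) refl (γ - A) (γ * C n) ⟩
          γ - A ≡⟨ cong (λ a → γ - a) (sym (⟪Y⟫ n)) ⟩
          γ - ⟪ Y ⟫ n ∎
          where
          open ≡-Reasoning
          A = sum (λ j → seq (c j) n * g j)
          B = sum (λ j → seq (c j) n * (γ - g j))
          B+A : B + A ≡ γ * C n
          B+A = trans (sym (∑-distrib-+ (λ j → seq (c j) n * (γ - g j)) (λ j → seq (c j) n * g j)))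
            (trans (sum-cong-≗ λ j → solve 3 (λ c γ g → c :* (γ :- g) :+ c :* g := γ :* c) refl (seq (c j) n) γ (g j))
              (sym (*-distribˡ-sum γ (λ j → seq (c j) n))))

  -- At a lattice point both sides are constant sequences, so the asymptotic bound is an exact
  -- inequality of integers.
  lattice-bound : ∀ {N} (G : Graph N) s (f : Fin N → ℤ) C →
    (∀ u v → Adj G u v → f u ℤ.- f v ℤ.≤ + C) →
    ∀ z → LatticePoint (Dilate s (SymmetricEdgePolytope G)) z →
    sumℤ (λ v → f v ℤ.* lookup z v) ℤ.≤ + s ℤ.* + C
  lattice-bound {N} G s f C slope z (y , Py , z≈sy) = ι-cancel-≤
    {sumℤ (λ v → f v ℤ.* lookup z v)} {+ s ℤ.* + C} (subst₂ _≤_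
      (trans (sum-cong-≗ λ v → sym (ι-* (f v) (lookup z v))) (sum-ι (λ v → f v ℤ.* lookup z v)))
      (sym (ι-* (+ s) (+ C)))
      (subst₂ _≤_ (+-identityˡ F) (solve 2 (λ a b → a :- b :+ b := a) refl (ι (+ s) * ι (+ C)) F)
        (+-monoˡ-≤ F (nonneg-const {ι (+ s) * ι (+ C) - F} difference-nonneg))))
    where
    φ : Fin N → ℚ
    φ = ι ∘ f
    F : ℚ
    F = sum (λ v → φ v * ι (lookup z v))
    0≤C : 0ℚ ≤ ι (+ C)
    0≤C = ι-mono-≤ {+ 0} {+ C} (ℤ.+≤+ ℕ.z≤n)
    0≤s : 0ℚ ≤ ι (+ s)
    0≤s = ι-mono-≤ {+ 0} {+ s} (ℤ.+≤+ ℕ.z≤n)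
    slopeℚ : ∀ u v → Adj G u v → φ u - φ v ≤ ι (+ C)
    slopeℚ u v uv = subst (_≤ ι (+ C)) (trans (ι-+ (f u) (ℤ.- f v)) (cong (_+_ (φ u)) (ι-neg (f v))))
      (ι-mono-≤ {f u ℤ.- f v} {+ C} (slope u v uv))
    sy : Fin N → ℕ → ℚ
    sy v n = ι (+ s) * seq (y v) n
    difference-nonneg : AsymptoticallyNonneg (λ _ → ι (+ s) * ι (+ C) - F)
    difference-nonneg = nonneg-close {λ _ → ι (+ s) * ι (+ C) - F} {λ n → ι (+ s) * ι (+ C) - ⟪_⟫ φ sy n}
      (null-cong {λ n → ⟪_⟫ φ sy n - F}
        (λ n → solve 3 (λ c a b → a :- b := (c :- b) :- (c :- a)) refl (ι (+ s) * ι (+ C)) (⟪_⟫ φ sy n) F)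
        (null-swap (λ _ → F) (⟪_⟫ φ sy) (⟪⟫-close φ (λ v _ → ι (lookup z v)) sy (λ v → converges (z≈sy v)))))
      (nonneg-cong {λ n → (ι (+ C) - ⟪_⟫ φ (seq ∘ y) n) * ι (+ s)} scale
        (nonneg-* {λ n → ι (+ C) - ⟪_⟫ φ (seq ∘ y) n} 0≤s (polytope-bound φ G (ι (+ C)) 0≤C slopeℚ y Py)))
      where
      scale : ∀ n → (ι (+ C) - ⟪_⟫ φ (seq ∘ y) n) * ι (+ s) ≡ ι (+ s) * ι (+ C) - ⟪_⟫ φ sy n
      scale n = trans (solve 3 (λ c a s → (c :- a) :* s := s :* c :- s :* a) refl (ι (+ C)) (⟪_⟫ φ (seq ∘ y) n) (ι (+ s)))
        (cong (λ a → ι (+ s) * ι (+ C) - a) (trans (*-distribˡ-sum (ι (+ s)) (λ v → φ v * seq (y v) n))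
          (sum-cong-≗ λ v → solve 3 (λ s f y → s :* (f :* y) := f :* (s :* y)) refl (ι (+ s)) (φ v) (seq (y v) n))))

-- Inequalities satisfied by every lattice point.

module Necessity where

  open import Data.Integer.Base as ℤ using (ℤ; _+_; _-_; _*_; -_; +_; -[1+_]; 0ℤ; 1ℤ; -1ℤ)
  open import Data.Integer.Tactic.RingSolver using (solve-∀)
  open import Data.List.Base using (List; []; _∷_)
  open import Data.List.Membership.Propositional using (_∈_)
  open import Data.List.Relation.Unary.All as All using (All; []; _∷_)
  open import Data.List.Relation.Unary.Any using (here; there)
  open import Data.Vec.Base using (Vec; []; _∷_; lookup)
  open import Relation.Nullary using (Dec; contradiction)
  open import Relation.Nullary.Decidable using (True; toWitness)
  open import Algebra.Properties.Semiring.Sum ℤ.+-*-semiring using () renaming (sum to sumℤ; sum-cong-≗ to sumℤ-cong)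
  open Kinds
  open LeafVectors
  open Points
  open Hubs
  open Duality using (lattice-bound)

  -- A potential on the vertices that depends on the kind of a vertex and on the sign of
  -- the coordinate there: slope c on x ≥ 0 and − d on x < 0.
  potential : (c d x : ℤ) → ℤ
  potential c d (+ _)    = c
  potential c d -[1+ _ ] = - d

  potential-* : ∀ c d x → potential c d x * x ≡ hinge c d x
  potential-* c d (+ n)    = sym (trans (cong (λ a → c * + n + a) (ℤ.*-zeroʳ d)) (ℤ.+-identityʳ _))
  potential-* c d -[1+ n ] = trans (lemma c d (+ suc n)) (cong (ℤ._+ d * + suc n) (sym (ℤ.*-zeroʳ c)))
    where
    lemma : ∀ c d x → (- d) * (- x) ≡ + 0 + d * x
    lemma = solve-∀

  slopes : (c d : Kind → ℤ) → Kind → List ℤ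
  slopes c d k = c k ∷ - d k ∷ []

  potential∈slopes : ∀ (c d : Kind → ℤ) k x → potential (c k) (d k) x ∈ slopes c d k
  potential∈slopes c d k (+ _)    = here refl
  potential∈slopes c d k -[1+ _ ] = there (here refl)

  -- The signs of the two end coordinates are arbitrary, so all four combinations of slopes are
  -- tested. The condition thus mentions no `z` and is decided by evaluation.
  Lipschitz : (c d : Kind → ℤ) → ℕ → List (Kind × Kind) → Set
  Lipschitz c d C = All λ (k , l) → All (λ p → All (λ q → p - q ℤ.≤ + C) (slopes c d l)) (slopes c d k)

  lipschitz? : ∀ c d C pairs → Dec (Lipschitz c d C pairs)
  lipschitz? c d C = All.all? λ (k , l) → All.all? (λ p → All.all? (λ q → p - q ℤ.≤? + C) (slopes c d l)) (slopes c d k)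

  coeffs : (h₁ h₂ c p₁ p₂ i : ℤ) → Kind → ℤ
  coeffs h₁ h₂ c p₁ p₂ i hub₁      = h₁
  coeffs h₁ h₂ c p₁ p₂ i hub₂      = h₂
  coeffs h₁ h₂ c p₁ p₂ i common    = c
  coeffs h₁ h₂ c p₁ p₂ i pendant₁  = p₁
  coeffs h₁ h₂ c p₁ p₂ i pendant₂  = p₂
  coeffs h₁ h₂ c p₁ p₂ i isolated  = i

  forestPairs : List (Kind × Kind)
  forestPairs = (hub₁ , pendant₁) ∷ (hub₂ , pendant₂) ∷ (pendant₁ , hub₁) ∷ (pendant₂ , hub₂) ∷ []

  forest-incident : ∀ {k l} → k ≢ common → l ≢ common → (k , l) ∈ incidentPairs → (k , l) ∈ forestPairs
  forest-incident k≢ l≢ (here refl)                                                 = contradiction refl l≢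
  forest-incident k≢ l≢ (there (here refl))                                         = here refl
  forest-incident k≢ l≢ (there (there (here refl)))                                 = contradiction refl l≢
  forest-incident k≢ l≢ (there (there (there (here refl))))                         = there (here refl)
  forest-incident k≢ l≢ (there (there (there (there (here refl)))))                 = contradiction refl k≢
  forest-incident k≢ l≢ (there (there (there (there (there (here refl))))))         = there (there (here refl))
  forest-incident k≢ l≢ (there (there (there (there (there (there (here refl))))))) = contradiction refl k≢
  forest-incident k≢ l≢ (there (there (there (there (there (there (there (here refl)))))))) = there (there (there (here refl)))

  -- Each inequality pairs z with a potential of slope at most 1, or constant, along the edges.
  record Inequalities (P Q : Kind → ℤ) (K s : ℕ) : Set where
    field
      total≤0   : Σₖ (λ k → P k - Q k) ℤ.≤ + 0
      total≥0   : - Σₖ (λ k → P k - Q k) ℤ.≤ + 0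
      isolated≤ : P isolated + Q isolated ℤ.≤ + 0
      norm≤     : P common + Q common + (P pendant₁ + Q pendant₁ + (P pendant₂ + Q pendant₂)) ℤ.≤ + s
      spread₁≤  : (P hub₁ - Q hub₁) - (P hub₂ - Q hub₂) + (+ 2 * P pendant₁ + + 2 * Q pendant₂) ℤ.≤ + s
      spread₂≤  : (P hub₂ - Q hub₂) - (P hub₁ - Q hub₁) + (+ 2 * Q pendant₁ + + 2 * P pendant₂) ℤ.≤ + s
      forest≤0  : K ≡ 0 → (P hub₁ - Q hub₁) + (P pendant₁ - Q pendant₁) ℤ.≤ + 0
      forest≥0  : K ≡ 0 → - ((P hub₁ - Q hub₁) + (P pendant₁ - Q pendant₁)) ℤ.≤ + 0

  Constraints : ∀ {N} → Vec Kind N → ℕ → Vec ℤ N → Set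
  Constraints κ s z = Inequalities (λ k → + posSum κ k z) (λ k → + negSum κ k z) (commonCount κ) s

  module _ {N} (G : Graph N) (H : HubStructure G) (s : ℕ) (z : Vec ℤ N)
           (lattice : LatticePoint (Dilate s (SymmetricEdgePolytope G)) z) where
    open HubStructure H using (κ; incident)

    private
      P Q : Kind → ℤ
      P k = + posSum κ k z
      Q k = + negSum κ k z

    -- The potential depends on the signs of `z`, but its pairing with `z` is a sum of hinges, so
    -- one choice of `c` and `d` gives the same linear inequality in the kind sums for all `z`.
    potential-bound : ∀ (c d : Kind → ℤ) C pairs → (∀ u v → Adj G u v → (lookup κ u , lookup κ v) ∈ pairs) →
      Lipschitz c d C pairs → Σₖ (λ k → c k * P k + d k * Q k) ℤ.≤ + s * + C
    potential-bound c d C pairs adj∈pairs lipschitz = subst (ℤ._≤ + s * + C)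
      (trans (sumℤ-cong (λ v → potential-* (c (lookup κ v)) (d (lookup κ v)) (lookup z v))) (sum-hinge κ c d z))
      (lattice-bound G s f C slope z lattice)
      where
      f : Fin N → ℤ
      f v = potential (c (lookup κ v)) (d (lookup κ v)) (lookup z v)
      slope : ∀ u v → Adj G u v → f u - f v ℤ.≤ + C
      slope u v uv = All.lookup (All.lookup (All.lookup lipschitz (adj∈pairs u v uv))
        (potential∈slopes c d (lookup κ u) (lookup z u))) (potential∈slopes c d (lookup κ v) (lookup z v))

    private
      2ℤ : ℤ
      2ℤ = + 2

      bound : ∀ (c d : Kind → ℤ) C {lipschitz : True (lipschitz? c d C incidentPairs)} {t t′} →
              Σₖ (λ k → c k * P k + d k * Q k) ≡ t → + s * + C ≡ t′ → t ℤ.≤ t′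
      bound c d C {lipschitz} eq eq′ = subst₂ ℤ._≤_ eq eq′
        (potential-bound c d C incidentPairs incident (toWitness lipschitz))

      bound-forest : ∀ (c d : Kind → ℤ) {lipschitz : True (lipschitz? c d 0 forestPairs)} → commonCount κ ≡ 0 → ∀ {t} →
              Σₖ (λ k → c k * P k + d k * Q k) ≡ t → t ℤ.≤ + 0
      bound-forest c d {lipschitz} K≡0 eq = subst₂ ℤ._≤_ eq (ℤ.*-zeroʳ (+ s))
        (potential-bound c d 0 forestPairs
          (λ u v uv → forest-incident (no-common κ K≡0 u) (no-common κ K≡0 v) (incident u v uv)) (toWitness lipschitz))

    -- The potentials are dual certificates. Constants give the zero coordinate sum. The sign of the
    -- coordinate at isolated vertices, and 0 elsewhere, is constant along edges; the sign at
    -- leaves, and 0 at hubs, yields the norm. Without common vertices the indicator of `hub₁` and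
    -- its pendants is constant along edges.
    constraints : Constraints κ s z
    constraints = record
      { total≤0 = bound (λ _ → 1ℤ) (λ _ → -1ℤ) 0
          (Σₖ-cong (λ k → one (P k) (Q k))) (ℤ.*-zeroʳ (+ s))
      ; total≥0 = bound (ℤ.-_ ∘ λ _ → 1ℤ) (ℤ.-_ ∘ λ _ → -1ℤ) 0
          (negated (λ _ → 1ℤ) (λ _ → -1ℤ) (Σₖ-cong (λ k → one (P k) (Q k)))) (ℤ.*-zeroʳ (+ s))
      ; isolated≤ = bound (coeffs 0ℤ 0ℤ 0ℤ 0ℤ 0ℤ 1ℤ) (coeffs 0ℤ 0ℤ 0ℤ 0ℤ 0ℤ 1ℤ) 0
          (only-isolated h₁ h₁′ h₂ h₂′ c c′ p₁ p₁′ p₂ p₂′ i i′) (ℤ.*-zeroʳ (+ s))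
      ; norm≤ = bound (coeffs 0ℤ 0ℤ 1ℤ 1ℤ 1ℤ 0ℤ) (coeffs 0ℤ 0ℤ 1ℤ 1ℤ 1ℤ 0ℤ) 1
          (leaves h₁ h₁′ h₂ h₂′ c c′ p₁ p₁′ p₂ p₂′ i i′) (ℤ.*-identityʳ (+ s))
      -- The potential is 1 at `hub₁`, 0 at common vertices and -1 at `hub₂`; a pendant lies 1 above
      -- its hub if its coordinate is nonnegative and 1 below otherwise. The next field exchanges
      -- the hubs.
      ; spread₁≤ = bound (coeffs 1ℤ -1ℤ 0ℤ 2ℤ 0ℤ 0ℤ) (coeffs -1ℤ 1ℤ 0ℤ 0ℤ 2ℤ 0ℤ) 1
          (spread h₁ h₁′ h₂ h₂′ c c′ p₁ p₁′ p₂ p₂′ i i′) (ℤ.*-identityʳ (+ s))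
      ; spread₂≤ = bound (coeffs -1ℤ 1ℤ 0ℤ 0ℤ 2ℤ 0ℤ) (coeffs 1ℤ -1ℤ 0ℤ 2ℤ 0ℤ 0ℤ) 1
          (spread′ h₁ h₁′ h₂ h₂′ c c′ p₁ p₁′ p₂ p₂′ i i′) (ℤ.*-identityʳ (+ s))
      ; forest≤0 = λ K≡0 → bound-forest (coeffs 1ℤ 0ℤ 0ℤ 1ℤ 0ℤ 0ℤ) (coeffs -1ℤ 0ℤ 0ℤ -1ℤ 0ℤ 0ℤ) K≡0
          (star h₁ h₁′ h₂ h₂′ c c′ p₁ p₁′ p₂ p₂′ i i′)
      ; forest≥0 = λ K≡0 → bound-forest (ℤ.-_ ∘ coeffs 1ℤ 0ℤ 0ℤ 1ℤ 0ℤ 0ℤ) (ℤ.-_ ∘ coeffs -1ℤ 0ℤ 0ℤ -1ℤ 0ℤ 0ℤ) K≡0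
          (negated (coeffs 1ℤ 0ℤ 0ℤ 1ℤ 0ℤ 0ℤ) (coeffs -1ℤ 0ℤ 0ℤ -1ℤ 0ℤ 0ℤ) (star h₁ h₁′ h₂ h₂′ c c′ p₁ p₁′ p₂ p₂′ i i′))
      }
      where
      h₁ h₁′ h₂ h₂′ c c′ p₁ p₁′ p₂ p₂′ i i′ : ℤ
      h₁ = P hub₁
      h₁′ = Q hub₁
      h₂ = P hub₂
      h₂′ = Q hub₂
      c = P common
      c′ = Q common
      p₁ = P pendant₁
      p₁′ = Q pendant₁
      p₂ = P pendant₂
      p₂′ = Q pendant₂
      i = P isolated
      i′ = Q isolated
      negated : ∀ (c d : Kind → ℤ) {t} → Σₖ (λ k → c k * P k + d k * Q k) ≡ t →
        Σₖ (λ k → - c k * P k + - d k * Q k) ≡ - t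
      negated c d refl = trans (Σₖ-cong (λ k → minus (c k) (d k) (P k) (Q k))) (Σₖ-neg (λ k → c k * P k + d k * Q k))
        where
        minus : ∀ c d p q → - c * p + - d * q ≡ - (c * p + d * q)
        minus = solve-∀
        Σₖ-neg : ∀ f → Σₖ (λ k → - f k) ≡ - Σₖ f
        Σₖ-neg f = lemma (f hub₁) (f hub₂) (f common) (f pendant₁) (f pendant₂) (f isolated)
          where
          lemma : ∀ a b c d e f → - a + - b + - c + - d + - e + - f ≡ - (a + b + c + d + e + f)
          lemma = solve-∀
      one : ∀ p q → + 1 * p + -[1+ 0 ] * q ≡ p - q
      one = solve-∀
      only-isolated : ∀ p₁ q₁ p₂ q₂ p₃ q₃ p₄ q₄ p₅ q₅ p₆ q₆ →
        (+ 0 * p₁ + + 0 * q₁) + (+ 0 * p₂ + + 0 * q₂) + (+ 0 * p₃ + + 0 * q₃) + (+ 0 * p₄ + + 0 * q₄) + (+ 0 * p₅ + + 0 * q₅) + (+ 1 * p₆ + + 1 * q₆)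
        ≡ p₆ + q₆
      only-isolated = solve-∀
      leaves : ∀ p₁ q₁ p₂ q₂ p₃ q₃ p₄ q₄ p₅ q₅ p₆ q₆ →
        (+ 0 * p₁ + + 0 * q₁) + (+ 0 * p₂ + + 0 * q₂) + (+ 1 * p₃ + + 1 * q₃) + (+ 1 * p₄ + + 1 * q₄) + (+ 1 * p₅ + + 1 * q₅) + (+ 0 * p₆ + + 0 * q₆)
        ≡ p₃ + q₃ + (p₄ + q₄ + (p₅ + q₅))
      leaves = solve-∀
      spread : ∀ p₁ q₁ p₂ q₂ p₃ q₃ p₄ q₄ p₅ q₅ p₆ q₆ →
        (+ 1 * p₁ + -[1+ 0 ] * q₁) + (-[1+ 0 ] * p₂ + + 1 * q₂) + (+ 0 * p₃ + + 0 * q₃) + (+ 2 * p₄ + + 0 * q₄) + (+ 0 * p₅ + + 2 * q₅) + (+ 0 * p₆ + + 0 * q₆)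
        ≡ (p₁ - q₁) - (p₂ - q₂) + (+ 2 * p₄ + + 2 * q₅)
      spread = solve-∀
      spread′ : ∀ p₁ q₁ p₂ q₂ p₃ q₃ p₄ q₄ p₅ q₅ p₆ q₆ →
        (-[1+ 0 ] * p₁ + + 1 * q₁) + (+ 1 * p₂ + -[1+ 0 ] * q₂) + (+ 0 * p₃ + + 0 * q₃) + (+ 0 * p₄ + + 2 * q₄) + (+ 2 * p₅ + + 0 * q₅) + (+ 0 * p₆ + + 0 * q₆)
        ≡ (p₂ - q₂) - (p₁ - q₁) + (+ 2 * q₄ + + 2 * p₅)
      spread′ = solve-∀
      star : ∀ p₁ q₁ p₂ q₂ p₃ q₃ p₄ q₄ p₅ q₅ p₆ q₆ →
        (+ 1 * p₁ + -[1+ 0 ] * q₁) + (+ 0 * p₂ + + 0 * q₂) + (+ 0 * p₃ + + 0 * q₃) + (+ 1 * p₄ + -[1+ 0 ] * q₄) + (+ 0 * p₅ + + 0 * q₅) + (+ 0 * p₆ + + 0 * q₆)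
        ≡ (p₁ - q₁) + (p₄ - q₄)
      star = solve-∀

-- Every vector satisfying the inequalities is listed.

module Complete where

  open import Data.Integer.Base as ℤ using (ℤ; _+_; _-_; _*_; -_; +_; -[1+_]; ∣_∣)
  open import Data.Integer.Tactic.RingSolver using (solve-∀)
  open import Data.List.Membership.Propositional using (_∈_)
  open import Data.Nat.Base as ℕ using (ℕ; zero; suc; ⌊_/2⌋)
  open import Data.Vec.Base using (Vec; lookup; tabulate)
  open import Data.Vec.Properties using (lookup∘tabulate)
  open import Algebra.Properties.Semiring.Sum ℤ.+-*-semiring using () renaming (sum to sumℤ; sum-cong-≗ to sumℤ-cong)
  open Kinds
  open LeafVectors
  open Points
  open Necessity using (Constraints; module Inequalities)
  open Duality using (module Kronecker)

  private variable
    N : ℕ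

  halve : ∀ x j → + 2 * x ℤ.≤ + j → x ℤ.≤ + ⌊ j /2⌋
  halve -[1+ _ ] j _    = ℤ.-≤+
  halve (+ n)    j 2n≤j = ℤ.+≤+ (subst (ℕ._≤ ⌊ j /2⌋) (sym (ℕ.n≡⌊n+n/2⌋ n)) (ℕ.⌊n/2⌋-mono
    (subst (ℕ._≤ j) (cong (ℕ._+_ n) (ℕ.+-identityʳ n)) (ℤ.drop‿+≤+ (subst (ℤ._≤ + j) (sym (ℤ.pos-* 2 n)) 2n≤j)))))

  shift-≤ : ∀ {x y} t {x′ y′} → x ℤ.≤ y → x + t ≡ x′ → y + t ≡ y′ → x′ ℤ.≤ y′
  shift-≤ t x≤y refl refl = ℤ.+-monoˡ-≤ t x≤y

  -- Apply `sum-hinge` to the linear potential that is 1 on the kind `k` and 0 elsewhere: the sum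
  -- over vertices has `a` as its only term.
  net-unique : ∀ (κ : Vec Kind N) k a → lookup κ a ≡ k → (∀ v → lookup κ v ≡ k → v ≡ a) → ∀ z → net κ k z ≡ lookup z a
  net-unique κ k a κa only z = begin
    + posSum κ k z - + negSum κ k z
      ≡⟨ sym (pick k (λ l → + posSum κ l z) (λ l → + negSum κ l z)) ⟩
    Σₖ (λ l → c l * + posSum κ l z + - c l * + negSum κ l z)
      ≡⟨ sym (sum-hinge κ c (λ l → - c l) z) ⟩
    sumℤ (λ v → hinge (c (lookup κ v)) (- c (lookup κ v)) (lookup z v))
      ≡⟨ sumℤ-cong select ⟩
    sumℤ (λ v → if does (a Fin.≟ v) then lookup z v else + 0)
      ≡⟨ Kronecker.sum-δ ℤ.+-*-semiring (lookup z) a ⟩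
    lookup z a ∎
    where
    open ≡-Reasoning
    c : Kind → ℤ
    c l = if same l k then + 1 else + 0
    pick : ∀ k (p q : Kind → ℤ) → Σₖ (λ l → (if same l k then + 1 else + 0) * p l
                                          + - (if same l k then + 1 else + 0) * q l) ≡ p k - q k
    pick k p q = trans (Σₖ-cong term) (Σₖ-single k (p k - q k))
      where
      term : ∀ l → (if same l k then + 1 else + 0) * p l + - (if same l k then + 1 else + 0) * q l
                 ≡ (if same l k then p k - q k else + 0)
      term l with same l k in eq
      ... | true  rewrite same⇒≡ l k eq = one (p k) (q k)
        where
        one : ∀ p q → + 1 * p + -[1+ 0 ] * q ≡ p - q
        one = solve-∀
      ... | false = refl
    select : ∀ v → hinge (c (lookup κ v)) (- c (lookup κ v)) (lookup z v)
                 ≡ (if does (a Fin.≟ v) then lookup z v else + 0)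
    select v with a Fin.≟ v
    ... | yes refl rewrite κa | same-refl k = trans (unit (+ pos x) (+ neg x)) (pos-neg x)
      where
      x = lookup z a
      unit : ∀ p q → + 1 * p + -[1+ 0 ] * q ≡ p - q
      unit = solve-∀
    ... | no a≢v with same (lookup κ v) k in eq
    ...   | true  = contradiction (sym (only v (same⇒≡ (lookup κ v) k eq))) a≢v
    ...   | false = refl

  -- Isolated coordinates are kept, since the constraints force them to vanish anyway.
  clearAt : Kind → ℤ → ℤ
  clearAt hub₁ _ = + 0
  clearAt hub₂ _ = + 0
  clearAt _    x = x

  module _ (κ : Vec Kind N) {a b : Fin N}
           (only-a : ∀ v → lookup κ v ≡ hub₁ → v ≡ a) (only-b : ∀ v → lookup κ v ≡ hub₂ → v ≡ b)
           (s : ℕ) (z : Vec ℤ N) (constraints : Constraints κ s z) where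
    open Inequalities constraints

    -- `y` inverts `placeAt` at `hub₁`: what the hub sends out in excess of what it sends to its
    -- pendants.
    h₁ h₂ σ π₁ π₂ y : ℤ
    h₁ = net κ hub₁ z
    h₂ = net κ hub₂ z
    σ = net κ common z
    π₁ = net κ pendant₁ z
    π₂ = net κ pendant₂ z
    y = h₁ + π₁

    isolated-mass : mass κ isolated z ≡ 0
    isolated-mass = ℕ.n≤0⇒n≡0 (ℤ.drop‿+≤+ isolated≤)

    isolated-zero : ∀ v → lookup κ v ≡ isolated → lookup z v ≡ + 0
    isolated-zero v κv = ℤ.∣i∣≡0⇒i≡0 (ℕ.n≤0⇒n≡0 (subst (∣ lookup z v ∣ ℕ.≤_) isolated-mass (mass-bound κ isolated z v κv)))

    net-isolated : net κ isolated z ≡ + 0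
    net-isolated rewrite ℕ.m+n≡0⇒m≡0 (posSum κ isolated z) isolated-mass
                       | ℕ.m+n≡0⇒n≡0 (posSum κ isolated z) isolated-mass = refl

    total : h₁ + h₂ + σ + π₁ + π₂ ≡ + 0
    total = trans (sym (ℤ.+-identityʳ _)) (trans (cong (λ i → h₁ + h₂ + σ + π₁ + π₂ + i) (sym net-isolated))
      (ℤ.≤-antisym total≤0 (subst (+ 0 ℤ.≤_) (ℤ.neg-involutive (Σₖ (λ k → net κ k z))) (ℤ.neg-mono-≤ total≥0))))

    h₂≡ : h₂ ≡ - (h₁ + σ + π₁ + π₂)
    h₂≡ = trans (isolate h₁ h₂ σ π₁ π₂) (trans (cong (ℤ._- (h₁ + σ + π₁ + π₂)) total) (ℤ.+-identityˡ _))
      where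
      isolate : ∀ h h′ c p q → h′ ≡ h + h′ + c + p + q - (h + c + p + q)
      isolate = solve-∀

    drop : ∀ a b → a + b - b ≡ a
    drop = solve-∀

    w : Vec ℤ N
    w = tabulate λ v → clearAt (lookup κ v) (lookup z v)

    lookup-w : ∀ v → lookup w v ≡ clearAt (lookup κ v) (lookup z v)
    lookup-w = lookup∘tabulate λ v → clearAt (lookup κ v) (lookup z v)

    supported : Supported κ w
    supported v not-leaf with lookup κ v in κv | lookup-w v
    ... | hub₁     | eq = eq
    ... | hub₂     | eq = eq
    ... | isolated | eq = trans eq (isolated-zero v κv)

    agree : ∀ k → leaf? k ≡ true → ∀ v → lookup κ v ≡ k → lookup w v ≡ lookup z v
    agree common    _ v κv = trans (lookup-w v) (cong (λ k → clearAt k (lookup z v)) κv)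
    agree pendant₁  _ v κv = trans (lookup-w v) (cong (λ k → clearAt k (lookup z v)) κv)
    agree pendant₂  _ v κv = trans (lookup-w v) (cong (λ k → clearAt k (lookup z v)) κv)

    posSum-w : ∀ k → leaf? k ≡ true → posSum κ k w ≡ posSum κ k z
    posSum-w k leaf = kindSum-cong pos κ k w z (agree k leaf)
    negSum-w : ∀ k → leaf? k ≡ true → negSum κ k w ≡ negSum κ k z
    negSum-w k leaf = kindSum-cong neg κ k w z (agree k leaf)
    mass-w : ∀ k → leaf? k ≡ true → mass κ k w ≡ mass κ k z
    mass-w k leaf = cong₂ ℕ._+_ (posSum-w k leaf) (negSum-w k leaf)
    net-w : ∀ k → leaf? k ≡ true → net κ k w ≡ net κ k z
    net-w k leaf = cong₂ (λ p q → + p - + q) (posSum-w k leaf) (negSum-w k leaf)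

    norm : ℕ
    norm = commonMass κ z ℕ.+ (mass κ pendant₁ z ℕ.+ mass κ pendant₂ z)

    norm-w : ∥ w ∥ ≡ norm
    norm-w = trans (norm-supported κ w supported)
      (cong₂ ℕ._+_ (mass-w common refl) (cong₂ ℕ._+_ (mass-w pendant₁ refl) (mass-w pendant₂ refl)))

    norm≤s : norm ℕ.≤ s
    norm≤s = ℤ.drop‿+≤+ norm≤

    X⁺ X⁻ h : ℕ
    X⁺ = posSum κ common z
    X⁻ = negSum κ common z
    h  = halfSlack (commonCount κ) (s ℕ.∸ norm)

    slack : + s ≡ + (s ℕ.∸ norm) + + norm
    slack = cong +_ (sym (ℕ.m∸n+n≡m norm≤s))

    -- With h₂ eliminated through the zero coordinate sum, the left side of `spread₁≤` is 2 (y - X⁻)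
    -- + norm.
    2[y-X⁻]≤slack : + 2 * (y - + X⁻) ℤ.≤ + (s ℕ.∸ norm)
    2[y-X⁻]≤slack = shift-≤ (- + norm) spread₁≤
      (trans (cong (λ h₂ → h₁ - h₂ + (+ 2 * + posSum κ pendant₁ z + + 2 * + negSum κ pendant₂ z) - + norm) h₂≡)
        (eliminate h₁ (+ X⁺) (+ X⁻) (+ posSum κ pendant₁ z) (+ negSum κ pendant₁ z) (+ posSum κ pendant₂ z) (+ negSum κ pendant₂ z)))
      (trans (cong (ℤ._- + norm) slack) (drop (+ (s ℕ.∸ norm)) (+ norm)))
      where
      eliminate : ∀ h c d p q r t → h - - (h + (c - d) + (p - q) + (r - t)) + (+ 2 * p + + 2 * t)
          - (c + d + (p + q + (r + t)))
        ≡ + 2 * (h + (p - q) - d)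
      eliminate = solve-∀

    2[-y-X⁺]≤slack : + 2 * (- y - + X⁺) ℤ.≤ + (s ℕ.∸ norm)
    2[-y-X⁺]≤slack = shift-≤ (- + norm) spread₂≤
      (trans (cong (λ h₂ → h₂ - h₁ + (+ 2 * + negSum κ pendant₁ z + + 2 * + posSum κ pendant₂ z) - + norm) h₂≡)
        (eliminate h₁ (+ X⁺) (+ X⁻) (+ posSum κ pendant₁ z) (+ negSum κ pendant₁ z) (+ posSum κ pendant₂ z) (+ negSum κ pendant₂ z)))
      (trans (cong (ℤ._- + norm) slack) (drop (+ (s ℕ.∸ norm)) (+ norm)))
      where
      eliminate : ∀ h c d p q r t → - (h + (c - d) + (p - q) + (r - t)) - h + (+ 2 * q + + 2 * r)
          - (c + d + (p + q + (r + t)))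
        ≡ + 2 * (- (h + (p - q)) - c)
      eliminate = solve-∀

    y-range : (y ℤ.≤ + X⁻ + + h) × (- y ℤ.≤ + X⁺ + + h)
    y-range = go (commonCount κ) refl
      where
      go : ∀ K → commonCount κ ≡ K → (y ℤ.≤ + X⁻ + + halfSlack K (s ℕ.∸ norm)) × (- y ℤ.≤ + X⁺ + + halfSlack K (s ℕ.∸ norm))
      -- Without common vertices the half slack is 0, and the forest inequalities give y ≤ 0 and -y
      -- ≤ 0.
      go zero    K≡0 = ℤ.≤-trans (forest≤0 K≡0) (ℤ.+≤+ ℕ.z≤n) , ℤ.≤-trans (forest≥0 K≡0) (ℤ.+≤+ ℕ.z≤n)
      go (suc _) _   =
          shift-≤ (+ X⁻) (halve (y - + X⁻) (s ℕ.∸ norm) 2[y-X⁻]≤slack) (add-back y (+ X⁻)) (ℤ.+-comm (+ ⌊ s ℕ.∸ norm /2⌋) (+ X⁻))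
        , shift-≤ (+ X⁺) (halve (- y - + X⁺) (s ℕ.∸ norm) 2[-y-X⁺]≤slack) (add-back (- y) (+ X⁺)) (ℤ.+-comm (+ ⌊ s ℕ.∸ norm /2⌋) (+ X⁺))
        where
        add-back : ∀ a b → a - b + b ≡ a
        add-back = solve-∀

    -- The absolute value only converts to ℕ: by `y-range` the argument is nonnegative.
    i : ℕ
    i = ∣ y + + (X⁺ ℕ.+ h) ∣

    i≡ : + i ≡ y + + (X⁺ ℕ.+ h)
    i≡ = ℤ.0≤i⇒+∣i∣≡i (shift-≤ y (proj₂ y-range) (ℤ.+-inverseˡ y) (ℤ.+-comm (+ (X⁺ ℕ.+ h)) y))

    i<width : i ℕ.< suc (commonMass κ z ℕ.+ 2 ℕ.* h)
    i<width = ℕ.s≤s (ℤ.drop‿+≤+ (shift-≤ (+ (X⁺ ℕ.+ h)) (proj₁ y-range) (sym i≡)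
      (cong +_ (rearrange X⁺ X⁻ h))))
      where
      rearrange : ∀ a b h → b ℕ.+ h ℕ.+ (a ℕ.+ h) ≡ a ℕ.+ b ℕ.+ 2 ℕ.* h
      rearrange = ℕSolver.solve-∀

    excess-w : excess κ s w ≡ h
    excess-w = cong (λ n → halfSlack (commonCount κ) (s ℕ.∸ n)) norm-w

    width-w : width κ s w ≡ suc (commonMass κ z ℕ.+ 2 ℕ.* h)
    width-w = cong₂ (λ m e → suc (m ℕ.+ 2 ℕ.* e)) (mass-w common refl) excess-w

    demand-w : demand κ s w i ≡ y
    demand-w = trans (cong₂ (λ a b → a - + b) i≡ (cong₂ ℕ._+_ (posSum-w common refl) excess-w))
      (cancel y (+ (X⁺ ℕ.+ h)))
      where
      cancel : ∀ a b → a + b - b ≡ a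
      cancel = solve-∀

    place-w : ∀ v → lookup z v ≡ lookup (place κ w y) v
    place-w v with lookup κ v in κv | lookup-place κ w y v | lookup-w v
    ... | hub₁      | eq | _ = sym (trans eq (trans (cong (λ p → y - p) (net-w pendant₁ refl))
                                 (trans (cancel h₁ π₁) (net-unique κ hub₁ v κv (λ u κu → trans (only-a u κu) (sym (only-a v κv))) z))))
      where
      cancel : ∀ a b → a + b - b ≡ a
      cancel = solve-∀
    ... | hub₂      | eq | _ = sym (trans eq (trans (cong₂ (λ c p → - (y + c + p)) (net-w common refl) (net-w pendant₂ refl))
                                 (trans (regroup h₁ σ π₁ π₂) (trans (sym h₂≡)
                                   (net-unique κ hub₂ v κv (λ u κu → trans (only-b u κu) (sym (only-b v κv))) z)))))
      where
      regroup : ∀ h c p q → - (h + p + c + q) ≡ - (h + c + p + q)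
      regroup = solve-∀
    ... | common    | eq | eq′ = sym (trans eq eq′)
    ... | pendant₁  | eq | eq′ = sym (trans eq eq′)
    ... | pendant₂  | eq | eq′ = sym (trans eq eq′)
    ... | isolated  | eq | eq′ = sym (trans eq eq′)

    points-complete : z ∈ points κ s
    points-complete = subst (_∈ points κ s)
      (trans (cong (place κ w) demand-w) (sym (vec-ext place-w)))
      (∈-points⁺ κ s w i supported (subst (ℕ._≤ s) (sym norm-w) norm≤s) (subst (i ℕ.<_) (sym width-w) i<width))

-- Flows and the convex combinations they induce.

module Flows where

  open import Data.Integer.Base as ℤ using (ℤ; +_)
  import Data.Integer.Tactic.RingSolver as ℤSolver
  open import Data.Rational.Base
  open import Data.Rational.Properties
  open import Data.Rational.Solver using (module +-*-Solver)
  open import Data.Vec.Base using (Vec; lookup)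
  open import Algebra.Properties.Semiring.Sum ℤ.+-*-semiring using () renaming (sum to sumℤ)
  open import Algebra.Properties.Semiring.Sum ℕ.+-*-semiring using () renaming (sum to sumℕ)
  open Embedding
  open Duality using (δ; seq-e; seq-∑)
  open import Algebra.Bundles using (module Ring)
  open import Algebra.Properties.Semiring.Sum (Ring.semiring +-*-ring) using (sum)
  open +-*-Solver

  δℤ : ∀ {N} → Fin N → Fin N → ℤ
  δℤ u v = if does (u Fin.≟ v) then + 1 else + 0

  ι-δ : ∀ {N} (u v : Fin N) → ι (δℤ u v) ≡ δ u v
  ι-δ u v with does (u Fin.≟ v)
  ... | true  = refl
  ... | false = refl

  module _ {N} (G : Graph N) where

    -- Flow n z: arcs of total weight n whose weighted edge vectors add up to z.
    data Flow : ℕ → (Fin N → ℤ) → Set where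
      stop : ∀ {z} → (∀ i → z i ≡ + 0) → Flow 0 z
      step : ∀ {u v n z z′} ω → Adj G u v → Flow n z →
             (∀ i → z′ i ≡ + ω ℤ.* (δℤ u i ℤ.- δℤ v i) ℤ.+ z i) → Flow (ω ℕ.+ n) z′

    flow-cong : ∀ {m n x y} → m ≡ n → (∀ i → y i ≡ x i) → Flow m x → Flow n y
    flow-cong refl y≡x (stop x≡0)         = stop (λ i → trans (y≡x i) (x≡0 i))
    flow-cong refl y≡x (step ω uv f x≡) = step ω uv f (λ i → trans (y≡x i) (x≡ i))

    flow-+ : ∀ {m n x y} → Flow m x → Flow n y → Flow (m ℕ.+ n) (λ i → x i ℤ.+ y i)
    flow-+ {y = y} (stop x≡0) g = flow-cong refl (λ i → trans (cong (ℤ._+ y i) (x≡0 i)) (ℤ.+-identityˡ (y i))) g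
    flow-+ {y = y} (step {u} {v} {n} {z} ω uv f x≡) g = flow-cong (sym (ℕ.+-assoc ω n _)) (λ _ → refl)
      (step ω uv (flow-+ f g) (λ i → trans (cong (ℤ._+ y i) (x≡ i)) (ℤ.+-assoc (+ ω ℤ.* (δℤ u i ℤ.- δℤ v i)) (z i) (y i))))

    flow-arc : ∀ {u v} ω → Adj G u v → Flow ω (λ i → + ω ℤ.* (δℤ u i ℤ.- δℤ v i))
    flow-arc ω uv = flow-cong (ℕ.+-identityʳ ω) (λ _ → refl)
      (step ω uv (stop {λ _ → + 0} (λ _ → refl)) (λ i → sym (ℤ.+-identityʳ _)))

    flow-∑ : ∀ k (m : Fin k → ℕ) (x : Fin k → Fin N → ℤ) → (∀ j → Flow (m j) (x j)) →
             Flow (sumℕ m) (λ i → sumℤ (λ j → x j i))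
    flow-∑ zero    m x f = stop (λ _ → refl)
    flow-∑ (suc k) m x f = flow-+ (f zero) (flow-∑ k (m ∘ suc) (x ∘ suc) (f ∘ suc))

    -- Sending `r` along an edge and back has no boundary and uses weight 2r; this raises a cheap
    -- flow to the prescribed total weight.
    flow-pad : ∀ {n z u v} r → Adj G u v → Flow n z → Flow (r ℕ.+ (r ℕ.+ n)) z
    flow-pad {z = z} {u} {v} r uv f = step r uv (step r (symmetric G uv) f (λ _ → refl))
      (λ i → cancel (+ r) (δℤ u i) (δℤ v i) (z i))
      where
      cancel : ∀ r a b z → z ≡ r ℤ.* (a ℤ.- b) ℤ.+ (r ℤ.* (b ℤ.- a) ℤ.+ z)
      cancel = ℤSolver.solve-∀

    flow-zero : ∀ {n z} → Flow n z → n ≡ 0 → ∀ i → z i ≡ + 0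
    flow-zero (stop z≡0)                          _ = z≡0
    flow-zero (step {n = n} ω _ f z≡) ω+n≡0 i with ℕ.m+n≡0⇒m≡0 ω ω+n≡0
    ... | refl = trans (z≡ i) (trans (ℤ.+-identityˡ _) (flow-zero f ω+n≡0 i))

    flow-fold : (P : ℕ → (Fin N → ℤ) → Set) →
      (∀ {z} → (∀ i → z i ≡ + 0) → P 0 z) →
      (∀ {u v n z z′} ω → Adj G u v → P n z →
        (∀ i → z′ i ≡ + ω ℤ.* (δℤ u i ℤ.- δℤ v i) ℤ.+ z i) → P (ω ℕ.+ n) z′) →
      ∀ {n z} → Flow n z → P n z
    flow-fold P base extend (stop z≡0)         = base z≡0
    flow-fold P base extend (step ω uv f z′≡) = extend ω uv (flow-fold P base extend f) z′≡

    -- For `q` the reciprocal of the total weight `n`, these are the data that `ConvexHull` asks of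
    -- the point z q. The equations hold at every index `t`, not only in the limit, as flows give
    -- constant sequences.
    Combination : ℕ → (Fin N → ℤ) → ℚ → Set
    Combination n z q = ∃ λ size → ∃₂ λ (weight : Fin size → ℝ) (point : Fin size → ℝ^ N) →
      (∀ j → 0ᴿ ≤ᴿ weight j) × (∀ t → sum (λ j → seq (weight j) t) ≡ ι (+ n) * q) × (∀ j → EdgeVector G (point j))
      × (∀ i t → sum (λ j → seq (weight j) t * seq (point j i) t) ≡ ι (z i) * q)

    zero-combined : ∀ x q → x ≡ + 0 → 0ℚ ≡ ι x * q
    zero-combined .(+ 0) q refl = sym (*-zeroˡ q)

    empty-combination : ∀ {z} q → (∀ i → z i ≡ + 0) → Combination 0 z q
    empty-combination {z} q z≡0 = 0 , (λ ()) , (λ ()) , (λ ())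
      , (λ _ → zero-combined (+ 0) q refl) , (λ ()) , λ i _ → zero-combined (z i) q (z≡0 i)

    module _ {u v : Fin N} {n : ℕ} {z z′ : Fin N → ℤ} {q : ℚ} (ω : ℕ) (uv : Adj G u v) (0≤q : 0ℚ ≤ q)
             (z′≡ : ∀ i → z′ i ≡ + ω ℤ.* (δℤ u i ℤ.- δℤ v i) ℤ.+ z i) (C : Combination n z q) where
      private
        size : ℕ
        size = proj₁ C

        weight′ : Fin (suc size) → ℝ
        weight′ zero    = ℚ→ℝ (ι (+ ω) * q)
        weight′ (suc j) = proj₁ (proj₂ C) j

        point′ : Fin (suc size) → ℝ^ N
        point′ zero    = e u -ⱽ e v
        point′ (suc j) = proj₁ (proj₂ (proj₂ C)) j

        0≤ωq : 0ℚ ≤ ι (+ ω) * q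
        0≤ωq = subst (_≤ ι (+ ω) * q) (*-zeroˡ q) (*-monoʳ-≤-nonNeg q {{nonNegative 0≤q}} (ι-mono-≤ {+ 0} {+ ω} (ℤ.+≤+ ℕ.z≤n)))

        nonneg′ : ∀ j → 0ᴿ ≤ᴿ weight′ j
        nonneg′ zero    = mk≤ᴿ (λ ε 0<ε → 0 , λ _ _ → +-mono-≤-< 0≤ωq 0<ε)
        nonneg′ (suc j) = proj₁ (proj₂ (proj₂ (proj₂ C))) j

        edges′ : ∀ j → EdgeVector G (point′ j)
        edges′ zero    = u , v , uv , λ i → mk≈ (λ ε 0<ε → 0 , λ t _ →
          subst (_< ε) (sym (cong ∣_∣ (+-inverseʳ (seq (e u i) t - seq (e v i) t)))) 0<ε)
        edges′ (suc j) = proj₁ (proj₂ (proj₂ (proj₂ (proj₂ (proj₂ C))))) j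

        total′ : ∀ t → sum (λ j → seq (weight′ j) t) ≡ ι (+ (ω ℕ.+ n)) * q
        total′ t = trans (cong (_+_ (ι (+ ω) * q)) (proj₁ (proj₂ (proj₂ (proj₂ (proj₂ C)))) t))
          (trans (sym (*-distribʳ-+ q (ι (+ ω)) (ι (+ n)))) (cong (_* q) (sym (ι-+ (+ ω) (+ n)))))

        collect : ∀ i → ι (+ ω) * q * (ι (δℤ u i) - ι (δℤ v i)) + ι (z i) * q ≡ ι (z′ i) * q
        collect i = begin
          ι (+ ω) * q * (ι (δℤ u i) - ι (δℤ v i)) + ι (z i) * q
            ≡⟨ solve 5 (λ w q a b z → w :* q :* (a :- b) :+ z :* q := (w :* (a :- b) :+ z) :* q) refl
                 (ι (+ ω)) q (ι (δℤ u i)) (ι (δℤ v i)) (ι (z i)) ⟩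
          (ι (+ ω) * (ι (δℤ u i) - ι (δℤ v i)) + ι (z i)) * q
            ≡⟨ cong (λ a → (ι (+ ω) * (ι (δℤ u i) + a) + ι (z i)) * q) (sym (ι-neg (δℤ v i))) ⟩
          (ι (+ ω) * (ι (δℤ u i) + ι (ℤ.- δℤ v i)) + ι (z i)) * q
            ≡⟨ cong (λ a → (ι (+ ω) * a + ι (z i)) * q) (sym (ι-+ (δℤ u i) (ℤ.- δℤ v i))) ⟩
          (ι (+ ω) * ι (δℤ u i ℤ.- δℤ v i) + ι (z i)) * q
            ≡⟨ cong (λ a → (a + ι (z i)) * q) (sym (ι-* (+ ω) (δℤ u i ℤ.- δℤ v i))) ⟩
          (ι (+ ω ℤ.* (δℤ u i ℤ.- δℤ v i)) + ι (z i)) * q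
            ≡⟨ cong (_* q) (sym (ι-+ (+ ω ℤ.* (δℤ u i ℤ.- δℤ v i)) (z i))) ⟩
          ι (+ ω ℤ.* (δℤ u i ℤ.- δℤ v i) ℤ.+ z i) * q
            ≡⟨ cong (λ a → ι a * q) (sym (z′≡ i)) ⟩
          ι (z′ i) * q ∎
          where open ≡-Reasoning

        combined′ : ∀ i t → sum (λ j → seq (weight′ j) t * seq (point′ j i) t) ≡ ι (z′ i) * q
        combined′ i t = trans
          (cong₂ (λ a b → ι (+ ω) * q * a + b)
            (cong₂ _-_ (trans (seq-e u i t) (sym (ι-δ u i))) (trans (seq-e v i t) (sym (ι-δ v i))))
            (proj₂ (proj₂ (proj₂ (proj₂ (proj₂ (proj₂ C))))) i t))
          (collect i)

      extend-combination : Combination (ω ℕ.+ n) z′ q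
      extend-combination = suc size , weight′ , point′ , nonneg′ , total′ , edges′ , combined′

    combination : ∀ n z → Flow n z → ∀ q → 0ℚ ≤ q → Combination n z q
    combination n z f q 0≤q = flow-fold (λ n z → Combination n z q) (empty-combination q)
      (λ ω uv C z′≡ → extend-combination ω uv 0≤q z′≡ C) f

    close : ∀ p q {ε} → p ≡ q → 0ℚ < ε → ∣ p - q ∣ < ε
    close p .p {ε} refl 0<ε = subst (_< ε) (sym (cong ∣_∣ (+-inverseʳ p))) 0<ε

    combination⇒lattice : ∀ n z′ q s z → Combination n z′ q → ι (+ n) * q ≡ 1ℚ →
      (∀ i → ι (+ s) * (ι (z′ i) * q) ≡ ι (lookup z i)) →
      LatticePoint (Dilate s (SymmetricEdgePolytope G)) z
    combination⇒lattice n z′ q s z (size , weight , point , nonneg , total , edges , combined) nq≡1 scaled =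
      y , inj₁ (size , weight , point , nonneg
               , mk≈ (λ ε 0<ε → 0 , λ t _ → close (seq (∑ weight) t) 1ℚ (trans (seq-∑ weight t) (trans (total t) nq≡1)) 0<ε)
               , edges , λ i → mk≈ (λ ε 0<ε → 0 , λ t _ → close (seq (y i) t) (seq (y i) t) refl 0<ε))
      , λ i → mk≈ (λ ε 0<ε → 0 , λ t _ → close (ι (lookup z i)) (ι (+ s) * seq (y i) t) (at i t) 0<ε)
      where
      y : ℝ^ N
      y i = ∑ (λ j → weight j *ᴿ point j i)
      at : ∀ i t → ι (lookup z i) ≡ ι (+ s) * seq (y i) t
      at i t = trans (sym (scaled i))
        (cong (ι (+ s) *_) (sym (trans (seq-∑ (λ j → weight j *ᴿ point j i) t) (combined i t))))

    reciprocal : ∀ n → 0ℚ < n → ∃ λ q → 0ℚ < q × n * q ≡ 1ℚ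
    reciprocal n 0<n = (1/ n) {{n≢0}} , positive⁻¹ _ {{1/pos⇒pos n {{positive 0<n}}}} , *-inverseʳ n {{n≢0}}
      where
      n≢0 : NonZero n
      n≢0 = pos⇒nonZero n {{positive 0<n}}

    unscale : ∀ s d z q → d * s * q ≡ 1ℚ → s * (d * z * q) ≡ z
    unscale s d z q dsq≡1 = trans
      (solve 4 (λ s d z q → s :* (d :* z :* q) := d :* s :* q :* z) refl s d z q)
      (trans (cong (_* z) dsq≡1) (*-identityˡ z))

    module _ {u v} (uv : Adj G u v) (D s : ℕ) (z : Vec ℤ N)
             (f : Flow (suc D ℕ.* s) (λ i → + suc D ℤ.* lookup z i)) where

      -- A flow of total weight 0 cannot be normalised. Any edge vector serves as the point of the
      -- polytope to be dilated by 0, and the flow shows that `z` is 0.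
      flow⇒lattice-zero : s ≡ 0 → LatticePoint (Dilate s (SymmetricEdgePolytope G)) z
      flow⇒lattice-zero s≡0 = combination⇒lattice 1 (λ i → + 1 ℤ.* (δℤ u i ℤ.- δℤ v i)) 1ℚ s z
        (combination 1 (λ i → + 1 ℤ.* (δℤ u i ℤ.- δℤ v i)) (flow-arc 1 uv) 1ℚ (ι-mono-≤ {+ 0} {+ 1} (ℤ.+≤+ ℕ.z≤n)))
        (*-identityˡ 1ℚ) (λ i → vanish (+ s) (lookup z i) _ (cong +_ s≡0) (z≡0 i))
        where
        z≡0 : ∀ i → lookup z i ≡ + 0
        z≡0 i = ℤ.*-cancelˡ-≡ (+ suc D) (lookup z i) (+ 0)
          (trans (flow-zero f (trans (cong (suc D ℕ.*_) s≡0) (ℕ.*-zeroʳ D)) i) (sym (ℤ.*-zeroʳ (+ suc D))))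
        vanish : ∀ a b x → a ≡ + 0 → b ≡ + 0 → ι a * x ≡ ι b
        vanish .(+ 0) .(+ 0) x refl refl = *-zeroˡ x

      flow⇒lattice-positive : 0 ℕ.< s → LatticePoint (Dilate s (SymmetricEdgePolytope G)) z
      flow⇒lattice-positive 0<s = combination⇒lattice (suc D ℕ.* s) (λ i → + suc D ℤ.* lookup z i) q s z
        (combination (suc D ℕ.* s) (λ i → + suc D ℤ.* lookup z i) f q (<⇒≤ (proj₁ (proj₂ inverse))))
        (proj₂ (proj₂ inverse)) back
        where
        0<n : 0ℚ < ι (+ (suc D ℕ.* s))
        0<n = <-≤-trans (positive⁻¹ 1ℚ) (ι-mono-≤ {+ 1} {+ (suc D ℕ.* s)} (ℤ.+≤+ (ℕ.≤-trans 0<s (ℕ.m≤m+n s (D ℕ.* s)))))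
        inverse : ∃ λ q → 0ℚ < q × ι (+ (suc D ℕ.* s)) * q ≡ 1ℚ
        inverse = reciprocal (ι (+ (suc D ℕ.* s))) 0<n
        q : ℚ
        q = proj₁ inverse
        back : ∀ i → ι (+ s) * (ι (+ suc D ℤ.* lookup z i) * q) ≡ ι (lookup z i)
        back i = trans (cong (λ a → ι (+ s) * (a * q)) (ι-* (+ suc D) (lookup z i)))
          (unscale (ι (+ s)) (ι (+ suc D)) (ι (lookup z i)) q
            (trans (cong (_* q) (sym (ι-ℕ* (suc D) s))) (proj₂ (proj₂ inverse))))
          where
          ι-ℕ* : ∀ m n → ι (+ (m ℕ.* n)) ≡ ι (+ m) * ι (+ n)
          ι-ℕ* m n = trans (cong ι (ℤ.pos-* m n)) (ι-* (+ m) (+ n))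

      flow⇒lattice : LatticePoint (Dilate s (SymmetricEdgePolytope G)) z
      flow⇒lattice = [ flow⇒lattice-zero , flow⇒lattice-positive ]′ (zero-or-positive s)
        where
        zero-or-positive : ∀ s → s ≡ 0 ⊎ 0 ℕ.< s
        zero-or-positive zero    = inj₁ refl
        zero-or-positive (suc s) = inj₂ ℕ.z<s

    -- Doubling makes the unused weight even, so that it can be spent on back-and-forth pairs of arcs.
    short-flow⇒lattice : ∀ {u v} → Adj G u v → ∀ D {n s} z → n ℕ.≤ s →
      Flow (suc D ℕ.* n) (λ i → + suc D ℤ.* lookup z i) →
      LatticePoint (Dilate s (SymmetricEdgePolytope G)) z
    short-flow⇒lattice uv D {n} {s} z n≤s f = flow⇒lattice uv (D ℕ.+ suc D) s z
      (flow-cong length (λ i → double (+ D) (lookup z i)) (flow-pad (suc D ℕ.* (s ℕ.∸ n)) uv (flow-+ f f)))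
      where
      double : ∀ d z → (+ 1 ℤ.+ (d ℤ.+ (+ 1 ℤ.+ d))) ℤ.* z ≡ (+ 1 ℤ.+ d) ℤ.* z ℤ.+ (+ 1 ℤ.+ d) ℤ.* z
      double = ℤSolver.solve-∀
      collect : ∀ d r n → (1 ℕ.+ d) ℕ.* r ℕ.+ ((1 ℕ.+ d) ℕ.* r ℕ.+ ((1 ℕ.+ d) ℕ.* n ℕ.+ (1 ℕ.+ d) ℕ.* n))
                        ≡ (1 ℕ.+ (d ℕ.+ (1 ℕ.+ d))) ℕ.* (r ℕ.+ n)
      collect = ℕSolver.solve-∀
      length : suc D ℕ.* (s ℕ.∸ n) ℕ.+ (suc D ℕ.* (s ℕ.∸ n) ℕ.+ (suc D ℕ.* n ℕ.+ suc D ℕ.* n))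
             ≡ suc (D ℕ.+ suc D) ℕ.* s
      length = trans (collect D (s ℕ.∸ n) n) (cong (suc (D ℕ.+ suc D) ℕ.*_) (ℕ.m∸n+n≡m n≤s))

-- Flows that realise the leaf coordinates and the hub-to-hub excess.

module Sufficiency where

  open import Data.Integer.Base as ℤ using (ℤ; _+_; _-_; _*_; -_; +_; -[1+_]; ∣_∣; 0ℤ)
  open import Data.Integer.Tactic.RingSolver using (solve-∀)
  open import Data.Nat.Base as ℕ using (ℕ; zero; suc; ⌊_/2⌋)
  open import Data.Vec.Base using (Vec; []; _∷_; lookup)
  open import Algebra.Properties.Semiring.Sum ℤ.+-*-semiring using (∑-distrib-+; *-distribʳ-sum) renaming (sum to sumℤ; sum-cong-≗ to sumℤ-cong)
  open import Algebra.Properties.Semiring.Sum ℕ.+-*-semiring using () renaming (sum to sumℕ)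
  open Kinds
  open LeafVectors
  open Points
  open Hubs
  open Necessity using (coeffs)
  open Duality using (module Kronecker)
  open Flows

  δ-sym : ∀ {N} (u v : Fin N) → does (u Fin.≟ v) ≡ does (v Fin.≟ u)
  δ-sym u v with u Fin.≟ v | v Fin.≟ u
  ... | yes _   | yes _   = refl
  ... | yes u≡v | no v≢u  = contradiction (sym u≡v) v≢u
  ... | no u≢v  | yes v≡u = contradiction (sym v≡u) u≢v
  ... | no _    | no _    = refl

  sum-*δℤ : ∀ {N} (f : Fin N → ℤ) j → sumℤ (λ v → f v * δℤ v j) ≡ f j
  sum-*δℤ f j = trans (sumℤ-cong λ v → trans (cong (λ b → f v * (if b then + 1 else + 0)) (δ-sym v j)) (select (does (j Fin.≟ v)) (f v)))
    (Kronecker.sum-δ ℤ.+-*-semiring f j)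
    where
    select : ∀ b a → a * (if b then + 1 else + 0) ≡ (if b then a else + 0)
    select true  a = ℤ.*-identityʳ a
    select false a = ℤ.*-zeroʳ a

  sum-∥∥ : ∀ {N} D (w : Vec ℤ N) → sumℕ (λ v → D ℕ.* ∣ lookup w v ∣) ≡ D ℕ.* ∥ w ∥
  sum-∥∥ D []      = sym (ℕ.*-zeroʳ D)
  sum-∥∥ D (x ∷ w) = trans (cong (ℕ._+_ (D ℕ.* ∣ x ∣)) (sum-∥∥ D w)) (sym (ℕ.*-distribˡ-+ D ∣ x ∣ ∥ w ∥))

  ∣r-h∣≤h : ∀ r h → r ℕ.≤ 2 ℕ.* h → ∣ + r - + h ∣ ℕ.≤ h
  ∣r-h∣≤h r h r≤2h rewrite ℤ.m-n≡m⊖n r h with ℕ.≤-total r h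
  ... | inj₁ r≤h rewrite ℤ.∣⊖∣-≤ r≤h = ℕ.m∸n≤m h r
  ... | inj₂ h≤r rewrite ℤ.⊖-≥ h≤r = ℕ.m≤n+o⇒m∸n≤o r h (subst (r ℕ.≤_) (cong (ℕ._+_ h) (ℕ.+-identityʳ h)) r≤2h)

  double-halfSlack : ∀ K j → 2 ℕ.* halfSlack K j ℕ.≤ j
  double-halfSlack zero    j = ℕ.z≤n
  double-halfSlack (suc _) j = subst₂ ℕ._≤_ (cong (ℕ._+_ ⌊ j /2⌋) (sym (ℕ.+-identityʳ ⌊ j /2⌋))) (ℕ.⌊n/2⌋+⌈n/2⌉≡n j)
    (ℕ.+-monoʳ-≤ ⌊ j /2⌋ (ℕ.⌊n/2⌋≤⌈n/2⌉ j))

  -- Common vertices split their supply between the hubs in the proportion p : q.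
  proportion : ∀ X⁺ X⁻ i → i ℕ.≤ X⁺ ℕ.+ X⁻ → ∃ λ D → ∃₂ λ p q → p ℕ.+ q ≡ suc D ×
    + suc D * (+ i - + X⁺) ≡ + q * + X⁻ - + p * + X⁺
  proportion X⁺ X⁻ i i≤m with X⁺ ℕ.+ X⁻ in eq
  ... | zero rewrite ℕ.m+n≡0⇒m≡0 X⁺ eq | ℕ.n≤0⇒n≡0 i≤m = 0 , 1 , 0 , refl , refl
  ... | suc D = D , suc D ℕ.∸ i , i , ℕ.m∸n+n≡m i≤m , (begin
    + suc D * (+ i - + X⁺)
      ≡⟨ cong (ℤ._* (+ i - + X⁺)) (cong +_ (sym eq)) ⟩
    (+ X⁺ + + X⁻) * (+ i - + X⁺)
      ≡⟨ split (+ X⁺) (+ X⁻) (+ i) ⟩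
    + i * + X⁻ - (+ X⁺ + + X⁻ - + i) * + X⁺
      ≡⟨ cong (λ m → + i * + X⁻ - (m - + i) * + X⁺) (cong +_ eq) ⟩
    + i * + X⁻ - (+ suc D - + i) * + X⁺
      ≡⟨ cong (λ p → + i * + X⁻ - p * + X⁺) (trans (ℤ.m-n≡m⊖n (suc D) i) (ℤ.⊖-≥ i≤m)) ⟩
    + i * + X⁻ - + (suc D ℕ.∸ i) * + X⁺ ∎)
    where
    open ≡-Reasoning
    split : ∀ a b i → (a + b) * (i - a) ≡ i * b - (a + b - i) * a
    split = solve-∀

  module _ {N} (G : Graph N) (H : HubStructure G) where
    open HubStructure H

    flow-arc-* : ∀ {u v} m n → Adj G u v → Flow G (m ℕ.* n) (λ j → + m * + n * (δℤ u j - δℤ v j))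
    flow-arc-* {u} {v} m n uv = flow-cong G refl (λ j → cong (ℤ._* (δℤ u j - δℤ v j)) (sym (ℤ.pos-* m n))) (flow-arc G (m ℕ.* n) uv)

    module LeafFlows (p q D : ℕ) (p+q≡D : p ℕ.+ q ≡ D) where

      -- Supply of the hubs per unit of leaf mass, times D. A common source sends the shares p to
      -- `a` and q to `b`, while a common sink draws q from `a` and p from `b`. The exchange lets
      -- the supply q X⁻ - p X⁺ of `a` sweep the whole range from -D X⁺ to D X⁻.
      cA dA cB dB : Kind → ℤ
      cA = coeffs 0ℤ 0ℤ (- + p) (- + D) 0ℤ 0ℤ
      dA = coeffs 0ℤ 0ℤ (+ q) (+ D) 0ℤ 0ℤ
      cB = coeffs 0ℤ 0ℤ (- + q) 0ℤ (- + D) 0ℤ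
      dB = coeffs 0ℤ 0ℤ (+ p) 0ℤ (+ D) 0ℤ

      leafNet : Fin N → Kind → ℤ → Fin N → ℤ
      leafNet v k x j = + D * x * δℤ v j + hinge (cA k) (dA k) x * δℤ a j + hinge (cB k) (dB k) x * δℤ b j

      hinge-D : ∀ x → hinge (- + D) (+ D) x ≡ - (+ D * x)
      hinge-D x = trans (factor (+ D) (+ pos x) (+ neg x)) (cong (λ y → - (+ D * y)) (pos-neg x))
        where
        factor : ∀ d m n → - d * m + d * n ≡ - (d * (m - n))
        factor = solve-∀

      pendantFlow : ∀ {v c} x → Adj G v c → Flow G (D ℕ.* ∣ x ∣) (λ j → + D * x * (δℤ v j - δℤ c j))
      pendantFlow {v} (+ n)    vc = flow-arc-* D n vc
      pendantFlow {v} {c} -[1+ n ] vc = flow-cong G refl (λ j → flip (+ D) (+ suc n) (δℤ v j) (δℤ c j))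
        (flow-arc-* D (suc n) (symmetric G vc))
        where
        flip : ∀ d x a b → d * (- x) * (a - b) ≡ d * x * (b - a)
        flip = solve-∀

      no-flow : ∀ v k x → x ≡ + 0 → (∀ j → leafNet v k (+ 0) j ≡ + D * + 0 * δℤ v j + + 0 + + 0) →
        Flow G (D ℕ.* ∣ x ∣) (leafNet v k x)
      no-flow v k .(+ 0) refl net≡ = flow-cong G (sym (ℕ.*-zeroʳ D))
        (λ j → trans (net≡ j) (zero-net (+ D) (δℤ v j))) (stop (λ _ → refl))
        where
        zero-net : ∀ d v → d * + 0 * v + + 0 + + 0 ≡ + 0
        zero-net = solve-∀

      leafFlow : ∀ v k x → lookup κ v ≡ k → (leaf? k ≡ false → x ≡ + 0) → Flow G (D ℕ.* ∣ x ∣) (leafNet v k x)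
      leafFlow v common x κv _ = flow-cong G length value
        (flow-+ G (flow-arc-* p (pos x) (common→a v κv)) (flow-+ G (flow-arc-* q (pos x) (common→b v κv))
          (flow-+ G (flow-arc-* q (neg x) (symmetric G (common→a v κv))) (flow-arc-* p (neg x) (symmetric G (common→b v κv))))))
        where
        collect : ∀ p q m n → p ℕ.* m ℕ.+ (q ℕ.* m ℕ.+ (q ℕ.* n ℕ.+ p ℕ.* n)) ≡ (p ℕ.+ q) ℕ.* (m ℕ.+ n)
        collect = ℕSolver.solve-∀
        length : p ℕ.* pos x ℕ.+ (q ℕ.* pos x ℕ.+ (q ℕ.* neg x ℕ.+ p ℕ.* neg x)) ≡ D ℕ.* ∣ x ∣
        length = trans (collect p q (pos x) (neg x)) (cong₂ ℕ._*_ p+q≡D (pos+neg x))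
        arcs : ∀ p q m n v a b → (p + q) * (m - n) * v + (- p * m + q * n) * a + (- q * m + p * n) * b
          ≡ p * m * (v - a) + (q * m * (v - b) + (q * n * (a - v) + p * n * (b - v)))
        arcs = solve-∀
        value : ∀ j → leafNet v common x j ≡ + p * + pos x * (δℤ v j - δℤ a j) + (+ q * + pos x * (δℤ v j - δℤ b j)
          + (+ q * + neg x * (δℤ a j - δℤ v j) + + p * + neg x * (δℤ b j - δℤ v j)))
        value j =
          trans (cong₂ (λ d y → d * y * δℤ v j + hinge (- + p) (+ q) x * δℤ a j + hinge (- + q) (+ p) x * δℤ b j)
            (cong +_ (sym p+q≡D)) (sym (pos-neg x)))
            (arcs (+ p) (+ q) (+ pos x) (+ neg x) (δℤ v j) (δℤ a j) (δℤ b j))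
      leafFlow v pendant₁ x κv _ = flow-cong G refl (λ j → trans
        (cong (λ y → + D * x * δℤ v j + y * δℤ a j + + 0 * δℤ b j) (hinge-D x))
        (rearrange (+ D * x) (δℤ v j) (δℤ a j) (δℤ b j))) (pendantFlow x (pendant₁→a v κv))
        where
        rearrange : ∀ y v a b → y * v + - y * a + + 0 * b ≡ y * (v - a)
        rearrange = solve-∀
      leafFlow v pendant₂ x κv _ = flow-cong G refl (λ j → trans
        (cong (λ y → + D * x * δℤ v j + + 0 * δℤ a j + y * δℤ b j) (hinge-D x))
        (rearrange (+ D * x) (δℤ v j) (δℤ a j) (δℤ b j))) (pendantFlow x (pendant₂→b v κv))
        where
        rearrange : ∀ y v a b → y * v + + 0 * a + - y * b ≡ y * (v - b)
        rearrange = solve-∀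
      leafFlow v hub₁     x κv x≡0 = no-flow v hub₁ x (x≡0 refl) (λ _ → refl)
      leafFlow v hub₂     x κv x≡0 = no-flow v hub₂ x (x≡0 refl) (λ _ → refl)
      leafFlow v isolated x κv x≡0 = no-flow v isolated x (x≡0 refl) (λ _ → refl)

      module _ (w : Vec ℤ N) (supp : Supported κ w) where

        hubSupply : (c d : Kind → ℤ) → ℤ
        hubSupply c d = sumℤ (λ v → hinge (c (lookup κ v)) (d (lookup κ v)) (lookup w v))

        leavesFlow : Flow G (D ℕ.* ∥ w ∥) (λ j → + D * lookup w j + hubSupply cA dA * δℤ a j + hubSupply cB dB * δℤ b j)
        leavesFlow = flow-cong G (sum-∥∥ D w) value
          (flow-∑ G N (λ v → D ℕ.* ∣ lookup w v ∣) (λ v → leafNet v (lookup κ v) (lookup w v))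
            (λ v → leafFlow v (lookup κ v) (lookup w v) refl (supp v)))
          where
          value : ∀ j → + D * lookup w j + hubSupply cA dA * δℤ a j + hubSupply cB dB * δℤ b j
            ≡ sumℤ (λ v → leafNet v (lookup κ v) (lookup w v) j)
          value j = sym (begin
            sumℤ (λ v → X v + A v * δℤ a j + B v * δℤ b j)
              ≡⟨ ∑-distrib-+ (λ v → X v + A v * δℤ a j) (λ v → B v * δℤ b j) ⟩
            sumℤ (λ v → X v + A v * δℤ a j) + sumℤ (λ v → B v * δℤ b j)
              ≡⟨ cong₂ ℤ._+_ (∑-distrib-+ X (λ v → A v * δℤ a j)) (sym (*-distribʳ-sum (δℤ b j) B)) ⟩
            sumℤ X + sumℤ (λ v → A v * δℤ a j) + hubSupply cB dB * δℤ b j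
              ≡⟨ cong₂ (λ s t → s + t + hubSupply cB dB * δℤ b j)
                   (sum-*δℤ (λ v → + D * lookup w v) j) (sym (*-distribʳ-sum (δℤ a j) A)) ⟩
            + D * lookup w j + hubSupply cA dA * δℤ a j + hubSupply cB dB * δℤ b j ∎)
            where
            open ≡-Reasoning
            X A B : Fin N → ℤ
            X v = + D * lookup w v * δℤ v j
            A v = hinge (cA (lookup κ v)) (dA (lookup κ v)) (lookup w v)
            B v = hinge (cB (lookup κ v)) (dB (lookup κ v)) (lookup w v)

      -- Each unit uses two arcs, from one hub to `c` and from `c` to the other; the sign of `t`
      -- gives the direction.
      excessFlow : ∀ c → lookup κ c ≡ common → ∀ t → Flow G (D ℕ.* (2 ℕ.* ∣ t ∣)) (λ j → + D * t * (δℤ a j - δℤ b j))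
      excessFlow c κc (+ n) = flow-cong G (twice D n) (λ j → value j)
        (flow-+ G (flow-arc-* D n (symmetric G (common→a c κc))) (flow-arc-* D n (common→b c κc)))
        where
        twice : ∀ d n → d ℕ.* n ℕ.+ d ℕ.* n ≡ d ℕ.* (2 ℕ.* n)
        twice = ℕSolver.solve-∀
        path : ∀ x a b c → x * (a - b) ≡ x * (a - c) + x * (c - b)
        path = solve-∀
        value : ∀ j → + D * + n * (δℤ a j - δℤ b j) ≡ + D * + n * (δℤ a j - δℤ c j) + + D * + n * (δℤ c j - δℤ b j)
        value j = path (+ D * + n) (δℤ a j) (δℤ b j) (δℤ c j)
      excessFlow c κc -[1+ n ] = flow-cong G (twice D (suc n)) (λ j → value j)
        (flow-+ G (flow-arc-* D (suc n) (symmetric G (common→b c κc))) (flow-arc-* D (suc n) (common→a c κc)))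
        where
        twice : ∀ d n → d ℕ.* n ℕ.+ d ℕ.* n ≡ d ℕ.* (2 ℕ.* n)
        twice = ℕSolver.solve-∀
        path : ∀ d x a b c → d * (- x) * (a - b) ≡ d * x * (b - c) + d * x * (c - a)
        path = solve-∀
        value : ∀ j → + D * -[1+ n ] * (δℤ a j - δℤ b j) ≡ + D * + suc n * (δℤ b j - δℤ c j) + + D * + suc n * (δℤ c j - δℤ a j)
        value j = path (+ D) (+ suc n) (δℤ a j) (δℤ b j) (δℤ c j)

-- Every listed vector is a lattice point of the dilated polytope.

module Sound where

  open import Data.Integer.Base as ℤ using (ℤ; _+_; _-_; _*_; -_; +_; -[1+_]; ∣_∣)
  open import Data.Integer.Tactic.RingSolver using (solve-∀)
  open import Data.List.Membership.Propositional using (_∈_)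
  open import Data.List.Relation.Unary.All as All using (All; []; _∷_)
  open import Data.Rational.Base using (0ℚ; _<_)
  import Data.Rational.Base as ℚ
  import Data.Rational.Properties as ℚ
  open import Data.Vec.Base using (Vec; []; _∷_; lookup)
  open Embedding using (ι)
  open Kinds
  open LeafVectors
  open Points
  open Hubs
  open Flows
  open Sufficiency

  module _ {N} (G : Graph N) (H : HubStructure G) (s : ℕ) (w : Vec ℤ N) (i : ℕ)
           (supp : Supported (HubStructure.κ H) w) (∥w∥≤s : ∥ w ∥ ℕ.≤ s) (i<width : i ℕ.< width (HubStructure.κ H) s w) where
    open HubStructure H

    -- Of the demand, i₀ − X⁺ is met by the common vertices and t = r − h passes from hub to hub.
    X⁺ X⁻ m h i₀ r : ℕ
    X⁺ = posSum κ common w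
    X⁻ = negSum κ common w
    m  = commonMass κ w
    h  = excess κ s w
    i₀ = m ℕ.⊓ i
    r  = i ℕ.∸ m

    t y : ℤ
    t = + r - + h
    y = demand κ s w i

    y-split : y ≡ (+ i₀ - + X⁺) + t
    y-split = trans (cong (λ n → + n - + (X⁺ ℕ.+ h)) (sym (ℕ.m⊓n+n∸m≡n m i))) (rearrange (+ i₀) (+ r) (+ X⁺) (+ h))
      where
      rearrange : ∀ i r x h → (i + r) - (x + h) ≡ (i - x) + (r - h)
      rearrange = solve-∀

    -- Since i ≤ m + 2h, the part `r` of the index beyond m lies between 0 and 2h. The split need
    -- not be the cheapest: for i ≤ m it always passes h units from `hub₂` to `hub₁`. The bound by h
    -- is what the budget s requires.
    ∣t∣≤h : ∣ t ∣ ℕ.≤ h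
    ∣t∣≤h = ∣r-h∣≤h r h (ℕ.m≤n+o⇒m∸n≤o i m (ℕ.s≤s⁻¹ i<width))

    weight : ℕ
    weight = ∥ w ∥ ℕ.+ 2 ℕ.* ∣ t ∣

    weight≤s : weight ℕ.≤ s
    weight≤s = subst (weight ℕ.≤_) (ℕ.m+[n∸m]≡n ∥w∥≤s)
      (ℕ.+-monoʳ-≤ ∥ w ∥ (ℕ.≤-trans (ℕ.*-monoʳ-≤ 2 ∣t∣≤h) (double-halfSlack (commonCount κ) (s ℕ.∸ ∥ w ∥))))

    indicator : ∀ {c} k → lookup κ c ≡ k → (∀ v → lookup κ v ≡ k → v ≡ c) → ∀ v → δℤ c v ≡ (if same k (lookup κ v) then + 1 else + 0)
    indicator {c} k κc only v with c Fin.≟ v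
    ... | yes refl rewrite κc | same-refl k = refl
    ... | no c≢v with same k (lookup κ v) in eq
    ...   | true  = contradiction (sym (only v (sym (same⇒≡ k (lookup κ v) eq)))) c≢v
    ...   | false = refl

    split : ∃ λ D → ∃₂ λ p q → p ℕ.+ q ≡ suc D × + suc D * (+ i₀ - + X⁺) ≡ + q * + X⁻ - + p * + X⁺
    split = proportion X⁺ X⁻ i₀ (ℕ.m⊓n≤m m i)

    D p q : ℕ
    D = proj₁ split
    p = proj₁ (proj₂ split)
    q = proj₁ (proj₂ (proj₂ split))
    p+q≡D : p ℕ.+ q ≡ suc D
    p+q≡D = proj₁ (proj₂ (proj₂ (proj₂ split)))
    balance : + suc D * (+ i₀ - + X⁺) ≡ + q * + X⁻ - + p * + X⁺
    balance = proj₂ (proj₂ (proj₂ (proj₂ split)))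

    open LeafFlows G H p q (suc D) p+q≡D

    P₁ Q₁ P₂ Q₂ d y₀ : ℤ
    P₁ = + posSum κ pendant₁ w
    Q₁ = + negSum κ pendant₁ w
    P₂ = + posSum κ pendant₂ w
    Q₂ = + negSum κ pendant₂ w
    d  = + suc D
    y₀ = + i₀ - + X⁺

    excess-flow : Flow G (suc D ℕ.* (2 ℕ.* ∣ t ∣)) (λ j → d * t * (δℤ a j - δℤ b j))
    excess-flow = go (commonCount κ) refl
      where
      go : ∀ K → commonCount κ ≡ K → Flow G (suc D ℕ.* (2 ℕ.* ∣ t ∣)) (λ j → d * t * (δℤ a j - δℤ b j))
      go (suc k) K≡ = let c , κc = common-exists κ K≡ in excessFlow c κc t
      -- Without a common vertex there is no path between the hubs, but then h = 0 forces t = 0.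
      go zero K≡0 = flow-cong G (sym (trans (cong (λ n → suc D ℕ.* (2 ℕ.* n)) (cong ∣_∣ t≡0)) (ℕ.*-zeroʳ (suc D))))
        (λ j → trans (cong (λ t → d * t * (δℤ a j - δℤ b j)) t≡0) (vanish d (δℤ a j - δℤ b j))) (stop (λ _ → refl))
        where
        vanish : ∀ d x → d * + 0 * x ≡ + 0
        vanish = solve-∀
        h≡0 : h ≡ 0
        h≡0 = cong (λ K → halfSlack K (s ℕ.∸ ∥ w ∥)) K≡0
        t≡0 : t ≡ + 0
        t≡0 = ℤ.∣i∣≡0⇒i≡0 (ℕ.n≤0⇒n≡0 (subst (∣ t ∣ ℕ.≤_) h≡0 ∣t∣≤h))

    -- The common and pendant leaves together draw q X⁻ - p X⁺ - d (P₁ - Q₁) from `a`, and the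
    -- proportion p : q was chosen so that the first part is d y₀.
    supplyA : hubSupply w supp cA dA ≡ d * (y₀ - (P₁ - Q₁))
    supplyA = trans (sum-hinge κ cA dA w) (trans
      (collect (+ p) (+ q) d (+ posSum κ hub₁ w) (+ negSum κ hub₁ w) (+ posSum κ hub₂ w) (+ negSum κ hub₂ w) (+ X⁺) (+ X⁻) P₁ Q₁ P₂ Q₂
        (+ posSum κ isolated w) (+ negSum κ isolated w))
      (trans (cong (ℤ._- d * (P₁ - Q₁)) (sym balance)) (factor d y₀ (P₁ - Q₁))))
      where
      collect : ∀ p q d a a′ b b′ x y p₁ q₁ p₂ q₂ i i′ →
        (+ 0 * a + + 0 * a′) + (+ 0 * b + + 0 * b′) + (- p * x + q * y)
          + (- d * p₁ + d * q₁) + (+ 0 * p₂ + + 0 * q₂) + (+ 0 * i + + 0 * i′)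
        ≡ q * y - p * x - d * (p₁ - q₁)
      collect = solve-∀
      factor : ∀ d y z → d * y - d * z ≡ d * (y - z)
      factor = solve-∀

    -- As p + q is the denominator d, the common part p X⁻ - q X⁺ equals -(q X⁻ - p X⁺) - d (X⁺ -
    -- X⁻), which `balance` evaluates again.
    supplyB : hubSupply w supp cB dB ≡ - (d * (y₀ + (+ X⁺ - + X⁻) + (P₂ - Q₂)))
    supplyB = trans (sum-hinge κ cB dB w) (trans
      (collect (+ p) (+ q) d (+ posSum κ hub₁ w) (+ negSum κ hub₁ w) (+ posSum κ hub₂ w) (+ negSum κ hub₂ w) (+ X⁺) (+ X⁻) P₁ Q₁ P₂ Q₂
        (+ posSum κ isolated w) (+ negSum κ isolated w))
      (trans (cong (λ e → - e - (+ p + + q) * (+ X⁺ - + X⁻) - d * (P₂ - Q₂)) (sym balance))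
        (trans (cong (λ e → - (d * y₀) - e * (+ X⁺ - + X⁻) - d * (P₂ - Q₂)) (cong +_ p+q≡D))
          (factor d y₀ (+ X⁺ - + X⁻) (P₂ - Q₂)))))
      where
      collect : ∀ p q d a a′ b b′ x y p₁ q₁ p₂ q₂ i i′ →
        (+ 0 * a + + 0 * a′) + (+ 0 * b + + 0 * b′) + (- q * x + p * y)
          + (+ 0 * p₁ + + 0 * q₁) + (- d * p₂ + d * q₂) + (+ 0 * i + + 0 * i′)
        ≡ - (q * y - p * x) - (p + q) * (x - y) - d * (p₂ - q₂)
      collect = solve-∀
      factor : ∀ d y c z → - (d * y) - d * c - d * z ≡ - (d * (y + c + z))
      factor = solve-∀

    value : ∀ j → d * lookup (place κ w y) j ≡
      d * lookup w j + hubSupply w supp cA dA * δℤ a j + hubSupply w supp cB dB * δℤ b j + d * t * (δℤ a j - δℤ b j)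
    value j = trans (cong (d ℤ.*_) (trans (lookup-place κ w y j) (cong (λ y → placeAt κ y w (lookup κ j) (lookup w j)) y-split)))
      (trans (at (lookup κ j) (lookup w j) (supp j))
        (combine (lookup w j) (sym supplyA) (sym supplyB) (sym (indicator hub₁ κa only-a j)) (sym (indicator hub₂ κb only-b j))))
      where
      π₁ π₂ σ : ℤ
      π₁ = P₁ - Q₁
      π₂ = P₂ - Q₂
      σ = + X⁺ - + X⁻
      rhs : (x A B δ₁ δ₂ : ℤ) → ℤ
      rhs x A B δ₁ δ₂ = d * x + A * δ₁ + B * δ₂ + d * t * (δ₁ - δ₂)
      combine : ∀ x {A A′ B B′ δ₁ δ₁′ δ₂ δ₂′} → A ≡ A′ → B ≡ B′ → δ₁ ≡ δ₁′ → δ₂ ≡ δ₂′ → rhs x A B δ₁ δ₂ ≡ rhs x A′ B′ δ₁′ δ₂′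
      combine x refl refl refl refl = refl
      at-hub₁ : ∀ d y t p e → d * (y + t - p) ≡ d * + 0 + d * (y - p) * + 1 + e * + 0 + d * t * + 1
      at-hub₁ = solve-∀
      at-hub₂ : ∀ d y t c p e → d * - (y + t + c + p)
        ≡ d * + 0 + e * + 0 + - (d * (y + c + p)) * + 1 + d * t * -[1+ 0 ]
      at-hub₂ = solve-∀
      at-leaf : ∀ d t x A B → d * x ≡ d * x + A * + 0 + B * + 0 + d * t * + 0
      at-leaf = solve-∀
      A B : ℤ
      A = d * (y₀ - π₁)
      B = - (d * (y₀ + σ + π₂))
      at : ∀ k x → (leaf? k ≡ false → x ≡ + 0) → d * placeAt κ (y₀ + t) w k x
        ≡ rhs x A B (if same hub₁ k then + 1 else + 0) (if same hub₂ k then + 1 else + 0)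
      at hub₁      x x≡0 = trans (at-hub₁ d y₀ t π₁ B) (cong (λ x → rhs x A B (+ 1) (+ 0)) (sym (x≡0 refl)))
      at hub₂      x x≡0 = trans (at-hub₂ d y₀ t σ π₂ A) (cong (λ x → rhs x A B (+ 0) (+ 1)) (sym (x≡0 refl)))
      at common    x _ = at-leaf d t x A B
      at pendant₁  x _ = at-leaf d t x A B
      at pendant₂  x _ = at-leaf d t x A B
      at isolated  x _ = at-leaf d t x A B

    point-flow : Flow G (suc D ℕ.* weight) (λ j → + suc D * lookup (place κ w y) j)
    point-flow = flow-cong G (sym (ℕ.*-distribˡ-+ (suc D) ∥ w ∥ (2 ℕ.* ∣ t ∣))) value
      (flow-+ G (leavesFlow w supp) excess-flow)

    lattice-with-edge : ∀ {u v} → Adj G u v → LatticePoint (Dilate s (SymmetricEdgePolytope G)) (place κ w y)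
    lattice-with-edge uv = short-flow⇒lattice G uv D (place κ w y) weight≤s point-flow

  module _ {N} (G : Graph N) (H : HubStructure G) where
    open HubStructure H

    leaf-edge : ∀ v → leaf? (lookup κ v) ≡ true → ∃ λ u → Adj G v u
    leaf-edge v leaf with lookup κ v in κv
    ... | common   = a , common→a v κv
    ... | pendant₁ = a , pendant₁→a v κv
    ... | pendant₂ = b , pendant₂→b v κv

    module _ (none : ∀ v → leaf? (lookup κ v) ≡ false) where

      edgeless : Edgeless G
      edgeless u v uv = All.lookup leaf-endpoint (incident u v uv) (none u , none v)
        where
        leaf-endpoint : All (λ (k , l) → ¬ (leaf? k ≡ false × leaf? l ≡ false)) incidentPairs
        leaf-endpoint = (λ ()) ∷ (λ ()) ∷ (λ ()) ∷ (λ ()) ∷ (λ ()) ∷ (λ ()) ∷ (λ ()) ∷ (λ ()) ∷ []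

      absent : ∀ k → leaf? k ≡ true → ∀ v → lookup κ v ≢ k
      absent k leaf v refl = contradiction (trans (sym leaf) (none v)) λ ()

      -- Without leaves all masses vanish and the width is 1, so the list holds only the origin, in
      -- accordance with the convention that the polytope is {0}.
      place-zero : ∀ s w i → Supported κ w → i ℕ.< width κ s w → ∀ v → lookup (place κ w (demand κ s w i)) v ≡ + 0
      place-zero s w i supp i<width v = trans (lookup-place κ w (demand κ s w i) v)
        (trans (cong (λ y → placeAt κ y w (lookup κ v) (lookup w v)) demand≡0) (at (lookup κ v) (supp v (none v))))
        where
        no-mass : ∀ k → leaf? k ≡ true → mass κ k w ≡ 0
        no-mass k leaf = absent-mass κ k (absent k leaf) w
        no-posSum : ∀ k → leaf? k ≡ true → posSum κ k w ≡ 0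
        no-posSum k leaf = ℕ.m+n≡0⇒m≡0 (posSum κ k w) (no-mass k leaf)
        no-net : ∀ k → leaf? k ≡ true → net κ k w ≡ + 0
        no-net k leaf = cong₂ (λ p q → + p - + q) (no-posSum k leaf) (ℕ.m+n≡0⇒n≡0 (posSum κ k w) (no-mass k leaf))
        excess≡0 : excess κ s w ≡ 0
        excess≡0 = go (commonCount κ) refl
          where
          go : ∀ K → commonCount κ ≡ K → halfSlack K (s ℕ.∸ ∥ w ∥) ≡ 0
          go zero    _  = refl
          go (suc k) K≡ = let c , κc = common-exists κ K≡ in contradiction κc (absent common refl c)
        i≡0 : i ≡ 0
        i≡0 = ℕ.n≤0⇒n≡0 (ℕ.s≤s⁻¹ (subst (i ℕ.<_) (cong₂ (λ m e → suc (m ℕ.+ 2 ℕ.* e)) (no-mass common refl) excess≡0) i<width))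
        demand≡0 : demand κ s w i ≡ + 0
        demand≡0 = cong₂ (λ i x → + i - + x) i≡0 (cong₂ ℕ._+_ (no-posSum common refl) excess≡0)
        at : ∀ k {x} → x ≡ + 0 → placeAt κ (+ 0) w k x ≡ + 0
        at hub₁      _   = cong (λ p → + 0 - p) (no-net pendant₁ refl)
        at hub₂      _   = cong₂ (λ c p → - (+ 0 + c + p)) (no-net common refl) (no-net pendant₂ refl)
        at common    x≡0 = x≡0
        at pendant₁  x≡0 = x≡0
        at pendant₂  x≡0 = x≡0
        at isolated  x≡0 = x≡0

      lattice-without-edge : ∀ s z → (∀ v → lookup z v ≡ + 0) → LatticePoint (Dilate s (SymmetricEdgePolytope G)) z
      lattice-without-edge s z z≡0 = 0ⱽ , inj₂ (edgeless , λ i → mk≈ (λ ε 0<ε → 0 , λ _ _ → close G 0ℚ 0ℚ refl 0<ε))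
        , λ v → mk≈ (λ ε 0<ε → 0 , λ _ _ → close G (ι (lookup z v)) (ι (+ s) ℚ.* 0ℚ) (at v) 0<ε)
        where
        at : ∀ v → ι (lookup z v) ≡ ι (+ s) ℚ.* 0ℚ
        at v = trans (cong ι (z≡0 v)) (sym (ℚ.*-zeroʳ (ι (+ s))))

    -- Padding a flow requires some edge, and any leaf provides one; without leaves the graph is
    -- edgeless.
    points-sound : ∀ s z → z ∈ points κ s → LatticePoint (Dilate s (SymmetricEdgePolytope G)) z
    points-sound s z z∈ = subst (LatticePoint (Dilate s (SymmetricEdgePolytope G))) (sym z≡) placed
      where
      decomposed = ∈-points⁻ κ s z∈
      w = proj₁ decomposed
      i = proj₁ (proj₂ decomposed)
      supp = proj₁ (proj₂ (proj₂ decomposed))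
      ∥w∥≤s = proj₁ (proj₂ (proj₂ (proj₂ decomposed)))
      i<width = proj₁ (proj₂ (proj₂ (proj₂ (proj₂ decomposed))))
      z≡ : z ≡ place κ w (demand κ s w i)
      z≡ = proj₂ (proj₂ (proj₂ (proj₂ (proj₂ decomposed))))
      placed : LatticePoint (Dilate s (SymmetricEdgePolytope G)) (place κ w (demand κ s w i))
      placed = [ (λ leaf → lattice-with-edge G H s w i supp ∥w∥≤s i<width (proj₂ (leaf-edge (proj₁ leaf) (proj₂ leaf))))
               , (λ none → lattice-without-edge none s (place κ w (demand κ s w i)) (place-zero none s w i supp i<width)) ]′
               (leaf-or-none κ)

-- The Ehrhart polynomial in terms of `M`, and its roots.

module EhrhartRoots where

  open import Data.Integer.Base as ℤ using (+_)
  open import Data.List.Base using (List; length)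
  open import Data.List.Membership.Propositional using (_∈_)
  open import Data.List.Membership.Propositional.Properties.WithK using (unique∧set⇒bag)
  open import Data.List.Relation.Binary.BagAndSetEquality using (∼bag⇒↭)
  open import Data.List.Relation.Binary.Permutation.Propositional.Properties using (↭-length)
  open import Data.List.Relation.Unary.Unique.Propositional using (Unique)
  open import Data.Nat.Base as ℕ using (ℕ; zero; suc; _!)
  open import Data.Rational.Base using (_+_; _*_)
  open import Data.Rational.Properties using (*-assoc)
  open import Function.Bundles using (_⇔_; mk⇔; module Equivalence)
  open Sequences using (L)
  open Polynomials
  open CrossPolytopes
  open Roots
  open Kinds
  open LeafVectors
  open Points
  open Hubs
  open Necessity using (constraints)
  open Complete using (points-complete)
  open Sound using (points-sound)

  length-determined : ∀ {A : Set} {xs ys : List A} → Unique xs → Unique ys →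
    (∀ {x} → x ∈ xs ⇔ x ∈ ys) → length xs ≡ length ys
  length-determined unique-xs unique-ys same-members =
    ↭-length (∼bag⇒↭ (unique∧set⇒bag unique-xs unique-ys same-members))

  module _ {N} (G : Graph N) (S : HubStructure G) where
    open HubStructure S

    -- Dual inequalities and flows show that the given list and `points κ s` have the same members,
    -- and duplicate-free lists with the same members have the same length.
    cardinality : ∀ s k → HasCardinality (LatticePoint (Dilate s (SymmetricEdgePolytope G))) k → k ≡ pointCount κ s
    cardinality s k (xs , unique , members , length≡k) = trans (sym length≡k)
      (trans (length-determined unique (points-unique κ s a κa)
        (λ {z} → mk⇔
          (λ z∈xs → points-complete κ only-a only-b s z (constraints G S s z (Equivalence.to (members z) z∈xs)))
          (λ z∈points → Equivalence.from (members z) (points-sound G S s z z∈points))))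
        (points-length κ s))

    module _ (H : ℚ[X]) (ehrhart : IsEhrhartPolynomial (SymmetricEdgePolytope G) H) where

      evalℚ-ehrhart : ∀ s → evalℚ H (ιⁿ s) ≡ ιⁿ (pointCount κ s)
      evalℚ-ehrhart s = trans (proj₂ (proj₂ (ehrhart s)))
        (cong ιⁿ (cardinality s (proj₁ (ehrhart s)) (proj₁ (proj₂ (ehrhart s)))))

      forest-on-line : commonCount κ ≡ 0 → ∀ z → evalℂ H z ≈ᶜ 0ᶜ → CriticalLine z
      forest-on-line K≡0 = M-on-line H (ιⁿ (d !)) d λ s → begin
        ιⁿ (d !) * evalℚ H (ιⁿ s) ≡⟨ cong (ιⁿ (d !) *_) (trans (evalℚ-ehrhart s) (cong ιⁿ (pointCount-forest κ K≡0 s))) ⟩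
        ιⁿ (d !) * ιⁿ (L d s) ≡⟨ sym (ιⁿ-* (d !) (L d s)) ⟩
        ιⁿ (d ! ℕ.* L d s) ≡⟨ sym (evalℚ-M d s) ⟩
        evalℚ (M d) (ιⁿ s) ∎
        where
        open ≡-Reasoning
        d = pendantCount κ

      common-on-line : ∀ k → commonCount κ ≡ suc k → ∀ z → evalℂ H z ≈ᶜ 0ᶜ → CriticalLine z
      common-on-line k K≡1+k = combination-on-line H (ιⁿ c) r (2 ℕ.+ k) β λ s → begin
        ιⁿ c * evalℚ H (ιⁿ s)
          ≡⟨ cong (ιⁿ c *_) (evalℚ-ehrhart s) ⟩
        ιⁿ c * ιⁿ (pointCount κ s)
          ≡⟨ sym (ιⁿ-* c (pointCount κ s)) ⟩
        ιⁿ (c ℕ.* pointCount κ s)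
          ≡⟨ cong ιⁿ (scale s) ⟩
        ιⁿ (value s)
          ≡⟨ sym (evaluate s) ⟩
        evalℚ (ιⁿ (2 ℕ.+ k) ·ₚ [2X+1]· M (suc r) +ₚ ιⁿ (suc β) ·ₚ M r) (ιⁿ s) ∎
        where
        open ≡-Reasoning
        p = pendantCount κ
        r = k ℕ.+ p
        -- The factor 2 (2 + r) comes from `pointCount-common`, and (r+1)! turns L_{r+1} into
        -- `M (suc r)`. Since (r+1)! L_r is r + 1 times the value of `M r`, the second coefficient
        -- is (1 + r)(2 + r + p), which is `suc β`.
        c = suc r ! ℕ.* (2 ℕ.* (2 ℕ.+ r))
        β = 1 ℕ.+ r ℕ.+ p ℕ.+ r ℕ.* (2 ℕ.+ r ℕ.+ p)
        value : ℕ → ℕ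
        value s = (2 ℕ.+ k) ℕ.* ((2 ℕ.* s ℕ.+ 1) ℕ.* (suc r ! ℕ.* L (suc r) s)) ℕ.+ suc β ℕ.* (r ! ℕ.* L r s)
        scale : ∀ s → c ℕ.* pointCount κ s ≡ value s
        scale s = begin
          suc r ! ℕ.* (2 ℕ.* (2 ℕ.+ r)) ℕ.* pointCount κ s
            ≡⟨ ℕ.*-assoc (suc r !) (2 ℕ.* (2 ℕ.+ r)) (pointCount κ s) ⟩
          suc r ! ℕ.* (2 ℕ.* (2 ℕ.+ r) ℕ.* pointCount κ s)
            ≡⟨ cong (suc r ! ℕ.*_) (pointCount-common κ k K≡1+k s) ⟩
          suc r ! ℕ.* ((2 ℕ.+ k) ℕ.* ((2 ℕ.* s ℕ.+ 1) ℕ.* L (suc r) s) ℕ.+ (2 ℕ.+ r ℕ.+ p) ℕ.* L r s)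
            ≡⟨ distribute r k p s (r !) (L (suc r) s) (L r s) ⟩
          value s ∎
          where
          distribute : ∀ r k p s f a b →
            (1 ℕ.+ r) ℕ.* f ℕ.* ((2 ℕ.+ k) ℕ.* ((2 ℕ.* s ℕ.+ 1) ℕ.* a) ℕ.+ (2 ℕ.+ r ℕ.+ p) ℕ.* b)
            ≡ (2 ℕ.+ k) ℕ.* ((2 ℕ.* s ℕ.+ 1) ℕ.* ((1 ℕ.+ r) ℕ.* f ℕ.* a))
              ℕ.+ (1 ℕ.+ (1 ℕ.+ r ℕ.+ p ℕ.+ r ℕ.* (2 ℕ.+ r ℕ.+ p))) ℕ.* (f ℕ.* b)
          distribute = ℕSolver.solve-∀
        evaluate : ∀ s → evalℚ (ιⁿ (2 ℕ.+ k) ·ₚ [2X+1]· M (suc r) +ₚ ιⁿ (suc β) ·ₚ M r) (ιⁿ s) ≡ ιⁿ (value s)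
        evaluate s = begin
          evalℚ (ιⁿ (2 ℕ.+ k) ·ₚ [2X+1]· M (suc r) +ₚ ιⁿ (suc β) ·ₚ M r) (ιⁿ s)
            ≡⟨ evalℚ-+ (ιⁿ (2 ℕ.+ k) ·ₚ [2X+1]· M (suc r)) (ιⁿ (suc β) ·ₚ M r) (ιⁿ s) ⟩
          evalℚ (ιⁿ (2 ℕ.+ k) ·ₚ [2X+1]· M (suc r)) (ιⁿ s) + evalℚ (ιⁿ (suc β) ·ₚ M r) (ιⁿ s)
            ≡⟨ cong₂ _+_ first (trans (evalℚ-· (ιⁿ (suc β)) (M r) (ιⁿ s))
                 (trans (cong (ιⁿ (suc β) *_) (evalℚ-M r s)) (sym (ιⁿ-* (suc β) (r ! ℕ.* L r s))))) ⟩
          ιⁿ ((2 ℕ.+ k) ℕ.* ((2 ℕ.* s ℕ.+ 1) ℕ.* (suc r ! ℕ.* L (suc r) s))) + ιⁿ (suc β ℕ.* (r ! ℕ.* L r s))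
            ≡⟨ sym (ιⁿ-+ ((2 ℕ.+ k) ℕ.* ((2 ℕ.* s ℕ.+ 1) ℕ.* (suc r ! ℕ.* L (suc r) s))) (suc β ℕ.* (r ! ℕ.* L r s))) ⟩
          ιⁿ (value s) ∎
          where
          first : evalℚ (ιⁿ (2 ℕ.+ k) ·ₚ [2X+1]· M (suc r)) (ιⁿ s)
                ≡ ιⁿ ((2 ℕ.+ k) ℕ.* ((2 ℕ.* s ℕ.+ 1) ℕ.* (suc r ! ℕ.* L (suc r) s)))
          first = begin
            evalℚ (ιⁿ (2 ℕ.+ k) ·ₚ [2X+1]· M (suc r)) (ιⁿ s)
              ≡⟨ evalℚ-· (ιⁿ (2 ℕ.+ k)) ([2X+1]· M (suc r)) (ιⁿ s) ⟩
            ιⁿ (2 ℕ.+ k) * evalℚ ([2X+1]· M (suc r)) (ιⁿ s)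
              ≡⟨ cong (ιⁿ (2 ℕ.+ k) *_) (trans (evalℚ-[2X+1] (M (suc r)) (ιⁿ s)) (cong₂ _*_ (2s+1 s) (evalℚ-M (suc r) s))) ⟩
            ιⁿ (2 ℕ.+ k) * (ιⁿ (2 ℕ.* s ℕ.+ 1) * ιⁿ (suc r ! ℕ.* L (suc r) s))
              ≡⟨ cong (ιⁿ (2 ℕ.+ k) *_) (sym (ιⁿ-* (2 ℕ.* s ℕ.+ 1) (suc r ! ℕ.* L (suc r) s))) ⟩
            ιⁿ (2 ℕ.+ k) * ιⁿ ((2 ℕ.* s ℕ.+ 1) ℕ.* (suc r ! ℕ.* L (suc r) s))
              ≡⟨ sym (ιⁿ-* (2 ℕ.+ k) ((2 ℕ.* s ℕ.+ 1) ℕ.* (suc r ! ℕ.* L (suc r) s))) ⟩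
            ιⁿ ((2 ℕ.+ k) ℕ.* ((2 ℕ.* s ℕ.+ 1) ℕ.* (suc r ! ℕ.* L (suc r) s))) ∎

      roots-on-critical-line : ∀ z → evalℂ H z ≈ᶜ 0ᶜ → CriticalLine z
      roots-on-critical-line = [ forest-on-line , (λ (k , K≡1+k) → common-on-line k K≡1+k) ]′ (zero-or-suc (commonCount κ))
        where
        zero-or-suc : ∀ n → n ≡ 0 ⊎ ∃ λ k → n ≡ suc k
        zero-or-suc zero    = inj₁ refl
        zero-or-suc (suc k) = inj₂ (k , refl)

open Hubs using (hubs)
open EhrhartRoots using (roots-on-critical-line)

theorem4p12 : ∀ (n N : ℕ) (G : Graph N) → BipartiteOfType 2 n G →
    ∀ (H : ℚ[X]) → IsEhrhartPolynomial (SymmetricEdgePolytope G) H →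
    ∀ (z : ℂ) → evalℂ H z ≈ᶜ 0ᶜ → CriticalLine z
theorem4p12 n N G bipartite = roots-on-critical-line G (hubs G bipartite)
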